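{- Let $G$ be a finite, simple, connected, undirected graph. Then the halved doubled Lovász complex $\mathsf{HDL}(G)$ is a strong $\mathbb{Z}_2$-deformation retract of the box complex $\mathsf{B}(G)$. That is, regarding $\|\mathsf{HDL}(G)\|$ as a subspace of $\|\mathsf{B}(G)\|=\|\mathrm{ssd}(\mathsf{B}(G))\|$, where $\mathrm{ssd}(\mathsf{B}(G))$ is the shore subdivision of $\mathsf{B}(G)$, the space $\|\mathsf{HDL}(G)\|$ is a strong $\mathbb{Z}_2$-deformation retract of $\|\mathsf{B}(G)\|$.
   Context: $V(G)$ is the node set of $G$. For $A\subseteq V(G)$, $\mathrm{CN}(A)$ is the set of all nodes adjacent to every $a\in A$, with $\mathrm{CN}(\emptyset)=V(G)$; $\mathrm{CN}^2(A)=\mathrm{CN}(\mathrm{CN}(A))$. The neighborhood complex $\mathsf{N}(G)$ is the abstract simplicial complex whose simplices are the sets $A\subseteq V(G)$ with $\mathrm{CN}(A)\ne\emptyset$. A chain $\mathcal{A}$ is a (possibly empty) family $A_1\subset\dots\subset A_p$ of strictly increasing subsets of $V(G)$. For sets $A,B$ put $A\uplus B:=\{(a,0):a\in A\}\cup\{(b,1):b\in B\}$. $\|K\|$ denotes the geometric realization of a simplicial complex $K$. Lovász complex: $\mathsf{L}(G)$ is the subcomplex of the barycentric subdivision $\mathrm{sd}(\mathsf{N}(G))$ induced by the fixed points of $\mathrm{CN}^2$. That is, its vertices are the nonempty sets $A\subseteq V(G)$ with $\mathrm{CN}(A)\ne\emptyset$ and $\mathrm{CN}^2(A)=A$, and its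 simplices are the chains of such sets. Box complex: $\mathsf{B}(G):=\{A\uplus B: A,B\in\mathsf{N}(G),\ A\subseteq\mathrm{CN}(B),\ B\subseteq\mathrm{CN}(A)\}$, with the free simplicial $\mathbb{Z}_2$-action $A\uplus B\mapsto B\uplus A$. Its two shores are the subcomplexes induced by the vertices $(v,0)$ and by the vertices $(v,1)$, respectively. Shore subdivision: $\mathrm{ssd}(\mathsf{B}(G))$ is the simplicial complex consisting of the simplices of the joins $\mathrm{sd}(\sigma\cap K_1)*\mathrm{sd}(\sigma\cap K_2)$, $\sigma\in\mathsf{B}(G)$, where $K_1,K_2$ are the two shores. Explicitly: its vertices are denoted $A\uplus\emptyset$ (first shore) and $\emptyset\uplus A$ (second shore), for $\emptyset\neq A\subseteq V(G)$ with $\mathrm{CN}(A)\neq\emptyset$. Its simplices are denoted $\mathcal{A}\uplus\mathcal{B}$, spanned by the vertices $A\uplus\emptyset$ ($A\in\mathcal{A}$) and $\emptyset\uplus B$ ($B\in\mathcal{B}$), where $\mathcal{A},\mathcal{B}$ are chains of such sets with $A\subseteq\mathrm{CN}(B)$ for all $A\in\mathcal{A}$, $B\in\mathcal{B}$. Its $\mathbb{Z}_2$-action interchanges $A\uplus\emptyset$ and $\emptyset\uplus A$. It is a subdivision of $\mathsf{B}(G)$: $\|\mathrm{ssd}(\mathsf{B}(G))\|$ is identified $\mathbb{Z}_2$-equivariantly with $\|\mathsf{B}(G)\|$ by placing each vertex $A\uplus\emptyset$ (resp. $\emptyset\uplus A$) at the barycenter of the simplex $A\uplus\emptyset$ (resp.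 $\emptyset\uplus A$) of $\mathsf{B}(G)$ and extending affinely on simplices. Doubled Lovász complex: $\mathsf{DL}(G)$ is the image of the simplicial $\mathbb{Z}_2$-map $\mathrm{ssd}(\mathsf{B}(G))\to\mathrm{ssd}(\mathsf{B}(G))$ given on vertices by $A\uplus\emptyset\mapsto\mathrm{CN}^2(A)\uplus\emptyset$ and $\emptyset\uplus A\mapsto\emptyset\uplus\mathrm{CN}^2(A)$. Explicitly, $\mathsf{DL}(G)$ consists of all $\mathcal{A}\uplus\mathcal{B}$ with $\mathcal{A},\mathcal{B}\in\mathsf{L}(G)$ (possibly empty) such that every $a\in A$ is adjacent to every $b\in B$ for all $A\in\mathcal{A}$, $B\in\mathcal{B}$. Halved doubled Lovász complex: fix a linear order on $V(G)$ and define a linear order $\prec$ on the vertices of $\mathsf{L}(G)$ by $A\prec B$ iff $|A|<|B|$, or $|A|=|B|$ and $A<_{\mathrm{lex}}B$ (lexicographic order). The vertices of $\mathsf{DL}(G)$ are partitioned into pairs $\{A\uplus\emptyset,\ \emptyset\uplus\mathrm{CN}(A)\}$, and each pair is ordered by: $A\uplus\emptyset\prec\emptyset\uplus\mathrm{CN}(A)$ iff $A\prec\mathrm{CN}(A)$ (otherwise $\emptyset\uplus\mathrm{CN}(A)$ is the smaller one). Define the simplicial $\mathbb{Z}_2$-map $j:\mathsf{DL}(G)\to\mathsf{DL}(G)$ on vertices by $j(A\uplus\emptyset)=\min_\prec\{A\uplus\emptyset,\emptyset\uplus\mathrm{CN}(A)\}$ and $j(\emptyset\uplus B)=\min_\prec\{\emptyset\uplus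 B,\mathrm{CN}(B)\uplus\emptyset\}$. Then $\mathsf{HDL}(G):=\operatorname{im} j=\{j(\sigma):\sigma\in\mathsf{DL}(G)\}$, a $\mathbb{Z}_2$-invariant subcomplex of $\mathrm{ssd}(\mathsf{B}(G))$. Strong $\mathbb{Z}_2$-deformation retract: for a $\mathbb{Z}_2$-space $(X,\nu)$ (a space with a free self-inverse homeomorphism $\nu$), a $\nu$-invariant subspace $Y\subseteq X$ is a strong $\mathbb{Z}_2$-deformation retract of $X$ if there is a continuous map $F:X\times[0,1]\to X$ with $F(x,0)=x$ and $F(x,1)\in Y$ for all $x\in X$, $F(y,t)=y$ for all $y\in Y$, $t\in[0,1]$, and $F(\nu(x),t)=\nu(F(x,t))$ for all $x\in X$, $t\in[0,1]$. -}

module Defs where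

open import Algebra.Bundles using (CommutativeMonoid)
import Algebra.Properties.CommutativeSemigroup as CommutativeSemigroup
open import Data.Bool.Base using (if_then_else_)
open import Data.Fin.Base using (Fin; opposite)
open import Data.Fin.Patterns using (0F; 1F)
open import Data.Fin.Properties using (all?)
open import Data.Fin.Subset as Subset
  using (Subset; inside; outside; Nonempty; _∈_; _⊆_; _⊂_)
open import Data.Fin.Subset.Properties using (_∈?_)
open import Data.List.Base
  using (List; []; _∷_; _++_; map; foldr; filter; allFin; cartesianProduct)
import Data.List.Membership.Propositional as List
open import Data.List.Relation.Binary.Lex.Strict using (Lex-<; <-decidable)
open import Data.List.Relation.Unary.All using (All)
open import Data.List.Relation.Unary.AllPairs using (AllPairs)
import Data.List.Sort as Sort
import Data.Nat.Base as ℕ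
import Data.Nat.Properties as ℕ
open import Data.Nat.Base using (ℕ; zero; suc)
open import Data.Integer.Base using (+_)
open import Data.Product.Base using (∃; Σ-syntax; _×_; _,_; proj₁; proj₂; map₂)
open import Data.Rational.Base using (ℚ; 0ℚ; 1ℚ; ½; _/_)
import Data.Rational.Base as ℚ
import Data.Rational.Properties as ℚ
open import Data.Sum.Base using (_⊎_)
import Data.Vec.Base as Vec
open import Function.Base using (_∘_)
open import Level using (0ℓ)
open import Relation.Binary.Bundles using (StrictTotalOrder)
open import Relation.Binary.Core using (Rel)
open import Relation.Binary.Construct.Closure.ReflexiveTransitive using (Star)
open import Relation.Binary.Definitions using (Decidable; Irreflexive; Symmetric)
open import Relation.Binary.PropositionalEquality
import Relation.Binary.Properties.StrictTotalOrder as STO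
open import Relation.Binary.Structures using (IsStrictTotalOrder)
open import Relation.Nullary.Decidable
  using (does; _→-dec_; _×-dec_; _⊎-dec_)
open import Relation.Nullary.Negation using (¬_)
open import Relation.Unary using (Pred; _≐_)
import Relation.Unary as Pred

------------------------------------------------------------------------
-- Real numbers: rational Cauchy sequences with explicit moduli.  ℝ is a
-- setoid under _≈_; only the operations needed for barycentric
-- coordinates are provided.

record ℝ : Set where
  field
    seq    : ℕ → ℚ
    cauchy : ∀ ε → 0ℚ ℚ.< ε → ∃ λ N → ∀ m n → N ℕ.≤ m → N ℕ.≤ n →
             ℚ.∣ seq m ℚ.- seq n ∣ ℚ.< ε

open ℝ public

infix 4 _<_ _≤_ _≈_
infixl 6 _+_
infixl 7 _·_

_<_ : Rel ℝ 0ℓ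
x < y = ∃ λ ε → 0ℚ ℚ.< ε × ∃ λ N → ∀ n → N ℕ.≤ n → seq x n ℚ.+ ε ℚ.≤ seq y n

_≤_ : Rel ℝ 0ℓ
x ≤ y = ¬ (y < x)

_≈_ : Rel ℝ 0ℓ
x ≈ y = x ≤ y × y ≤ x

const : ℚ → ℝ
const q .seq _ = q
const q .cauchy ε 0<ε = 0 , λ _ _ _ _ →
  subst (ℚ._< ε) (sym (cong ℚ.∣_∣ (ℚ.+-inverseʳ q))) 0<ε

0ℝ 1ℝ : ℝ
0ℝ = const 0ℚ
1ℝ = const 1ℚ

private
  +-interchange : ∀ a b c d → (a ℚ.+ b) ℚ.- (c ℚ.+ d) ≡ (a ℚ.- c) ℚ.+ (b ℚ.- d)
  +-interchange a b c d =
    trans (cong ((a ℚ.+ b) ℚ.+_) (ℚ.neg-distrib-+ c d))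
          (interchange a b (ℚ.- c) (ℚ.- d))
    where open CommutativeSemigroup (CommutativeMonoid.commutativeSemigroup ℚ.+-0-commutativeMonoid)

  halves : ∀ ε → ε ℚ.* ½ ℚ.+ ε ℚ.* ½ ≡ ε
  halves ε = trans (sym (ℚ.*-distribˡ-+ ε ½ ½)) (ℚ.*-identityʳ ε)

  half-pos : ∀ {ε} → 0ℚ ℚ.< ε → 0ℚ ℚ.< ε ℚ.* ½
  half-pos {ε} 0<ε = subst (ℚ._< ε ℚ.* ½) (ℚ.*-zeroˡ ½) (ℚ.*-monoˡ-<-pos ½ 0<ε)

_+_ : ℝ → ℝ → ℝ
(x + y) .seq n = seq x n ℚ.+ seq y n
(x + y) .cauchy ε 0<ε with cauchy x (ε ℚ.* ½) (half-pos 0<ε) | cauchy y (ε ℚ.* ½) (half-pos 0<ε)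
... | M , p | N , q = M ℕ.⊔ N , λ m n b c → begin-strict
  ℚ.∣ (seq x m ℚ.+ seq y m) ℚ.- (seq x n ℚ.+ seq y n) ∣
    ≡⟨ cong ℚ.∣_∣ (+-interchange (seq x m) (seq y m) (seq x n) (seq y n)) ⟩
  ℚ.∣ (seq x m ℚ.- seq x n) ℚ.+ (seq y m ℚ.- seq y n) ∣
    ≤⟨ ℚ.∣p+q∣≤∣p∣+∣q∣ (seq x m ℚ.- seq x n) (seq y m ℚ.- seq y n) ⟩
  ℚ.∣ seq x m ℚ.- seq x n ∣ ℚ.+ ℚ.∣ seq y m ℚ.- seq y n ∣
    <⟨ ℚ.+-mono-< (p m n (ℕ.m⊔n≤o⇒m≤o M N b) (ℕ.m⊔n≤o⇒m≤o M N c))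
                  (q m n (ℕ.m⊔n≤o⇒n≤o M N b) (ℕ.m⊔n≤o⇒n≤o M N c)) ⟩
  ε ℚ.* ½ ℚ.+ ε ℚ.* ½
    ≡⟨ halves ε ⟩
  ε ∎
  where open ℚ.≤-Reasoning

_·_ : ℚ → ℝ → ℝ
(q · x) .seq n = q ℚ.* seq x n
(q · x) .cauchy ε 0<ε = map₂ bound (cauchy x δ 0<δ)
  where
  K : ℚ
  K = ℚ.∣ q ∣ ℚ.+ 1ℚ

  0<K : 0ℚ ℚ.< K
  0<K = ℚ.+-mono-≤-< (ℚ.0≤∣p∣ q) (ℚ.positive⁻¹ 1ℚ)

  instance
    K-positive : ℚ.Positive K
    K-positive = ℚ.positive 0<K

    K-nonZero : ℚ.NonZero K
    K-nonZero = ℚ.pos⇒nonZero K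

    K⁻¹-positive : ℚ.Positive (ℚ.1/ K)
    K⁻¹-positive = ℚ.1/pos⇒pos K

  δ : ℚ
  δ = ε ℚ.* ℚ.1/ K

  0<δ : 0ℚ ℚ.< δ
  0<δ = subst (ℚ._< δ) (ℚ.*-zeroˡ (ℚ.1/ K)) (ℚ.*-monoˡ-<-pos (ℚ.1/ K) 0<ε)

  Kδ≡ε : K ℚ.* δ ≡ ε
  Kδ≡ε = begin
    K ℚ.* (ε ℚ.* ℚ.1/ K)   ≡⟨ ℚ.*-comm K _ ⟩
    ε ℚ.* ℚ.1/ K ℚ.* K     ≡⟨ ℚ.*-assoc ε _ K ⟩
    ε ℚ.* (ℚ.1/ K ℚ.* K)   ≡⟨ cong (ε ℚ.*_) (ℚ.*-inverseˡ K) ⟩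
    ε ℚ.* 1ℚ               ≡⟨ ℚ.*-identityʳ ε ⟩
    ε                      ∎
    where open ≡-Reasoning

  factor : ∀ a b → q ℚ.* a ℚ.- q ℚ.* b ≡ q ℚ.* (a ℚ.- b)
  factor a b = trans (cong (q ℚ.* a ℚ.+_) (ℚ.neg-distribʳ-* q b))
                     (sym (ℚ.*-distribˡ-+ q a (ℚ.- b)))

  bound : ∀ {N} →
          (∀ m n → N ℕ.≤ m → N ℕ.≤ n → ℚ.∣ seq x m ℚ.- seq x n ∣ ℚ.< δ) →
          ∀ m n → N ℕ.≤ m → N ℕ.≤ n → ℚ.∣ q ℚ.* seq x m ℚ.- q ℚ.* seq x n ∣ ℚ.< ε
  bound p m n b c = begin-strict
    ℚ.∣ q ℚ.* seq x m ℚ.- q ℚ.* seq x n ∣   ≡⟨ cong ℚ.∣_∣ (factor (seq x m) (seq x n)) ⟩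
    ℚ.∣ q ℚ.* d ∣                           ≡⟨ ℚ.∣p*q∣≡∣p∣*∣q∣ q d ⟩
    ℚ.∣ q ∣ ℚ.* ℚ.∣ d ∣                     ≤⟨ ℚ.*-monoʳ-≤-nonNeg ℚ.∣ d ∣ ∣q∣≤K ⟩
    K ℚ.* ℚ.∣ d ∣                           <⟨ ℚ.*-monoʳ-<-pos K (p m n b c) ⟩
    K ℚ.* δ                                 ≡⟨ Kδ≡ε ⟩
    ε                                       ∎
    where
    open ℚ.≤-Reasoning

    d : ℚ
    d = seq x m ℚ.- seq x n

    instance
      ∣d∣-nonNegative : ℚ.NonNegative ℚ.∣ d ∣
      ∣d∣-nonNegative = ℚ.nonNegative (ℚ.0≤∣p∣ d)

    ∣q∣≤K : ℚ.∣ q ∣ ℚ.≤ K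
    ∣q∣≤K = subst (ℚ._≤ K) (ℚ.+-identityʳ ℚ.∣ q ∣)
              (ℚ.+-monoʳ-≤ ℚ.∣ q ∣ (ℚ.<⇒≤ (ℚ.positive⁻¹ 1ℚ)))

∑ : {I : Set} → List I → (I → ℝ) → ℝ
∑ is f = foldr (λ i s → f i + s) 0ℝ is

-- Near ε x y says ∣ x - y ∣ < ε.

Near : ℚ → Rel ℝ 0ℓ
Near ε x y = x < y + const ε × y < x + const ε

------------------------------------------------------------------------
-- Subspaces of ℝᴵ (I finite, with the sup metric)

infix 4 _≋_

_≋_ : {I : Set} → Rel (I → ℝ) 0ℓ
x ≋ y = ∀ i → x i ≈ y i

Near∞ : {I : Set} → ℚ → Rel (I → ℝ) 0ℓ
Near∞ ε x y = ∀ i → Near ε (x i) (y i)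

Point : {I : Set} → Pred (I → ℝ) 0ℓ → Set
Point X = ∃ λ x → X x

[0,1] : Set
[0,1] = ∃ λ t → 0ℝ ≤ t × t ≤ 1ℝ

record IsZ₂Space {I : Set} (X : Pred (I → ℝ) 0ℓ) (ν : (I → ℝ) → (I → ℝ)) : Set where
  field
    closed     : ∀ x → X x → X (ν x)
    continuous : ∀ (x : Point X) ε → 0ℚ ℚ.< ε → ∃ λ δ → 0ℚ ℚ.< δ ×
                 (∀ (y : Point X) → Near∞ δ (proj₁ x) (proj₁ y) →
                  Near∞ ε (ν (proj₁ x)) (ν (proj₁ y)))
    involutive : ∀ (x : Point X) → ν (ν (proj₁ x)) ≋ proj₁ x
    free       : ∀ (x : Point X) → ¬ (ν (proj₁ x) ≋ proj₁ x)

  act : Point X → Point X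
  act (x , x∈X) = ν x , closed x x∈X

record IsStrongZ₂DeformationRetract
  {I : Set} (X : Pred (I → ℝ) 0ℓ) (ν : (I → ℝ) → (I → ℝ)) (Y : Pred (I → ℝ) 0ℓ) : Set where
  field
    isZ₂Space : IsZ₂Space X ν

  open IsZ₂Space isZ₂Space public using (act)

  field
    subspace   : Y Pred.⊆ X
    invariant  : ∀ y → Y y → Y (ν y)
    F          : Point X → [0,1] → Point X
    continuous : ∀ x t ε → 0ℚ ℚ.< ε → ∃ λ δ → 0ℚ ℚ.< δ ×
                 (∀ x′ t′ → Near∞ δ (proj₁ x) (proj₁ x′) → Near δ (proj₁ t) (proj₁ t′) →
                  Near∞ ε (proj₁ (F x t)) (proj₁ (F x′ t′)))
    start      : ∀ x t → proj₁ t ≈ 0ℝ → proj₁ (F x t) ≋ proj₁ x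
    end        : ∀ x t → proj₁ t ≈ 1ℝ → Y (proj₁ (F x t))
    fixed      : ∀ x t → Y (proj₁ x) → proj₁ (F x t) ≋ proj₁ x
    equivar    : ∀ x t → proj₁ (F (act x) t) ≋ ν (proj₁ (F x t))

------------------------------------------------------------------------
-- Simplicial complexes on a vertex type V.  A finite set of vertices is
-- given by a list, order and repetitions being irrelevant.

Complex : Set → Set₁
Complex V = Pred (List V) 0ℓ

image : {V W : Set} → (V → W) → Complex V → Complex W
image f K τ = ∃ λ σ → K σ × (List._∈ τ) ≐ (List._∈ map f σ)

-- Barycentric coordinates.  As complexes are closed under subsets, the
-- last condition says that { v | x v > 0 } is a simplex of K; this form
-- does not require the set { v | x v > 0 } to be decidable.

record Realization {V : Set} (vs : List V) (K : Complex V) (x : V → ℝ) : Set where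
  field
    nonNegative : ∀ v → 0ℝ ≤ x v
    sum         : ∑ vs x ≈ 1ℝ
    support     : ∀ σ → All (λ v → 0ℝ < x v) σ → K σ

-- P ⊎ˢ Q = { (a , 0) | a ∈ P } ∪ { (b , 1) | b ∈ Q }

_⊎ˢ_ : {U : Set} → Pred U 0ℓ → Pred U 0ℓ → Pred (U × Fin 2) 0ℓ
(P ⊎ˢ Q) (u , 0F) = P u
(P ⊎ˢ Q) (u , 1F) = Q u

swap : {U : Set} → U × Fin 2 → U × Fin 2
swap (u , i) = u , opposite i

subsets : ∀ n → List (Subset n)
subsets zero    = Vec.[] ∷ []
subsets (suc n) = map (outside Vec.∷_) (subsets n) ++ map (inside Vec.∷_) (subsets n)

IsChain : ∀ {n} → Pred (List (Subset n)) 0ℓ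
IsChain = AllPairs _⊂_

-- The affine extension of  (A , i) ↦ barycentre of the simplex
-- with vertices (a , i), a ∈ A.

1/_ : ℕ → ℚ
1/ zero  = 0ℚ
1/ suc k = + 1 / suc k

barycentre : ∀ {n} → Subset n → Fin n → ℚ
barycentre A v = if does (v ∈? A) then 1/ Subset.∣ A ∣ else 0ℚ

placement : ∀ {n} → (Subset n × Fin 2 → ℝ) → (Fin n × Fin 2 → ℝ)
placement z (v , i) = ∑ (subsets _) λ A → barycentre A v · z (A , i)

------------------------------------------------------------------------
-- Graphs

record Graph (n : ℕ) : Set₁ where
  field
    Adj    : Rel (Fin n) 0ℓ
    adj?   : Decidable Adj
    symm   : Symmetric Adj
    irrefl : Irreflexive _≡_ Adj

Connected : ∀ {n} → Graph n → Set
Connected G = ∀ u v → Star (Graph.Adj G) u v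

module _ {n : ℕ} (G : Graph n) where

  open Graph G

  CN : Subset n → Subset n
  CN A = Vec.tabulate λ v → does (all? λ a → (a ∈? A) →-dec adj? a v)

  CN² : Subset n → Subset n
  CN² A = CN (CN A)

  N : Pred (Subset n) 0ℓ
  N A = Nonempty (CN A)

  boxVertices : List (Fin n × Fin 2)
  boxVertices = cartesianProduct (allFin n) (allFin 2)

  B : Complex (Fin n × Fin 2)
  B σ = Σ[ P ∈ Subset n ] Σ[ Q ∈ Subset n ]
        N P × N Q × P ⊆ CN Q × Q ⊆ CN P ×
        (List._∈ σ) ≐ ((_∈ P) ⊎ˢ (_∈ Q))

  ∥B∥ : Pred (Fin n × Fin 2 → ℝ) 0ℓ
  ∥B∥ = Realization boxVertices B

  ν : (Fin n × Fin 2 → ℝ) → (Fin n × Fin 2 → ℝ)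
  ν x = x ∘ swap

  ssdVertices : List (Subset n × Fin 2)
  ssdVertices = cartesianProduct (subsets n) (allFin 2)

  ssdB : Complex (Subset n × Fin 2)
  ssdB σ = Σ[ 𝒜 ∈ List (Subset n) ] Σ[ ℬ ∈ List (Subset n) ]
           IsChain 𝒜 × All Nonempty 𝒜 × All N 𝒜 ×
           IsChain ℬ × All Nonempty ℬ × All N ℬ ×
           (∀ {P Q} → P List.∈ 𝒜 → Q List.∈ ℬ → P ⊆ CN Q) ×
           (List._∈ σ) ≐ ((List._∈ 𝒜) ⊎ˢ (List._∈ ℬ))

  -- ∥ K ∥ as a subspace of ∥ B ∥, for subcomplexes K of ssdB.

  Placed : Complex (Subset n × Fin 2) → Pred (Fin n × Fin 2 → ℝ) 0ℓ
  Placed K x = ∃ λ z → Realization ssdVertices K z × placement z ≋ x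

  DL : Complex (Subset n × Fin 2)
  DL = image (λ (A , i) → CN² A , i) ssdB

  module _ {_<ᵥ_ : Rel (Fin n) 0ℓ} (<ᵥ-isSTO : IsStrictTotalOrder _≡_ _<ᵥ_) where

    order : StrictTotalOrder 0ℓ 0ℓ 0ℓ
    order = record { isStrictTotalOrder = <ᵥ-isSTO }

    elements : Subset n → List (Fin n)
    elements A = Sort.sort (STO.decTotalOrder order) (filter (_∈? A) (allFin n))

    infix 4 _<ˡᵉˣ_ _≺_ _≺?_

    _<ˡᵉˣ_ : Rel (Subset n) 0ℓ
    P <ˡᵉˣ Q = Lex-< _≡_ _<ᵥ_ (elements P) (elements Q)

    _≺_ : Rel (Subset n) 0ℓ
    P ≺ Q = Subset.∣ P ∣ ℕ.< Subset.∣ Q ∣ ⊎ (Subset.∣ P ∣ ≡ Subset.∣ Q ∣ × P <ˡᵉˣ Q)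

    _≺?_ : Decidable _≺_
    P ≺? Q = (Subset.∣ P ∣ ℕ.<? Subset.∣ Q ∣) ⊎-dec
             ((Subset.∣ P ∣ ℕ.≟ Subset.∣ Q ∣) ×-dec
              <-decidable _≟_ _<?_ (elements P) (elements Q))
      where open IsStrictTotalOrder <ᵥ-isSTO using (_≟_; _<?_)

    -- The smaller element of the pair (A , 0), (CN A , 1), for which
    -- (A , 0) is the smaller one exactly if A ≺ CN A.

    j : Subset n × Fin 2 → Subset n × Fin 2
    j (P , 0F) = if does (P ≺? CN P) then (P , 0F) else (CN P , 1F)
    j (Q , 1F) = if does (CN Q ≺? Q) then (CN Q , 0F) else (Q , 1F)

    HDL : Complex (Subset n × Fin 2)
    HDL = image j DL

    ∥HDL∥ : Pred (Fin n × Fin 2 → ℝ) 0ℓ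
    ∥HDL∥ = Placed HDL

{-# OPTIONS --safe #-}

-- A point x of ∥ B(G) ∥ is the layer cake of its superlevel sets: on shore i, the levels
-- r with { v ∣ r < x (v , i) } = A form an interval, and ∣ A ∣ times its length is the
-- weight of x at the vertex (A , i) of ssd(B(G)).  The deformation raises the level t
-- from 0 to 1 and moves the weight of all levels below t from (A , i) to
-- J (A , i) = j (CN² A , i).  Thus the largest sets move first, which keeps the support of
-- every intermediate point inside a simplex of B(G): what has not been moved lies
-- in every superlevel set below t, and j moves with a set all sets containing it.
-- Points of ∥ HDL(G) ∥ only have weight at vertices fixed by J.
--
-- Weights are piecewise linear in x and t.  They are defined on rationals, where
-- the order is decidable and their identities hold exactly, and extended to reals as
-- Lipschitz functions.

module Submission where

open import Defs
open import Data.Bool.Base using (true; false; if_then_else_)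
import Data.Bool.Properties as Bool
open import Data.Empty using (⊥-elim)
open import Data.Fin.Base using (Fin; zero; suc; opposite)
open import Data.Fin.Patterns using (0F; 1F)
open import Data.Fin.Properties using (all?; any?; _≟_; opposite-involutive)
open import Data.Fin.Subset as Subset
  using (Subset; inside; outside; _∈_; _∉_; _⊆_; _⊂_; Nonempty)
import Data.Fin.Subset.Properties as Subset
open import Data.Integer.Base using (+_)
import Data.Integer.Base as ℤ
import Data.Integer.Properties as ℤ
open import Data.List.Base
  using (List; []; _∷_; _++_; map; foldr; filter; allFin; cartesianProduct)
import Data.List.Membership.DecPropositional as DecMembership
import Data.List.Membership.Propositional as List
import Data.List.Membership.Propositional.Properties as List
open import Data.List.Properties using (map-tabulate)
open import Data.List.Relation.Binary.Lex.Strict using (<-asymmetric; <-compare)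
open import Data.List.Relation.Binary.Permutation.Propositional using (↭-sym)
open import Data.List.Relation.Binary.Permutation.Propositional.Properties using (∈-resp-↭)
open import Data.List.Relation.Binary.Pointwise using (Pointwise-≡⇒≡)
open import Data.List.Relation.Unary.All using (All; []; _∷_)
import Data.List.Relation.Unary.All as All
import Data.List.Relation.Unary.All.Properties as All
open import Data.List.Relation.Unary.AllPairs using ([]; _∷_)
open import Data.List.Relation.Unary.Any using (here; there)
import Data.List.Sort as Sort
open import Data.Maybe.Base using (Maybe; just; nothing; maybe)
open import Data.Nat.Base using (ℕ)
import Data.Nat.Base as ℕ
import Data.Nat.Properties as ℕ
open import Data.Product.Base as Product using (∃; _×_; _,_; proj₁; proj₂)
import Data.Product.Properties as Product
open import Data.Rational.Base using (ℚ; 0ℚ; 1ℚ; ½)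
import Data.Rational.Base as ℚ
import Data.Rational.Properties as ℚ
open import Data.Rational.Solver using (module +-*-Solver)
import Data.Rational.Unnormalised.Base as ℚᵘ
import Data.Rational.Unnormalised.Properties as ℚᵘ
open import Data.Sum.Base as Sum using (_⊎_; inj₁; inj₂)
import Data.Sum.Properties as Sum
open import Data.Vec.Base using (here; there)
import Data.Vec.Base as Vec
open import Data.Vec.Properties using (lookup∘tabulate; lookup⇒[]=; []=⇒lookup)
import Data.Vec.Properties as Vec
open import Function.Base using (_∘_; id)
open import Level using (0ℓ)
open import Relation.Binary.Core using (Rel)
open import Relation.Binary.Definitions using (Reflexive; Transitive; tri<; tri≈; tri>)
open import Relation.Binary.PropositionalEquality hiding (J)
import Relation.Binary.Properties.StrictTotalOrder as STO
open import Relation.Binary.Structures using (IsStrictTotalOrder)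
open import Relation.Nullary.Decidable
  using ( Dec; does; yes; no; toSum; dec-true; dec-false; ¬?; _×-dec_; _→-dec_
        ; decidable-stable; ¬¬-excluded-middle)
open import Relation.Nullary.Negation using (¬_; contradiction)
open import Relation.Unary using (Pred; Decidable; _≐_)

open +-*-Solver using (solve; _:+_; _:-_; :-_; _:*_; _:=_; con)

-- The straight-line homotopy from x to its image under `J` would leave ∥ B(G) ∥: if A ⊂ A′ lie on
-- one shore and both are sent to the other, the support would contain A′ here and `CN A` there,
-- although nodes of `CN A` need not be adjacent to all nodes of A′. Raising a level leaves a
-- one-sided condition between unmoved nodes R and a moved set A, namely `R ⊆ A` or `R ⊆ CN A`, and
-- this condition passes from `(A , i)` to `J (A , i)`. Changing shores is monotone in the set
-- because `CN` is antitone and `CN²` monotone: the comparison `CN A ≺ CN² A` is inherited by larger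
-- sets. For the same reason it cannot hold for two completely adjacent sets at once, which makes
-- `J` respect the simplices that meet both shores. Which of two real coordinates is larger is
-- undecidable, so superlevel sets of a real point are never formed. Only lengths of layers are, as
-- nested minima and maxima, and the combinatorics is read off from strict inequalities that a
-- positive weight implies. Rational approximations may be negative where the real number is not;
-- positive parts absorb this.

-- Linear inequalities over the rationals

p≤q⇒0≤q-p : ∀ {p q} → p ℚ.≤ q → 0ℚ ℚ.≤ q ℚ.- p
p≤q⇒0≤q-p {p} {q} p≤q = subst (ℚ._≤ q ℚ.- p) (ℚ.+-inverseʳ p) (ℚ.+-monoˡ-≤ (ℚ.- p) p≤q)

0≤q-p⇒p≤q : ∀ {p q} → 0ℚ ℚ.≤ q ℚ.- p → p ℚ.≤ q
0≤q-p⇒p≤q {p} {q} 0≤q-p = subst₂ ℚ._≤_ (ℚ.+-identityʳ p)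
  (solve 2 (λ p q → p :+ (q :- p) := q) refl p q) (ℚ.+-monoʳ-≤ p 0≤q-p)

-- For linear inequalities it suffices that b − a is the sum of the gaps of known
-- inequalities, an equation for the ring solver.

linear₁ : ∀ {a b p q} → q ℚ.- p ≡ b ℚ.- a → p ℚ.≤ q → a ℚ.≤ b
linear₁ eq p≤q = 0≤q-p⇒p≤q (subst (0ℚ ℚ.≤_) eq (p≤q⇒0≤q-p p≤q))

linear₂ : ∀ {a b p q r s} → (q ℚ.- p) ℚ.+ (s ℚ.- r) ≡ b ℚ.- a →
          p ℚ.≤ q → r ℚ.≤ s → a ℚ.≤ b
linear₂ eq p≤q r≤s =
  0≤q-p⇒p≤q (subst (0ℚ ℚ.≤_) eq (ℚ.+-mono-≤ (p≤q⇒0≤q-p p≤q) (p≤q⇒0≤q-p r≤s)))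

linear₃ : ∀ {a b p q r s u v} → ((q ℚ.- p) ℚ.+ (s ℚ.- r)) ℚ.+ (v ℚ.- u) ≡ b ℚ.- a →
          p ℚ.≤ q → r ℚ.≤ s → u ℚ.≤ v → a ℚ.≤ b
linear₃ eq p≤q r≤s u≤v = 0≤q-p⇒p≤q (subst (0ℚ ℚ.≤_) eq
  (ℚ.+-mono-≤ (ℚ.+-mono-≤ (p≤q⇒0≤q-p p≤q) (p≤q⇒0≤q-p r≤s)) (p≤q⇒0≤q-p u≤v)))

0<½ε : ∀ ε → 0ℚ ℚ.< ε → 0ℚ ℚ.< ε ℚ.* ½
0<½ε ε 0<ε = subst (ℚ._< ε ℚ.* ½) (ℚ.*-zeroˡ ½) (ℚ.*-monoˡ-<-pos ½ 0<ε)

p+ε≰p : ∀ {p ε} → 0ℚ ℚ.< ε → ¬ (p ℚ.+ ε ℚ.≤ p)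
p+ε≰p {p} {ε} 0<ε le = ℚ.<-irrefl refl (ℚ.<-≤-trans 0<ε (linear₁ (solve 2 (λ p ε → p :- (p :+ ε) := con 0ℚ :- ε) refl p ε) le))

p≤∣p∣ : ∀ p → p ℚ.≤ ℚ.∣ p ∣
p≤∣p∣ p with ℚ.≤-total 0ℚ p
... | inj₁ 0≤p = ℚ.≤-reflexive (sym (ℚ.0≤p⇒∣p∣≡p 0≤p))
... | inj₂ p≤0 = ℚ.≤-trans p≤0 (ℚ.0≤∣p∣ p)

∣p-q∣<ε⇒p≤q+ε : ∀ {p q ε} → ℚ.∣ p ℚ.- q ∣ ℚ.< ε → p ℚ.≤ q ℚ.+ ε
∣p-q∣<ε⇒p≤q+ε {p} {q} {ε} lt =
  linear₁ (solve 3 (λ p q ε → ε :- (p :- q) := (q :+ ε) :- p) refl p q ε)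
          (ℚ.≤-trans (p≤∣p∣ (p ℚ.- q)) (ℚ.<⇒≤ lt))

∣p-q∣≤ε : ∀ {p q ε} → p ℚ.≤ q ℚ.+ ε → q ℚ.≤ p ℚ.+ ε → ℚ.∣ p ℚ.- q ∣ ℚ.≤ ε
∣p-q∣≤ε {p} {q} {ε} p≤q+ε q≤p+ε with ℚ.∣p∣≡p∨∣p∣≡-p (p ℚ.- q)
... | inj₁ eq = subst (ℚ._≤ ε) (sym eq)
  (linear₁ (solve 3 (λ p q ε → (q :+ ε) :- p := ε :- (p :- q)) refl p q ε) p≤q+ε)
... | inj₂ eq = subst (ℚ._≤ ε) (sym eq)
  (linear₁ (trans (solve 3 (λ p q ε → (p :+ ε) :- q := ε :+ (p :- q)) refl p q ε)
                  (cong (ε ℚ.+_) (sym (neg-involutive (p ℚ.- q))))) q≤p+ε)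
  where
  neg-involutive : ∀ r → ℚ.- (ℚ.- r) ≡ r
  neg-involutive r = solve 1 (λ r → :- (:- r) := r) refl r

locate-gap : ∀ x y x′ y′ ε → x′ ℚ.≤ x ℚ.+ ε ℚ.* ½ ℚ.* ½ → y ℚ.≤ y′ ℚ.+ ε ℚ.* ½ ℚ.* ½ →
             x ℚ.+ ε ℚ.≤ y → x′ ℚ.+ ε ℚ.* ½ ℚ.≤ y′
locate-gap x y x′ y′ ε = linear₃
  (solve 5 (λ x y x′ y′ ε → ((x :+ ε :* con ½ :* con ½ :- x′) :+ (y′ :+ ε :* con ½ :* con ½ :- y))
                            :+ (y :- (x :+ ε)) := y′ :- (x′ :+ ε :* con ½)) refl x y x′ y′ ε)

gap-then-half : ∀ x y z ε → x ℚ.+ ε ℚ.≤ y → y ℚ.≤ z ℚ.+ ε ℚ.* ½ → x ℚ.+ ε ℚ.* ½ ℚ.≤ z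
gap-then-half x y z ε = linear₂
  (solve 4 (λ x y z ε → (y :- (x :+ ε)) :+ (z :+ ε :* con ½ :- y) := z :- (x :+ ε :* con ½))
         refl x y z ε)

half-then-gap : ∀ x y z ε → x ℚ.≤ y ℚ.+ ε ℚ.* ½ → y ℚ.+ ε ℚ.≤ z → x ℚ.+ ε ℚ.* ½ ℚ.≤ z
half-then-gap x y z ε = linear₂
  (solve 4 (λ x y z ε → (y :+ ε :* con ½ :- x) :+ (z :- (y :+ ε)) := z :- (x :+ ε :* con ½))
         refl x y z ε)

gap-then-gap : ∀ x y z ε δ → x ℚ.+ ε ℚ.≤ y → y ℚ.+ δ ℚ.≤ z → x ℚ.+ (ε ℚ.+ δ) ℚ.≤ z
gap-then-gap x y z ε δ = linear₂
  (solve 5 (λ x y z ε δ → (y :- (x :+ ε)) :+ (z :- (y :+ δ)) := z :- (x :+ (ε :+ δ)))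
         refl x y z ε δ)

split-gap : ∀ a b c d ε → c ℚ.≤ a ℚ.+ ε ℚ.* ½ → a ℚ.+ b ℚ.+ ε ℚ.≤ c ℚ.+ d → b ℚ.+ ε ℚ.* ½ ℚ.≤ d
split-gap a b c d ε = linear₂
  (solve 5 (λ a b c d ε → (a :+ ε :* con ½ :- c) :+ ((c :+ d) :- (a :+ b :+ ε))
                          := d :- (b :+ ε :* con ½)) refl a b c d ε)

half-gap : ∀ a b ε → a ℚ.≤ b ℚ.+ ε ℚ.* ½ → a ℚ.+ ε ℚ.* ½ ℚ.≤ b ℚ.+ ε
half-gap a b ε = linear₁
  (solve 3 (λ a b ε → b :+ ε :* con ½ :- a := b :+ ε :- (a :+ ε :* con ½)) refl a b ε)

interchange : ∀ a b c d → (a ℚ.+ b) ℚ.+ (c ℚ.+ d) ≡ (a ℚ.+ c) ℚ.+ (b ℚ.+ d)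
interchange = solve 4 (λ a b c d → (a :+ b) :+ (c :+ d) := (a :+ c) :+ (b :+ d)) refl

*-rotate : ∀ m ε r → m ℚ.* (ε ℚ.* r) ≡ ε ℚ.* (m ℚ.* r)
*-rotate = solve 3 (λ m ε r → m :* (ε :* r) := ε :* (m :* r)) refl

half+half : ∀ ε → ε ℚ.* ½ ℚ.+ ε ℚ.* ½ ≡ ε
half+half = solve 1 (λ ε → ε :* con ½ :+ ε :* con ½ := ε) refl

-- Order and finite sums of Cauchy reals

modulus : ∀ x ε → 0ℚ ℚ.< ε → ∃ λ N → ∀ m n → N ℕ.≤ m → N ℕ.≤ n → seq x m ℚ.≤ seq x n ℚ.+ ε
modulus x ε 0<ε with cauchy x ε 0<ε
... | N , p = N , λ m n N≤m N≤n → ∣p-q∣<ε⇒p≤q+ε (p m n N≤m N≤n)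

-- A gap of ε seen at one index beyond the moduli for a quarter of ε persists, as half a gap, at all
-- indices beyond them. So a single rational comparison certifies a strict inequality of reals.
<-locate : ∀ x y ε → 0ℚ ℚ.< ε →
           ∃ λ N → ∀ n → N ℕ.≤ n → seq x n ℚ.+ ε ℚ.≤ seq y n → x < y
<-locate x y ε 0<ε =
  let M , p = modulus x (ε ℚ.* ½ ℚ.* ½) 0<¼ε
      N , q = modulus y (ε ℚ.* ½ ℚ.* ½) 0<¼ε
  in M ℕ.⊔ N , λ n b gap → ε ℚ.* ½ , 0<½ε ε 0<ε , M ℕ.⊔ N , λ m c →
     locate-gap (seq x n) (seq y n) (seq x m) (seq y m) ε
       (p m n (ℕ.m⊔n≤o⇒m≤o M N c) (ℕ.m⊔n≤o⇒m≤o M N b))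
       (q n m (ℕ.m⊔n≤o⇒n≤o M N b) (ℕ.m⊔n≤o⇒n≤o M N c))
       gap
  where
  0<¼ε : 0ℚ ℚ.< ε ℚ.* ½ ℚ.* ½
  0<¼ε = 0<½ε (ε ℚ.* ½) (0<½ε ε 0<ε)

infix 4 _≲_

-- Positive form of `≤`, which supplies an index for every ε and can be combined with the witnesses
-- of `<`.
_≲_ : ℝ → ℝ → Set
x ≲ y = ∀ ε → 0ℚ ℚ.< ε → ∃ λ N → ∀ n → N ℕ.≤ n → seq x n ℚ.≤ seq y n ℚ.+ ε

-- A failure at one late index would already certify `y < x` through `<-locate`.
≤⇒≲ : ∀ {x y} → x ≤ y → x ≲ y
≤⇒≲ {x} {y} x≤y ε 0<ε =
  let N , p = <-locate y x ε 0<ε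
  in N , λ n N≤n → ℚ.≮⇒≥ λ lt → x≤y (p n N≤n (ℚ.<⇒≤ lt))

seq-≤⇒≤ : ∀ {x y} → (∀ n → seq x n ℚ.≤ seq y n) → x ≤ y
seq-≤⇒≤ {x} {y} p (ε , 0<ε , N , q) = p+ε≰p {seq y N} 0<ε (ℚ.≤-trans (q N ℕ.≤-refl) (p N))

seq-≡⇒≈ : ∀ {x y} → (∀ n → seq x n ≡ seq y n) → x ≈ y
seq-≡⇒≈ {x} {y} p = seq-≤⇒≤ {x} {y} (λ n → ℚ.≤-reflexive (p n)) ,
                     seq-≤⇒≤ {y} {x} (λ n → ℚ.≤-reflexive (sym (p n)))

<-≤-trans : ∀ {x y z} → x < y → y ≤ z → x < z
<-≤-trans {x} {y} {z} (ε , 0<ε , M , p) y≤z =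
  let N , q = ≤⇒≲ {y} {z} y≤z (ε ℚ.* ½) (0<½ε ε 0<ε)
  in ε ℚ.* ½ , 0<½ε ε 0<ε , M ℕ.⊔ N , λ n b →
     gap-then-half (seq x n) (seq y n) (seq z n) ε
       (p n (ℕ.m⊔n≤o⇒m≤o M N b)) (q n (ℕ.m⊔n≤o⇒n≤o M N b))

≤-<-trans : ∀ {x y z} → x ≤ y → y < z → x < z
≤-<-trans {x} {y} {z} x≤y (ε , 0<ε , M , p) =
  let N , q = ≤⇒≲ {x} {y} x≤y (ε ℚ.* ½) (0<½ε ε 0<ε)
  in ε ℚ.* ½ , 0<½ε ε 0<ε , M ℕ.⊔ N , λ n b →
     half-then-gap (seq x n) (seq y n) (seq z n) ε
       (q n (ℕ.m⊔n≤o⇒n≤o M N b)) (p n (ℕ.m⊔n≤o⇒m≤o M N b))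

≤-refl : ∀ {x} → x ≤ x
≤-refl {x} = seq-≤⇒≤ {x} {x} (λ _ → ℚ.≤-refl)

≤-trans : ∀ {x y z} → x ≤ y → y ≤ z → x ≤ z
≤-trans {x} {y} {z} x≤y y≤z z<x = y≤z (<-≤-trans {z} {x} {y} z<x x≤y)

<⇒≤ : ∀ {x y} → x < y → x ≤ y
<⇒≤ {x} {y} (ε , 0<ε , M , p) (δ , 0<δ , N , q) = p+ε≰p {seq x k} (ℚ.+-mono-< 0<ε 0<δ)
  (gap-then-gap (seq x k) (seq y k) (seq x k) ε δ (p k (ℕ.m≤m⊔n M N)) (q k (ℕ.m≤n⊔m M N)))
  where
  k : ℕ
  k = M ℕ.⊔ N

≈-refl : ∀ {x} → x ≈ x
≈-refl {x} = ≤-refl {x} , ≤-refl {x}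

≈-sym : ∀ {x y} → x ≈ y → y ≈ x
≈-sym (p , q) = q , p

≈-trans : ∀ {x y z} → x ≈ y → y ≈ z → x ≈ z
≈-trans {x} {y} {z} (p , q) (r , s) = ≤-trans {x} {y} {z} p r , ≤-trans {z} {y} {x} s q

-- Equality of reals is a negative statement, so it may be proved by cases on
-- an arbitrary proposition.

≈-by-cases : ∀ {x y} {P : Set} → (P → x ≈ y) → (¬ P → x ≈ y) → x ≈ y
≈-by-cases {x} {y} {P} yes? no? =
  (λ y<x → ¬¬-excluded-middle {A = P} λ where
     (yes p) → proj₁ (yes? p) y<x
     (no ¬p) → proj₁ (no? ¬p) y<x) ,
  (λ x<y → ¬¬-excluded-middle {A = P} λ where
     (yes p) → proj₂ (yes? p) x<y
     (no ¬p) → proj₂ (no? ¬p) x<y)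

-- At one late index it is decidable whether the first summands have half of the gap; otherwise the
-- second ones have the other half. As `≤` is a negation, monotonicity of `+` and `∑` is the
-- contrapositive.
+-<-split : ∀ x₁ x₂ y₁ y₂ → x₁ + x₂ < y₁ + y₂ → x₁ < y₁ ⊎ x₂ < y₂
+-<-split x₁ x₂ y₁ y₂ (ε , 0<ε , K , p) =
  let M , q = <-locate x₁ y₁ (ε ℚ.* ½) (0<½ε ε 0<ε)
      N , r = <-locate x₂ y₂ (ε ℚ.* ½) (0<½ε ε 0<ε)
      n     = K ℕ.⊔ (M ℕ.⊔ N)
  in Sum.map
       (q n (ℕ.≤-trans (ℕ.m≤m⊔n M N) (ℕ.m≤n⊔m K (M ℕ.⊔ N))))
       (λ gap≰ → r n (ℕ.≤-trans (ℕ.m≤n⊔m M N) (ℕ.m≤n⊔m K (M ℕ.⊔ N)))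
         (split-gap (seq x₁ n) (seq x₂ n) (seq y₁ n) (seq y₂ n) ε
           (ℚ.<⇒≤ (ℚ.≰⇒> gap≰)) (p n (ℕ.m≤m⊔n K (M ℕ.⊔ N)))))
       (toSum (seq x₁ n ℚ.+ ε ℚ.* ½ ℚ.≤? seq y₁ n))

∑-<⇒∃ : ∀ {I : Set} is (f g : I → ℝ) → ∑ is f < ∑ is g → ∃ λ i → i List.∈ is × f i < g i
∑-<⇒∃ []       f g lt = contradiction lt (≤-refl {0ℝ})
∑-<⇒∃ (i ∷ is) f g lt = Sum.[ (λ fi<gi → i , here refl , fi<gi) ,
                              (λ rest → Product.map₂ (Product.map₁ there) (∑-<⇒∃ is f g rest)) ]
                        (+-<-split (f i) (∑ is f) (g i) (∑ is g) lt)

∑-mono-≤ : ∀ {I : Set} is {f g : I → ℝ} → (∀ i → f i ≤ g i) → ∑ is f ≤ ∑ is g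
∑-mono-≤ is {f} {g} f≤g lt = let i , _ , gi<fi = ∑-<⇒∃ is g f lt in f≤g i gi<fi

∑-cong : ∀ {I : Set} is {f g : I → ℝ} → (∀ i → f i ≈ g i) → ∑ is f ≈ ∑ is g
∑-cong is {f} {g} f≈g = ∑-mono-≤ is {f} {g} (proj₁ ∘ f≈g) , ∑-mono-≤ is {g} {f} (proj₂ ∘ f≈g)

+-mono-≤ : ∀ {x₁ x₂ y₁ y₂} → x₁ ≤ y₁ → x₂ ≤ y₂ → x₁ + x₂ ≤ y₁ + y₂
+-mono-≤ {x₁} {x₂} {y₁} {y₂} p q lt = Sum.[ p , q ] (+-<-split y₁ y₂ x₁ x₂ lt)

+-cong : ∀ {x₁ x₂ y₁ y₂} → x₁ ≈ y₁ → x₂ ≈ y₂ → x₁ + x₂ ≈ y₁ + y₂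
+-cong {x₁} {x₂} {y₁} {y₂} (p , q) (r , s) =
  +-mono-≤ {x₁} {x₂} {y₁} {y₂} p r , +-mono-≤ {y₁} {y₂} {x₁} {x₂} q s

private
  module Scale (q : ℚ) (0<q : 0ℚ ℚ.< q) where
    instance
      q-positive : ℚ.Positive q
      q-positive = ℚ.positive 0<q

      q-nonZero : ℚ.NonZero q
      q-nonZero = ℚ.pos⇒nonZero q

      q⁻¹-positive : ℚ.Positive (ℚ.1/ q)
      q⁻¹-positive = ℚ.1/pos⇒pos q

    0<ε/q : ∀ ε → 0ℚ ℚ.< ε → 0ℚ ℚ.< ε ℚ.* ℚ.1/ q
    0<ε/q ε 0<ε = subst (ℚ._< ε ℚ.* ℚ.1/ q) (ℚ.*-zeroˡ (ℚ.1/ q)) (ℚ.*-monoˡ-<-pos (ℚ.1/ q) 0<ε)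

    q*ε/q : ∀ ε → q ℚ.* (ε ℚ.* ℚ.1/ q) ≡ ε
    q*ε/q ε = begin
      q ℚ.* (ε ℚ.* ℚ.1/ q)   ≡⟨ *-rotate q ε (ℚ.1/ q) ⟩
      ε ℚ.* (q ℚ.* ℚ.1/ q)   ≡⟨ cong (ε ℚ.*_) (ℚ.*-inverseʳ q) ⟩
      ε ℚ.* 1ℚ               ≡⟨ ℚ.*-identityʳ ε ⟩
      ε                      ∎
      where open ≡-Reasoning

    unscale : ∀ a b ε → q ℚ.* a ℚ.+ ε ℚ.≤ q ℚ.* b → a ℚ.+ ε ℚ.* ℚ.1/ q ℚ.≤ b
    unscale a b ε le = ℚ.*-cancelˡ-≤-pos q (subst (ℚ._≤ q ℚ.* b)
      (sym (trans (ℚ.*-distribˡ-+ q a (ε ℚ.* ℚ.1/ q)) (cong (q ℚ.* a ℚ.+_) (q*ε/q ε)))) le)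

-- The strict inequality excludes q = 0, where both sides vanish, and then the gap can be divided by
-- q. Positivity of q is returned too, because a positive term of a sum has to reveal a positive
-- coefficient and a positive weight.
·-cancel-< : ∀ q x y → 0ℚ ℚ.≤ q → q · x < q · y → 0ℚ ℚ.< q × x < y
·-cancel-< q x y 0≤q (ε , 0<ε , N , p) = 0<q , ε ℚ.* ℚ.1/ q , 0<ε/q ε 0<ε , N ,
    λ n b → unscale (seq x n) (seq y n) ε (p n b)
  where
  0<q : 0ℚ ℚ.< q
  0<q = ℚ.≰⇒> λ q≤0 →
    let null : ∀ a → q ℚ.* a ≡ 0ℚ
        null a = trans (cong (ℚ._* a) (ℚ.≤-antisym q≤0 0≤q)) (ℚ.*-zeroˡ a)
    in p+ε≰p 0<ε (subst₂ (λ a b → a ℚ.+ ε ℚ.≤ b) (null (seq x N)) (null (seq y N)) (p N ℕ.≤-refl))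

  open Scale q 0<q

·-mono-≤ : ∀ q {x y} → 0ℚ ℚ.≤ q → x ≤ y → q · x ≤ q · y
·-mono-≤ q {x} {y} 0≤q x≤y lt = x≤y (proj₂ (·-cancel-< q y x 0≤q lt))

·-cong : ∀ q {x y} → 0ℚ ℚ.≤ q → x ≈ y → q · x ≈ q · y
·-cong q {x} {y} 0≤q (p , r) = ·-mono-≤ q {x} {y} 0≤q p , ·-mono-≤ q {y} {x} 0≤q r

·-zeroʳ : ∀ q → q · 0ℝ ≈ 0ℝ
·-zeroʳ q = seq-≡⇒≈ {q · 0ℝ} {0ℝ} (λ _ → ℚ.*-zeroʳ q)

∑-0 : ∀ {I : Set} (is : List I) → ∑ is (λ _ → 0ℝ) ≈ 0ℝ
∑-0 []       = ≈-refl {0ℝ}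
∑-0 (i ∷ is) = ≈-trans {0ℝ + ∑ is (λ _ → 0ℝ)} {0ℝ + 0ℝ} {0ℝ}
  (+-cong {0ℝ} {∑ is (λ _ → 0ℝ)} {0ℝ} {0ℝ} (≈-refl {0ℝ}) (∑-0 is))
  (seq-≡⇒≈ {0ℝ + 0ℝ} {0ℝ} (λ _ → refl))

0<∑⇒∃ : ∀ {I : Set} is (f : I → ℝ) → 0ℝ < ∑ is f → ∃ λ i → i List.∈ is × 0ℝ < f i
0<∑⇒∃ is f lt = ∑-<⇒∃ is (λ _ → 0ℝ) f
  (≤-<-trans {∑ is (λ _ → 0ℝ)} {0ℝ} {∑ is f} (proj₁ (∑-0 is)) lt)

0≤∑ : ∀ {I : Set} is (f : I → ℝ) → (∀ i → 0ℝ ≤ f i) → 0ℝ ≤ ∑ is f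
0≤∑ is f 0≤f = ≤-trans {0ℝ} {∑ is (λ _ → 0ℝ)} {∑ is f} (proj₂ (∑-0 is))
  (∑-mono-≤ is {λ _ → 0ℝ} {f} 0≤f)

term≤∑ : ∀ {I : Set} {is} {i : I} (f : I → ℝ) → (∀ i → 0ℝ ≤ f i) → i List.∈ is → f i ≤ ∑ is f
term≤∑ {is = i ∷ is} f 0≤f (here refl) = ≤-trans {f i} {f i + 0ℝ} {f i + ∑ is f}
  (seq-≤⇒≤ {f i} {f i + 0ℝ} (λ n → ℚ.≤-reflexive (sym (ℚ.+-identityʳ _))))
  (+-mono-≤ {f i} {0ℝ} {f i} {∑ is f} (≤-refl {f i}) (0≤∑ is f 0≤f))
term≤∑ {is = k ∷ is} {i} f 0≤f (there i∈is) = ≤-trans {f i} {0ℝ + f i} {f k + ∑ is f}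
  (seq-≤⇒≤ {f i} {0ℝ + f i} (λ n → ℚ.≤-reflexive (sym (ℚ.+-identityˡ _))))
  (+-mono-≤ {0ℝ} {f i} {f k} {∑ is f} (0≤f k) (term≤∑ f 0≤f i∈is))

-- Finite sums of rationals

∑ℚ : {I : Set} → List I → (I → ℚ) → ℚ
∑ℚ is f = foldr (λ i s → f i ℚ.+ s) 0ℚ is

seq-∑ : ∀ {I : Set} is (f : I → ℝ) n → seq (∑ is f) n ≡ ∑ℚ is (λ i → seq (f i) n)
seq-∑ []       f n = refl
seq-∑ (i ∷ is) f n = cong (seq (f i) n ℚ.+_) (seq-∑ is f n)

∑ℚ-cong : ∀ {I : Set} is {f g : I → ℚ} → (∀ i → f i ≡ g i) → ∑ℚ is f ≡ ∑ℚ is g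
∑ℚ-cong []       f≡g = refl
∑ℚ-cong (i ∷ is) f≡g = cong₂ ℚ._+_ (f≡g i) (∑ℚ-cong is f≡g)

∑ℚ-0 : ∀ {I : Set} (is : List I) → ∑ℚ is (λ _ → 0ℚ) ≡ 0ℚ
∑ℚ-0 []       = refl
∑ℚ-0 (i ∷ is) = trans (ℚ.+-identityˡ _) (∑ℚ-0 is)

∑ℚ-+ : ∀ {I : Set} is (f g : I → ℚ) → ∑ℚ is (λ i → f i ℚ.+ g i) ≡ ∑ℚ is f ℚ.+ ∑ℚ is g
∑ℚ-+ []       f g = refl
∑ℚ-+ (i ∷ is) f g = trans (cong ((f i ℚ.+ g i) ℚ.+_) (∑ℚ-+ is f g))
  (interchange (f i) (g i) (∑ℚ is f) (∑ℚ is g))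

∑ℚ-* : ∀ {I : Set} is (f : I → ℚ) q → ∑ℚ is (λ i → f i ℚ.* q) ≡ ∑ℚ is f ℚ.* q
∑ℚ-* []       f q = sym (ℚ.*-zeroˡ q)
∑ℚ-* (i ∷ is) f q = trans (cong (f i ℚ.* q ℚ.+_) (∑ℚ-* is f q)) (sym (ℚ.*-distribʳ-+ q (f i) _))

∑ℚ-swap : ∀ {I K : Set} is ks (f : I → K → ℚ) →
          ∑ℚ is (λ i → ∑ℚ ks (f i)) ≡ ∑ℚ ks (λ k → ∑ℚ is (λ i → f i k))
∑ℚ-swap []       ks f = sym (∑ℚ-0 ks)
∑ℚ-swap (i ∷ is) ks f = trans (cong (∑ℚ ks (f i) ℚ.+_) (∑ℚ-swap is ks f))
  (sym (∑ℚ-+ ks (f i) _))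

∑ℚ-map : ∀ {I K : Set} (g : I → K) is (f : K → ℚ) → ∑ℚ (map g is) f ≡ ∑ℚ is (f ∘ g)
∑ℚ-map g []       f = refl
∑ℚ-map g (i ∷ is) f = cong (f (g i) ℚ.+_) (∑ℚ-map g is f)

∑ℚ-++ : ∀ {I : Set} is ks (f : I → ℚ) → ∑ℚ (is ++ ks) f ≡ ∑ℚ is f ℚ.+ ∑ℚ ks f
∑ℚ-++ []       ks f = sym (ℚ.+-identityˡ _)
∑ℚ-++ (i ∷ is) ks f = trans (cong (f i ℚ.+_) (∑ℚ-++ is ks f)) (sym (ℚ.+-assoc (f i) _ _))

∑ℚ-× : ∀ {I K : Set} is (ks : List K) (f : I × K → ℚ) →
       ∑ℚ (cartesianProduct is ks) f ≡ ∑ℚ is (λ i → ∑ℚ ks (λ k → f (i , k)))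
∑ℚ-× []       ks f = refl
∑ℚ-× (i ∷ is) ks f = trans (∑ℚ-++ (map (i ,_) ks) (cartesianProduct is ks) f)
  (cong₂ ℚ._+_ (∑ℚ-map (i ,_) ks f) (∑ℚ-× is ks f))

0≤∑ℚ : ∀ {I : Set} is {f : I → ℚ} → (∀ i → 0ℚ ℚ.≤ f i) → 0ℚ ℚ.≤ ∑ℚ is f
0≤∑ℚ []       0≤f = ℚ.≤-refl
0≤∑ℚ (i ∷ is) 0≤f = ℚ.+-mono-≤ (0≤f i) (0≤∑ℚ is 0≤f)

-- Lipschitz functions of rational vectors and their extension to the reals

0≤* : ∀ p q → 0ℚ ℚ.≤ p → 0ℚ ℚ.≤ q → 0ℚ ℚ.≤ p ℚ.* q
0≤* p q 0≤p 0≤q = subst (ℚ._≤ p ℚ.* q) (ℚ.*-zeroʳ p)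
  (ℚ.*-monoˡ-≤-nonNeg p {{ℚ.nonNegative 0≤p}} 0≤q)

-- A one-sided bound suffices: its hypothesis is symmetric in ρ and ρ′, so exchanging them gives the
-- other side.
record Lipschitz {K : Set} (f : (K → ℚ) → ℚ) : Set where
  field
    L     : ℚ
    0≤L   : 0ℚ ℚ.≤ L
    bound : ∀ {δ} → 0ℚ ℚ.≤ δ → ∀ {ρ ρ′} →
            (∀ k → ρ k ℚ.≤ ρ′ k ℚ.+ δ × ρ′ k ℚ.≤ ρ k ℚ.+ δ) → f ρ ℚ.≤ f ρ′ ℚ.+ L ℚ.* δ

open Lipschitz

+-bound : ∀ a a′ b b′ l m δ → a ℚ.≤ a′ ℚ.+ l ℚ.* δ → b ℚ.≤ b′ ℚ.+ m ℚ.* δ →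
          a ℚ.+ b ℚ.≤ a′ ℚ.+ b′ ℚ.+ (l ℚ.+ m) ℚ.* δ
+-bound a a′ b b′ l m δ = linear₂
  (solve 7 (λ a a′ b b′ l m δ → (a′ :+ l :* δ :- a) :+ (b′ :+ m :* δ :- b)
                                := (a′ :+ b′ :+ (l :+ m) :* δ) :- (a :+ b))
           refl a a′ b b′ l m δ)

minus-bound : ∀ a a′ b b′ l m δ → a ℚ.≤ a′ ℚ.+ l ℚ.* δ → b′ ℚ.≤ b ℚ.+ m ℚ.* δ →
          a ℚ.- b ℚ.≤ a′ ℚ.- b′ ℚ.+ (l ℚ.+ m) ℚ.* δ
minus-bound a a′ b b′ l m δ = linear₂
  (solve 7 (λ a a′ b b′ l m δ → (a′ :+ l :* δ :- a) :+ (b :+ m :* δ :- b′)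
                                := (a′ :- b′ :+ (l :+ m) :* δ) :- (a :- b))
           refl a a′ b b′ l m δ)

*-bound : ∀ q a l δ → q ℚ.* (a ℚ.+ l ℚ.* δ) ≡ q ℚ.* a ℚ.+ q ℚ.* l ℚ.* δ
*-bound = solve 4 (λ q a l δ → q :* (a :+ l :* δ) := q :* a :+ q :* l :* δ) refl

module _ {K : Set} where

  lip-var : ∀ k → Lipschitz {K} (λ ρ → ρ k)
  lip-var k .L = 1ℚ
  lip-var k .0≤L = ℚ.<⇒≤ (ℚ.positive⁻¹ 1ℚ)
  lip-var k .bound {δ} _ {ρ} {ρ′} c =
    subst (λ d → ρ k ℚ.≤ ρ′ k ℚ.+ d) (sym (ℚ.*-identityˡ δ)) (proj₁ (c k))

  lip-const : ∀ q → Lipschitz {K} (λ _ → q)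
  lip-const q .L = 0ℚ
  lip-const q .0≤L = ℚ.≤-refl
  lip-const q .bound {δ} _ c = linear₁
    (solve 2 (λ q δ → con 0ℚ :- con 0ℚ := (q :+ con 0ℚ :* δ) :- q) refl q δ) (ℚ.≤-refl {0ℚ})

  module _ {f g : (K → ℚ) → ℚ} (F : Lipschitz f) (G : Lipschitz g) where

    lip-+ : Lipschitz (λ ρ → f ρ ℚ.+ g ρ)
    lip-+ .L = L F ℚ.+ L G
    lip-+ .0≤L = ℚ.+-mono-≤ (0≤L F) (0≤L G)
    lip-+ .bound {δ} 0≤δ {ρ} {ρ′} c = +-bound (f ρ) (f ρ′) (g ρ) (g ρ′) (L F) (L G) δ
      (bound F 0≤δ c) (bound G 0≤δ c)

    private
      below : ∀ l a d b → 0ℚ ℚ.≤ d → a ℚ.≤ b ℚ.+ l → a ℚ.≤ b ℚ.+ (l ℚ.+ d)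
      below l a d b 0≤d le = linear₂
        (solve 4 (λ a b l d → (b :+ l :- a) :+ (d :- con 0ℚ) := (b :+ (l :+ d)) :- a) refl a b l d)
        le 0≤d

      module _ {δ} (0≤δ : 0ℚ ℚ.≤ δ) {ρ ρ′ : K → ℚ}
               (c : ∀ k → ρ k ℚ.≤ ρ′ k ℚ.+ δ × ρ′ k ℚ.≤ ρ k ℚ.+ δ) where

        sum-bound : ℚ
        sum-bound = (L F ℚ.+ L G) ℚ.* δ

        f-below : f ρ ℚ.≤ f ρ′ ℚ.+ sum-bound
        f-below = subst (λ d → f ρ ℚ.≤ f ρ′ ℚ.+ d) (sym (ℚ.*-distribʳ-+ δ (L F) (L G)))
          (below (L F ℚ.* δ) (f ρ) (L G ℚ.* δ) (f ρ′) (0≤* (L G) δ (0≤L G) 0≤δ) (bound F 0≤δ c))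

        g-below : g ρ ℚ.≤ g ρ′ ℚ.+ sum-bound
        g-below = subst (λ d → g ρ ℚ.≤ g ρ′ ℚ.+ d)
          (trans (ℚ.+-comm (L G ℚ.* δ) (L F ℚ.* δ)) (sym (ℚ.*-distribʳ-+ δ (L F) (L G))))
          (below (L G ℚ.* δ) (g ρ) (L F ℚ.* δ) (g ρ′) (0≤* (L F) δ (0≤L F) 0≤δ) (bound G 0≤δ c))

    -- The sum of the constants is used as an upper bound of both.
    lip-⊔ : Lipschitz (λ ρ → f ρ ℚ.⊔ g ρ)
    lip-⊔ .L = L F ℚ.+ L G
    lip-⊔ .0≤L = ℚ.+-mono-≤ (0≤L F) (0≤L G)
    lip-⊔ .bound {δ} 0≤δ {ρ} {ρ′} c = ℚ.⊔-lub
      (ℚ.≤-trans (f-below 0≤δ c) (ℚ.+-monoˡ-≤ ((L F ℚ.+ L G) ℚ.* δ) (ℚ.p≤p⊔q (f ρ′) (g ρ′))))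
      (ℚ.≤-trans (g-below 0≤δ c) (ℚ.+-monoˡ-≤ ((L F ℚ.+ L G) ℚ.* δ) (ℚ.p≤q⊔p (f ρ′) (g ρ′))))

    lip-⊓ : Lipschitz (λ ρ → f ρ ℚ.⊓ g ρ)
    lip-⊓ .L = L F ℚ.+ L G
    lip-⊓ .0≤L = ℚ.+-mono-≤ (0≤L F) (0≤L G)
    lip-⊓ .bound {δ} 0≤δ {ρ} {ρ′} c = Sum.[
        (λ eq → subst (λ b → f ρ ℚ.⊓ g ρ ℚ.≤ b ℚ.+ (L F ℚ.+ L G) ℚ.* δ) (sym eq)
                  (ℚ.≤-trans (ℚ.p⊓q≤p (f ρ) (g ρ)) (f-below 0≤δ c))) ,
        (λ eq → subst (λ b → f ρ ℚ.⊓ g ρ ℚ.≤ b ℚ.+ (L F ℚ.+ L G) ℚ.* δ) (sym eq)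
                  (ℚ.≤-trans (ℚ.p⊓q≤q (f ρ) (g ρ)) (g-below 0≤δ c))) ]′
      (ℚ.⊓-sel (f ρ′) (g ρ′))

    lip-- : Lipschitz (λ ρ → f ρ ℚ.- g ρ)
    lip-- .L = L F ℚ.+ L G
    lip-- .0≤L = ℚ.+-mono-≤ (0≤L F) (0≤L G)
    lip-- .bound {δ} 0≤δ {ρ} {ρ′} c = minus-bound (f ρ) (f ρ′) (g ρ) (g ρ′) (L F) (L G) δ
      (bound F 0≤δ c) (bound G 0≤δ (λ k → proj₂ (c k) , proj₁ (c k)))

  lip-* : ∀ {q f} → 0ℚ ℚ.≤ q → Lipschitz {K} f → Lipschitz (λ ρ → q ℚ.* f ρ)
  lip-* {q} 0≤q F .L = q ℚ.* L F
  lip-* {q} 0≤q F .0≤L = 0≤* q (L F) 0≤q (0≤L F)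
  lip-* {q} {f} 0≤q F .bound {δ} 0≤δ {ρ} {ρ′} c = subst (q ℚ.* f ρ ℚ.≤_)
    (*-bound q (f ρ′) (L F) δ)
    (ℚ.*-monoˡ-≤-nonNeg q {{ℚ.nonNegative 0≤q}} (bound F 0≤δ c))

  lip-∑ : ∀ {I : Set} is {f : I → (K → ℚ) → ℚ} → (∀ i → Lipschitz (f i)) →
          Lipschitz (λ ρ → ∑ℚ is (λ i → f i ρ))
  lip-∑ []       F = lip-const 0ℚ
  lip-∑ (i ∷ is) F = lip-+ (F i) (lip-∑ is F)

abstract
  -- Dividing ε by L + 1 instead of L covers L = 0 as well.
  shrink : ∀ L → 0ℚ ℚ.≤ L → ∀ ε → 0ℚ ℚ.< ε → ∃ λ δ → 0ℚ ℚ.< δ × L ℚ.* δ ℚ.≤ ε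
  shrink L 0≤L ε 0<ε = ε ℚ.* ℚ.1/ M , 0<ε/q ε 0<ε ,
      subst (L ℚ.* (ε ℚ.* ℚ.1/ M) ℚ.≤_) (q*ε/q ε)
        (ℚ.*-monoʳ-≤-nonNeg (ε ℚ.* ℚ.1/ M) {{ℚ.nonNegative (ℚ.<⇒≤ (0<ε/q ε 0<ε))}} L≤M)
    where
    M : ℚ
    M = L ℚ.+ 1ℚ

    L≤M : L ℚ.≤ M
    L≤M = subst (ℚ._≤ M) (ℚ.+-identityʳ L) (ℚ.+-monoʳ-≤ L (ℚ.<⇒≤ (ℚ.positive⁻¹ 1ℚ)))

    open Scale M (ℚ.+-mono-≤-< 0≤L (ℚ.positive⁻¹ 1ℚ))

module Lift {K : Set} (keys : List K) (complete : ∀ k → k List.∈ keys) where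

  Close : ℚ → (K → ℚ) → (K → ℚ) → Set
  Close δ ρ ρ′ = ∀ k → ρ k ℚ.≤ ρ′ k ℚ.+ δ × ρ′ k ℚ.≤ ρ k ℚ.+ δ

  infixl 20 _at_

  _at_ : (K → ℝ) → ℕ → K → ℚ
  (ρ at n) k = seq (ρ k) n

  abstract
    uniform : {P : K → ℕ → Set} → (∀ k → ∃ λ N → ∀ n → N ℕ.≤ n → P k n) →
              ∃ λ N → ∀ n → N ℕ.≤ n → ∀ k → P k n
    uniform {P} p = let N , q = go keys in N , λ n b k → q n b (complete k)
      where
      go : ∀ ks → ∃ λ N → ∀ n → N ℕ.≤ n → ∀ {k} → k List.∈ ks → P k n
      go []       = 0 , λ _ _ ()
      go (k ∷ ks) = let M , q = p k
                        N , r = go ks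
                    in M ℕ.⊔ N , λ where
                         n b (here refl)  → q n (ℕ.m⊔n≤o⇒m≤o M N b)
                         n b (there k∈ks) → r n (ℕ.m⊔n≤o⇒n≤o M N b) k∈ks

    at-cauchy : ∀ ρ δ → 0ℚ ℚ.< δ → ∃ λ N → ∀ n → N ℕ.≤ n → ∀ k → ∀ m → n ℕ.≤ m →
                (ρ at n) k ℚ.≤ (ρ at m) k ℚ.+ δ × (ρ at m) k ℚ.≤ (ρ at n) k ℚ.+ δ
    at-cauchy ρ δ 0<δ = uniform
      {λ k n → ∀ m → n ℕ.≤ m → seq (ρ k) n ℚ.≤ seq (ρ k) m ℚ.+ δ × seq (ρ k) m ℚ.≤ seq (ρ k) n ℚ.+ δ}
      λ k → proj₁ (modulus (ρ k) δ 0<δ) , λ n N≤n m n≤m →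
        proj₂ (modulus (ρ k) δ 0<δ) n m N≤n (ℕ.≤-trans N≤n n≤m) ,
        proj₂ (modulus (ρ k) δ 0<δ) m n (ℕ.≤-trans N≤n n≤m) N≤n

    close-at : ∀ ρ δ → 0ℚ ℚ.< δ →
               ∃ λ N → ∀ m n → N ℕ.≤ m → N ℕ.≤ n → Close δ (ρ at m) (ρ at n)
    close-at ρ δ 0<δ = proj₁ late , λ m n N≤m N≤n k → close m n N≤m N≤n k (ℕ.≤-total m n)
      where
      late : ∃ λ N → ∀ n → N ℕ.≤ n → ∀ k → ∀ m → n ℕ.≤ m →
             (ρ at n) k ℚ.≤ (ρ at m) k ℚ.+ δ × (ρ at m) k ℚ.≤ (ρ at n) k ℚ.+ δ
      late = at-cauchy ρ δ 0<δ

      close : ∀ m n → proj₁ late ℕ.≤ m → proj₁ late ℕ.≤ n → ∀ k → m ℕ.≤ n ⊎ n ℕ.≤ m →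
              (ρ at m) k ℚ.≤ (ρ at n) k ℚ.+ δ × (ρ at n) k ℚ.≤ (ρ at m) k ℚ.+ δ
      close m n N≤m N≤n k (inj₁ m≤n) = proj₂ late m N≤m k n m≤n
      close m n N≤m N≤n k (inj₂ n≤m) =
        proj₂ (proj₂ late n N≤n k m n≤m) , proj₁ (proj₂ late n N≤n k m n≤m)

    stays-close : ∀ {f} (F : Lipschitz f) ε → 0ℚ ℚ.< ε → ∃ λ δ → 0ℚ ℚ.< δ ×
                  (∀ ρ ρ′ → Close δ ρ ρ′ → f ρ ℚ.≤ f ρ′ ℚ.+ ε)
    stays-close {f} F ε 0<ε = let δ , 0<δ , Lδ≤ε = shrink (L F) (0≤L F) ε 0<ε in
      δ , 0<δ , λ ρ ρ′ close →
        ℚ.≤-trans (bound F (ℚ.<⇒≤ 0<δ) {ρ} {ρ′} close) (ℚ.+-monoʳ-≤ (f ρ′) Lδ≤ε)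

    lift-cauchy : ∀ {f} → Lipschitz f → ∀ ρ ε → 0ℚ ℚ.< ε → ∃ λ N → ∀ m n → N ℕ.≤ m → N ℕ.≤ n →
                  ℚ.∣ f (ρ at m) ℚ.- f (ρ at n) ∣ ℚ.< ε
    lift-cauchy {f} F ρ ε 0<ε =
      let δ , 0<δ , p = stays-close F (ε ℚ.* ½) (0<½ε ε 0<ε)
          N , q       = close-at ρ δ 0<δ
      in N , λ m n N≤m N≤n → ℚ.≤-<-trans
           (∣p-q∣≤ε {f (ρ at m)} {f (ρ at n)} {ε ℚ.* ½}
             (p (ρ at m) (ρ at n) (q m n N≤m N≤n)) (p (ρ at n) (ρ at m) (q n m N≤n N≤m)))
           ½ε<ε
      where
      ½ε<ε : ε ℚ.* ½ ℚ.< ε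
      ½ε<ε = subst₂ ℚ._<_ (ℚ.+-identityʳ (ε ℚ.* ½)) (half+half ε)
        (ℚ.+-monoʳ-< (ε ℚ.* ½) (0<½ε ε 0<ε))

  -- Termwise application to the approximating sequences: an exact identity between rational
  -- functions becomes an identity of reals through `seq-≡⇒≈`.
  lift : ∀ {f} → Lipschitz f → (K → ℝ) → ℝ
  lift {f} F ρ .seq n = f (ρ at n)
  lift {f} F ρ .cauchy = lift-cauchy F ρ

  abstract
    near⇒close : ∀ ρ ρ′ δ → (∀ k → Near δ (ρ k) (ρ′ k)) →
                 ∃ λ N → ∀ n → N ℕ.≤ n → Close δ (ρ at n) (ρ′ at n)
    near⇒close ρ ρ′ δ near = uniform
        {λ k n → seq (ρ k) n ℚ.≤ seq (ρ′ k) n ℚ.+ δ × seq (ρ′ k) n ℚ.≤ seq (ρ k) n ℚ.+ δ} late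
      where
      weaken : ∀ a b η → 0ℚ ℚ.< η → a ℚ.+ η ℚ.≤ b → a ℚ.≤ b
      weaken a b η 0<η = ℚ.≤-trans
        (subst (ℚ._≤ a ℚ.+ η) (ℚ.+-identityʳ a) (ℚ.+-monoʳ-≤ a (ℚ.<⇒≤ 0<η)))

      late : ∀ k → ∃ λ N → ∀ n → N ℕ.≤ n →
             seq (ρ k) n ℚ.≤ seq (ρ′ k) n ℚ.+ δ × seq (ρ′ k) n ℚ.≤ seq (ρ k) n ℚ.+ δ
      late k = let (η , 0<η , M , p) , (θ , 0<θ , N , q) = near k in
        M ℕ.⊔ N , λ n c →
          weaken (seq (ρ k) n) (seq (ρ′ k) n ℚ.+ δ) η 0<η (p n (ℕ.m⊔n≤o⇒m≤o M N c)) ,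
          weaken (seq (ρ′ k) n) (seq (ρ k) n ℚ.+ δ) θ 0<θ (q n (ℕ.m⊔n≤o⇒n≤o M N c))

    -- The radius depends only on ε and the Lipschitz constant, not on the point. It is chosen for
    -- half of ε, since the other half is the gap that a strict inequality has to exhibit.
    lift-near : ∀ {f} (F : Lipschitz f) ε → 0ℚ ℚ.< ε → ∃ λ δ → 0ℚ ℚ.< δ ×
                (∀ ρ ρ′ → (∀ k → Near δ (ρ k) (ρ′ k)) → Near ε (lift F ρ) (lift F ρ′))
    lift-near {f} F ε 0<ε = δ , proj₁ (proj₂ control) , λ ρ ρ′ near →
        below ρ ρ′ near , below ρ′ ρ (λ k → Product.swap (near k))
      where
      control : ∃ λ δ → 0ℚ ℚ.< δ × (∀ ρ ρ′ → Close δ ρ ρ′ → f ρ ℚ.≤ f ρ′ ℚ.+ ε ℚ.* ½)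
      control = stays-close F (ε ℚ.* ½) (0<½ε ε 0<ε)

      δ : ℚ
      δ = proj₁ control

      below : ∀ ρ ρ′ → (∀ k → Near δ (ρ k) (ρ′ k)) → lift F ρ < lift F ρ′ + const ε
      below ρ ρ′ near = let N , q = near⇒close ρ ρ′ δ near in
        ε ℚ.* ½ , 0<½ε ε 0<ε , N , λ n N≤n →
        half-gap (f (ρ at n)) (f (ρ′ at n)) ε
          (proj₂ (proj₂ control) (ρ at n) (ρ′ at n) (q n N≤n))

-- The layer cake of a rational vector

infixl 6 _∸_

-- Length of the interval from l to u, zero if the interval is empty.
_∸_ : ℚ → ℚ → ℚ
u ∸ l = 0ℚ ℚ.⊔ (u ℚ.- l)

p≤q⇒p-q≤0 : ∀ {p q} → p ℚ.≤ q → p ℚ.- q ℚ.≤ 0ℚ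
p≤q⇒p-q≤0 {p} {q} p≤q = subst (p ℚ.- q ℚ.≤_) (ℚ.+-inverseʳ q) (ℚ.+-monoˡ-≤ (ℚ.- q) p≤q)

u≤l⇒u∸l≡0 : ∀ {u l} → u ℚ.≤ l → u ∸ l ≡ 0ℚ
u≤l⇒u∸l≡0 u≤l = ℚ.p≥q⇒p⊔q≡p (p≤q⇒p-q≤0 u≤l)

l≤u⇒u∸l≡u-l : ∀ {u l} → l ℚ.≤ u → u ∸ l ≡ u ℚ.- l
l≤u⇒u∸l≡u-l l≤u = ℚ.p≤q⇒p⊔q≡q (p≤q⇒0≤q-p l≤u)

0≤∸ : ∀ u l → 0ℚ ℚ.≤ u ∸ l
0≤∸ u l = ℚ.p≤p⊔q 0ℚ (u ℚ.- l)

∸-mono-≤ : ∀ {u u′ l l′} → u ℚ.≤ u′ → l′ ℚ.≤ l → u ∸ l ℚ.≤ u′ ∸ l′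
∸-mono-≤ u≤u′ l′≤l = ℚ.⊔-monoʳ-≤ 0ℚ (ℚ.+-mono-≤ u≤u′ (ℚ.neg-antimono-≤ l′≤l))

-- Cuts the interval from l to u at y into the part above y and the part below, wherever y lies.
∸-split : ∀ u l y → (u ∸ (l ℚ.⊔ y)) ℚ.+ ((u ℚ.⊓ y) ∸ l) ≡ u ∸ l
∸-split u l y = cases (ℚ.≤-total y l) (ℚ.≤-total u y)
  where
  open ≡-Reasoning

  cases : y ℚ.≤ l ⊎ l ℚ.≤ y → u ℚ.≤ y ⊎ y ℚ.≤ u → (u ∸ (l ℚ.⊔ y)) ℚ.+ ((u ℚ.⊓ y) ∸ l) ≡ u ∸ l
  cases (inj₁ y≤l) _ = trans
    (cong₂ ℚ._+_ (cong (u ∸_) (ℚ.p≥q⇒p⊔q≡p y≤l))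
                 (u≤l⇒u∸l≡0 (ℚ.≤-trans (ℚ.p⊓q≤q u y) y≤l)))
    (ℚ.+-identityʳ (u ∸ l))
  cases (inj₂ l≤y) (inj₁ u≤y) = trans
    (cong₂ ℚ._+_ (u≤l⇒u∸l≡0 (ℚ.≤-trans u≤y (ℚ.p≤q⊔p l y)))
                 (cong (_∸ l) (ℚ.p≤q⇒p⊓q≡p u≤y)))
    (ℚ.+-identityˡ (u ∸ l))
  cases (inj₂ l≤y) (inj₂ y≤u) = begin
    (u ∸ (l ℚ.⊔ y)) ℚ.+ ((u ℚ.⊓ y) ∸ l)
      ≡⟨ cong₂ ℚ._+_ (cong (u ∸_) (ℚ.p≤q⇒p⊔q≡q l≤y)) (cong (_∸ l) (ℚ.p≥q⇒p⊓q≡q y≤u)) ⟩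
    (u ∸ y) ℚ.+ (y ∸ l)
      ≡⟨ cong₂ ℚ._+_ (l≤u⇒u∸l≡u-l y≤u) (l≤u⇒u∸l≡u-l l≤y) ⟩
    (u ℚ.- y) ℚ.+ (y ℚ.- l)
      ≡⟨ solve 3 (λ u y l → (u :- y) :+ (y :- l) := u :- l) refl u y l ⟩
    u ℚ.- l
      ≡⟨ sym (l≤u⇒u∸l≡u-l (ℚ.≤-trans l≤y y≤u)) ⟩
    u ∸ l ∎

-- The length of the set of levels r between l and u with { v ∣ r < x v } = A.

layer : ∀ {n} → Subset n → ℚ → ℚ → (Fin n → ℚ) → ℚ
layer Vec.[]            u l x = u ∸ l
layer (outside Vec.∷ A) u l x = layer A u (l ℚ.⊔ x zero) (x ∘ suc)
layer (inside  Vec.∷ A) u l x = layer A (u ℚ.⊓ x zero) l (x ∘ suc)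

0≤layer : ∀ {n} (A : Subset n) u l x → 0ℚ ℚ.≤ layer A u l x
0≤layer Vec.[]            u l x = 0≤∸ u l
0≤layer (outside Vec.∷ A) u l x = 0≤layer A u (l ℚ.⊔ x zero) (x ∘ suc)
0≤layer (inside  Vec.∷ A) u l x = 0≤layer A (u ℚ.⊓ x zero) l (x ∘ suc)

-- The levels that belong to A end at the minimum of u and all `x a` with a in A, and begin at the
-- maximum of l and all `x b` with b outside A. Any upper candidate minus any lower one bounds the
-- length; this is how a positive weight yields inequalities between coordinates.
layer-≤ : ∀ {n} (A : Subset n) {u l x u′ l′} →
          u ℚ.≤ u′ ⊎ ∃ (λ a → a ∈ A × x a ℚ.≤ u′) →
          l′ ℚ.≤ l ⊎ ∃ (λ b → b ∉ A × l′ ℚ.≤ x b) →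
          layer A u l x ℚ.≤ u′ ∸ l′
layer-≤ Vec.[] (inj₁ u≤u′) (inj₁ l′≤l) = ∸-mono-≤ u≤u′ l′≤l
layer-≤ (outside Vec.∷ A) {u} {l} {x} {u′} {l′} upper lower = layer-≤ A (up upper) (low lower)
  where
  up : u ℚ.≤ u′ ⊎ ∃ (λ a → a ∈ outside Vec.∷ A × x a ℚ.≤ u′) →
       u ℚ.≤ u′ ⊎ ∃ (λ a → a ∈ A × x (suc a) ℚ.≤ u′)
  up (inj₁ u≤u′)                  = inj₁ u≤u′
  up (inj₂ (suc a , there a∈A , p)) = inj₂ (a , a∈A , p)

  low : l′ ℚ.≤ l ⊎ ∃ (λ b → b ∉ outside Vec.∷ A × l′ ℚ.≤ x b) →
        l′ ℚ.≤ l ℚ.⊔ x zero ⊎ ∃ (λ b → b ∉ A × l′ ℚ.≤ x (suc b))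
  low (inj₁ l′≤l)           = inj₁ (ℚ.≤-trans l′≤l (ℚ.p≤p⊔q l (x zero)))
  low (inj₂ (zero , _ , p))    = inj₁ (ℚ.≤-trans p (ℚ.p≤q⊔p l (x zero)))
  low (inj₂ (suc b , b∉A , p)) = inj₂ (b , b∉A ∘ there , p)
layer-≤ (inside Vec.∷ A) {u} {l} {x} {u′} {l′} upper lower = layer-≤ A (up upper) (low lower)
  where
  up : u ℚ.≤ u′ ⊎ ∃ (λ a → a ∈ inside Vec.∷ A × x a ℚ.≤ u′) →
       u ℚ.⊓ x zero ℚ.≤ u′ ⊎ ∃ (λ a → a ∈ A × x (suc a) ℚ.≤ u′)
  up (inj₁ u≤u′)                  = inj₁ (ℚ.≤-trans (ℚ.p⊓q≤p u (x zero)) u≤u′)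
  up (inj₂ (zero , _ , p))          = inj₁ (ℚ.≤-trans (ℚ.p⊓q≤q u (x zero)) p)
  up (inj₂ (suc a , there a∈A , p)) = inj₂ (a , a∈A , p)

  low : l′ ℚ.≤ l ⊎ ∃ (λ b → b ∉ inside Vec.∷ A × l′ ℚ.≤ x b) →
        l′ ℚ.≤ l ⊎ ∃ (λ b → b ∉ A × l′ ℚ.≤ x (suc b))
  low (inj₁ l′≤l)              = inj₁ l′≤l
  low (inj₂ (zero , ∉A , p))   = ⊥-elim (∉A here)
  low (inj₂ (suc b , b∉A , p)) = inj₂ (b , b∉A ∘ there , p)

indicator : ∀ {n} → Subset n → Fin n → ℚ → ℚ
indicator A v q = if does (v Subset.∈? A) then q else 0ℚ

-- Each coordinate cuts the interval into the levels that leave it out and the levels that include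
-- it, so the layers of all subsets partition the interval.
∑-layer : ∀ {n} u l (x : Fin n → ℚ) → ∑ℚ (subsets n) (λ A → layer A u l x) ≡ u ∸ l
∑-layer {ℕ.zero}  u l x = ℚ.+-identityʳ (u ∸ l)
∑-layer {ℕ.suc n} u l x = begin
  ∑ℚ (subsets (ℕ.suc n)) (λ A → layer A u l x)
    ≡⟨ ∑ℚ-++ (map (outside Vec.∷_) (subsets n)) _ (λ A → layer A u l x) ⟩
  ∑ℚ (map (outside Vec.∷_) (subsets n)) (λ A → layer A u l x) ℚ.+
  ∑ℚ (map (inside Vec.∷_) (subsets n)) (λ A → layer A u l x)
    ≡⟨ cong₂ ℚ._+_ (∑ℚ-map (outside Vec.∷_) (subsets n) (λ A → layer A u l x))
                   (∑ℚ-map (inside Vec.∷_) (subsets n) (λ A → layer A u l x)) ⟩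
  ∑ℚ (subsets n) (λ A → layer A u (l ℚ.⊔ x zero) (x ∘ suc)) ℚ.+
  ∑ℚ (subsets n) (λ A → layer A (u ℚ.⊓ x zero) l (x ∘ suc))
    ≡⟨ cong₂ ℚ._+_ (∑-layer u (l ℚ.⊔ x zero) (x ∘ suc)) (∑-layer (u ℚ.⊓ x zero) l (x ∘ suc)) ⟩
  (u ∸ (l ℚ.⊔ x zero)) ℚ.+ ((u ℚ.⊓ x zero) ∸ l)
    ≡⟨ ∸-split u l (x zero) ⟩
  u ∸ l ∎
  where open ≡-Reasoning

-- The layer cake formula: sets containing v occupy exactly the levels below `x v`.
∑-layer-∋ : ∀ {n} u l (x : Fin n → ℚ) v →
            ∑ℚ (subsets n) (λ A → indicator A v (layer A u l x)) ≡ (u ℚ.⊓ x v) ∸ l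
∑-layer-∋ {ℕ.suc n} u l x v = begin
  ∑ℚ (subsets (ℕ.suc n)) (λ A → indicator A v (layer A u l x))
    ≡⟨ ∑ℚ-++ (map (outside Vec.∷_) (subsets n)) _ (λ A → indicator A v (layer A u l x)) ⟩
  ∑ℚ (map (outside Vec.∷_) (subsets n)) (λ A → indicator A v (layer A u l x)) ℚ.+
  ∑ℚ (map (inside Vec.∷_) (subsets n)) (λ A → indicator A v (layer A u l x))
    ≡⟨ cong₂ ℚ._+_ (∑ℚ-map (outside Vec.∷_) (subsets n) (λ A → indicator A v (layer A u l x)))
                   (∑ℚ-map (inside Vec.∷_) (subsets n) (λ A → indicator A v (layer A u l x))) ⟩
  ∑ℚ (subsets n) (λ A → indicator (outside Vec.∷ A) v (layer A u (l ℚ.⊔ x zero) (x ∘ suc))) ℚ.+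
  ∑ℚ (subsets n) (λ A → indicator (inside Vec.∷ A) v (layer A (u ℚ.⊓ x zero) l (x ∘ suc)))
    ≡⟨ step v ⟩
  (u ℚ.⊓ x v) ∸ l ∎
  where
  open ≡-Reasoning

  step : ∀ v →
    ∑ℚ (subsets n) (λ A → indicator (outside Vec.∷ A) v (layer A u (l ℚ.⊔ x zero) (x ∘ suc))) ℚ.+
    ∑ℚ (subsets n) (λ A → indicator (inside Vec.∷ A) v (layer A (u ℚ.⊓ x zero) l (x ∘ suc)))
    ≡ (u ℚ.⊓ x v) ∸ l
  step zero = trans
    (cong₂ ℚ._+_ (∑ℚ-0 (subsets n)) (∑-layer (u ℚ.⊓ x zero) l (x ∘ suc)))
    (ℚ.+-identityˡ ((u ℚ.⊓ x zero) ∸ l))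
  step (suc v) = begin
    ∑ℚ (subsets n) (λ A → indicator A v (layer A u (l ℚ.⊔ x zero) (x ∘ suc))) ℚ.+
    ∑ℚ (subsets n) (λ A → indicator A v (layer A (u ℚ.⊓ x zero) l (x ∘ suc)))
      ≡⟨ cong₂ ℚ._+_ (∑-layer-∋ u (l ℚ.⊔ x zero) (x ∘ suc) v)
                     (∑-layer-∋ (u ℚ.⊓ x zero) l (x ∘ suc) v) ⟩
    ((u ℚ.⊓ x (suc v)) ∸ (l ℚ.⊔ x zero)) ℚ.+ (((u ℚ.⊓ x zero) ℚ.⊓ x (suc v)) ∸ l)
      -- `x zero` becomes the outermost cut, the form in which `∸-split` applies.
      ≡⟨ cong (λ w → ((u ℚ.⊓ x (suc v)) ∸ (l ℚ.⊔ x zero)) ℚ.+ (w ∸ l))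
              (trans (ℚ.⊓-assoc u (x zero) (x (suc v)))
                     (trans (cong (u ℚ.⊓_) (ℚ.⊓-comm (x zero) (x (suc v))))
                            (sym (ℚ.⊓-assoc u (x (suc v)) (x zero))))) ⟩
    ((u ℚ.⊓ x (suc v)) ∸ (l ℚ.⊔ x zero)) ℚ.+ (((u ℚ.⊓ x (suc v)) ℚ.⊓ x zero) ∸ l)
      ≡⟨ ∸-split (u ℚ.⊓ x (suc v)) l (x zero) ⟩
    (u ℚ.⊓ x (suc v)) ∸ l ∎

lip-∸ : ∀ {K} {f g : (K → ℚ) → ℚ} → Lipschitz f → Lipschitz g → Lipschitz (λ ρ → f ρ ∸ g ρ)
lip-∸ F G = lip-⊔ (lip-const 0ℚ) (lip-- F G)

lip-layer : ∀ {K n} (A : Subset n) {u l : (K → ℚ) → ℚ} {x : Fin n → (K → ℚ) → ℚ} →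
            Lipschitz u → Lipschitz l → (∀ v → Lipschitz (x v)) →
            Lipschitz (λ ρ → layer A (u ρ) (l ρ) (λ v → x v ρ))
lip-layer Vec.[]            U L X = lip-∸ U L
lip-layer (outside Vec.∷ A) U L X = lip-layer A U (lip-⊔ L (X zero)) (X ∘ suc)
lip-layer (inside  Vec.∷ A) U L X = lip-layer A (lip-⊓ U (X zero)) L (X ∘ suc)

-- Cardinalities and barycentres

fromℕ : ℕ → ℚ
fromℕ ℕ.zero    = 0ℚ
fromℕ (ℕ.suc k) = 1ℚ ℚ.+ fromℕ k

0≤fromℕ : ∀ k → 0ℚ ℚ.≤ fromℕ k
0≤fromℕ ℕ.zero    = ℚ.≤-refl
0≤fromℕ (ℕ.suc k) = ℚ.+-mono-≤ (ℚ.<⇒≤ (ℚ.positive⁻¹ 1ℚ)) (0≤fromℕ k)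

fromℕ≡/1 : ∀ k → fromℕ k ≡ ℚ.fromℚᵘ (ℚᵘ.mkℚᵘ (+ k) 0)
fromℕ≡/1 ℕ.zero    = refl
fromℕ≡/1 (ℕ.suc k) = ℚ.toℚᵘ-injective (begin-equality
  ℚ.toℚᵘ (1ℚ ℚ.+ fromℕ k)
    ≃⟨ ℚ.toℚᵘ-homo-+ 1ℚ (fromℕ k) ⟩
  ℚᵘ.1ℚᵘ ℚᵘ.+ ℚ.toℚᵘ (fromℕ k)
    ≃⟨ ℚᵘ.+-congʳ ℚᵘ.1ℚᵘ (ℚᵘ.≃-trans (ℚ.toℚᵘ-cong (fromℕ≡/1 k)) (ℚ.toℚᵘ-fromℚᵘ (ℚᵘ.mkℚᵘ (+ k) 0))) ⟩
  ℚᵘ.1ℚᵘ ℚᵘ.+ ℚᵘ.mkℚᵘ (+ k) 0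
    ≃⟨ ℚᵘ.*≡* (cong (λ i → (+ 1 ℤ.+ i) ℤ.* + 1) (ℤ.*-identityʳ (+ k))) ⟩
  ℚᵘ.mkℚᵘ (+ (ℕ.suc k)) 0
    ≃⟨ ℚᵘ.≃-sym (ℚ.toℚᵘ-fromℚᵘ (ℚᵘ.mkℚᵘ (+ (ℕ.suc k)) 0)) ⟩
  ℚ.toℚᵘ (ℚ.fromℚᵘ (ℚᵘ.mkℚᵘ (+ (ℕ.suc k)) 0)) ∎)
  where open ℚᵘ.≤-Reasoning

1/-*-fromℕ : ∀ k .{{_ : ℕ.NonZero k}} → (1/ k) ℚ.* fromℕ k ≡ 1ℚ
1/-*-fromℕ (ℕ.suc k) = ℚ.toℚᵘ-injective (begin-equality
  ℚ.toℚᵘ (r ℚ.* fromℕ (ℕ.suc k))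
    ≃⟨ ℚ.toℚᵘ-homo-* r (fromℕ (ℕ.suc k)) ⟩
  ℚ.toℚᵘ r ℚᵘ.* ℚ.toℚᵘ (fromℕ (ℕ.suc k))
    ≃⟨ ℚᵘ.*-cong (ℚ.toℚᵘ-fromℚᵘ (ℚᵘ.mkℚᵘ (+ 1) k))
         (ℚᵘ.≃-trans (ℚ.toℚᵘ-cong (fromℕ≡/1 (ℕ.suc k))) (ℚ.toℚᵘ-fromℚᵘ (ℚᵘ.mkℚᵘ (+ (ℕ.suc k)) 0))) ⟩
  ℚᵘ.mkℚᵘ (+ 1) k ℚᵘ.* ℚᵘ.mkℚᵘ (+ (ℕ.suc k)) 0
    ≃⟨ ℚᵘ.*≡* (trans (ℤ.*-identityʳ _) (trans (ℤ.*-identityˡ _)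
         (sym (trans (ℤ.*-identityˡ _) (cong (+_ ∘ ℕ.suc) (ℕ.*-identityʳ k)))))) ⟩
  ℚᵘ.1ℚᵘ ∎)
  where
  open ℚᵘ.≤-Reasoning

  r : ℚ
  r = ℚ.fromℚᵘ (ℚᵘ.mkℚᵘ (+ 1) k)

∑ℚ-allFin-suc : ∀ n (f : Fin (ℕ.suc n) → ℚ) →
                ∑ℚ (allFin (ℕ.suc n)) f ≡ f zero ℚ.+ ∑ℚ (allFin n) (f ∘ suc)
∑ℚ-allFin-suc n f = cong (f zero ℚ.+_)
  (trans (cong (λ is → ∑ℚ is f) (sym (map-tabulate id suc))) (∑ℚ-map suc (allFin n) f))

∑-indicator : ∀ {n} (A : Subset n) q → ∑ℚ (allFin n) (λ v → indicator A v q) ≡ fromℕ Subset.∣ A ∣ ℚ.* q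
∑-indicator Vec.[] q = sym (ℚ.*-zeroˡ q)
∑-indicator {ℕ.suc n} (outside Vec.∷ A) q = trans (∑ℚ-allFin-suc n (λ v → indicator (outside Vec.∷ A) v q))
  (trans (ℚ.+-identityˡ _) (∑-indicator A q))
∑-indicator {ℕ.suc n} (inside Vec.∷ A) q = begin
  ∑ℚ (allFin (ℕ.suc n)) (λ v → indicator (inside Vec.∷ A) v q)
    ≡⟨ ∑ℚ-allFin-suc n (λ v → indicator (inside Vec.∷ A) v q) ⟩
  q ℚ.+ ∑ℚ (allFin n) (λ v → indicator A v q)
    ≡⟨ cong₂ ℚ._+_ (sym (ℚ.*-identityˡ q)) (∑-indicator A q) ⟩
  1ℚ ℚ.* q ℚ.+ fromℕ Subset.∣ A ∣ ℚ.* q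
    ≡⟨ sym (ℚ.*-distribʳ-+ q 1ℚ (fromℕ Subset.∣ A ∣)) ⟩
  fromℕ (ℕ.suc Subset.∣ A ∣) ℚ.* q ∎
  where open ≡-Reasoning

∈⇒∣∣-nonZero : ∀ {n v} {A : Subset n} → v ∈ A → ℕ.NonZero Subset.∣ A ∣
∈⇒∣∣-nonZero {A = inside Vec.∷ A}  v∈A         = _
∈⇒∣∣-nonZero {A = outside Vec.∷ A} (there v∈A) = ∈⇒∣∣-nonZero v∈A

0≤1/ : ∀ k → 0ℚ ℚ.≤ 1/ k
0≤1/ ℕ.zero    = ℚ.≤-refl
0≤1/ (ℕ.suc k) = ℚ.<⇒≤ (ℚ.positive⁻¹ (1/ ℕ.suc k) {{ℚ.normalize-pos 1 (ℕ.suc k)}})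

module _ {n : ℕ} (A : Subset n) where

  indicator-∈ : ∀ {v} q → v ∈ A → indicator A v q ≡ q
  indicator-∈ {v} q v∈A = cong (λ b → if b then q else 0ℚ) (dec-true (v Subset.∈? A) v∈A)

  indicator-∉ : ∀ {v} q → v ∉ A → indicator A v q ≡ 0ℚ
  indicator-∉ {v} q v∉A = cong (λ b → if b then q else 0ℚ) (dec-false (v Subset.∈? A) v∉A)

  0≤barycentre : ∀ v → 0ℚ ℚ.≤ barycentre A v
  0≤barycentre v = cases (does (v Subset.∈? A))
    where
    cases : ∀ b → 0ℚ ℚ.≤ (if b then 1/ Subset.∣ A ∣ else 0ℚ)
    cases true  = 0≤1/ Subset.∣ A ∣
    cases false = ℚ.≤-refl

  0<barycentre⇒∈ : ∀ {v} → 0ℚ ℚ.< barycentre A v → v ∈ A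
  0<barycentre⇒∈ {v} lt = cases (v Subset.∈? A)
    where
    cases : Dec (v ∈ A) → v ∈ A
    cases (yes v∈A) = v∈A
    cases (no v∉A)  = ⊥-elim (ℚ.<-irrefl refl (subst (0ℚ ℚ.<_) (indicator-∉ (1/ Subset.∣ A ∣) v∉A) lt))

  -- The cardinality in a weight cancels the denominator of the barycentre, so every member of A
  -- receives the plain length of the layer.
  barycentre-scaled : ∀ v q → barycentre A v ℚ.* (fromℕ Subset.∣ A ∣ ℚ.* q) ≡ indicator A v q
  barycentre-scaled v q = cases (v Subset.∈? A)
    where
    open ≡-Reasoning

    k : ℕ
    k = Subset.∣ A ∣

    cases : Dec (v ∈ A) → barycentre A v ℚ.* (fromℕ k ℚ.* q) ≡ indicator A v q
    cases (yes v∈A) = begin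
      barycentre A v ℚ.* (fromℕ k ℚ.* q)   ≡⟨ cong (ℚ._* (fromℕ k ℚ.* q)) (indicator-∈ (1/ k) v∈A) ⟩
      (1/ k) ℚ.* (fromℕ k ℚ.* q)           ≡⟨ sym (ℚ.*-assoc (1/ k) (fromℕ k) q) ⟩
      (1/ k) ℚ.* fromℕ k ℚ.* q             ≡⟨ cong (ℚ._* q) (1/-*-fromℕ k {{∈⇒∣∣-nonZero v∈A}}) ⟩
      1ℚ ℚ.* q                             ≡⟨ ℚ.*-identityˡ q ⟩
      q                                    ≡⟨ sym (indicator-∈ q v∈A) ⟩
      indicator A v q                      ∎
    cases (no v∉A) = begin
      barycentre A v ℚ.* (fromℕ k ℚ.* q)   ≡⟨ cong (ℚ._* (fromℕ k ℚ.* q)) (indicator-∉ (1/ k) v∉A) ⟩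
      0ℚ ℚ.* (fromℕ k ℚ.* q)               ≡⟨ ℚ.*-zeroˡ (fromℕ k ℚ.* q) ⟩
      0ℚ                                   ≡⟨ sym (indicator-∉ q v∉A) ⟩
      indicator A v q                      ∎

  ∑-barycentre : Nonempty A → ∑ℚ (allFin n) (barycentre A) ≡ 1ℚ
  ∑-barycentre (v , v∈A) = trans (∑-indicator A (1/ Subset.∣ A ∣))
    (trans (ℚ.*-comm (fromℕ Subset.∣ A ∣) (1/ Subset.∣ A ∣))
           (1/-*-fromℕ Subset.∣ A ∣ {{∈⇒∣∣-nonZero v∈A}}))

  -- The empty set occupies the levels above all coordinates, possibly an interval of positive
  -- length; its cardinality removes it.
  empty⇒weightless : ¬ Nonempty A → ∀ q → fromℕ Subset.∣ A ∣ ℚ.* q ≡ 0ℚ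
  empty⇒weightless ¬ne q = trans (cong (λ B → fromℕ Subset.∣ B ∣ ℚ.* q) (Subset.Empty-unique ¬ne))
    (trans (cong (λ k → fromℕ k ℚ.* q) (Subset.∣⊥∣≡0 n)) (ℚ.*-zeroˡ q))

∑-∣∣*layer : ∀ {n} u l (x : Fin n → ℚ) →
  ∑ℚ (subsets n) (λ A → fromℕ Subset.∣ A ∣ ℚ.* layer A u l x) ≡ ∑ℚ (allFin n) (λ v → (u ℚ.⊓ x v) ∸ l)
∑-∣∣*layer {n} u l x = begin
  ∑ℚ (subsets n) (λ A → fromℕ Subset.∣ A ∣ ℚ.* layer A u l x)
    ≡⟨ ∑ℚ-cong (subsets n) (λ A → sym (∑-indicator A (layer A u l x))) ⟩
  ∑ℚ (subsets n) (λ A → ∑ℚ (allFin n) (λ v → indicator A v (layer A u l x)))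
    ≡⟨ ∑ℚ-swap (subsets n) (allFin n) (λ A v → indicator A v (layer A u l x)) ⟩
  ∑ℚ (allFin n) (λ v → ∑ℚ (subsets n) (λ A → indicator A v (layer A u l x)))
    ≡⟨ ∑ℚ-cong (allFin n) (∑-layer-∋ u l x) ⟩
  ∑ℚ (allFin n) (λ v → (u ℚ.⊓ x v) ∸ l) ∎
  where open ≡-Reasoning

-- Placed at the barycentres of their own sets, the weights rebuild x between the levels l and u.
-- The flow only redirects them to other barycentres.
∑-barycentre*layer : ∀ {n} u l (x : Fin n → ℚ) v →
  ∑ℚ (subsets n) (λ A → barycentre A v ℚ.* (fromℕ Subset.∣ A ∣ ℚ.* layer A u l x)) ≡ (u ℚ.⊓ x v) ∸ l
∑-barycentre*layer {n} u l x v = trans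
  (∑ℚ-cong (subsets n) (λ A → barycentre-scaled A v (layer A u l x))) (∑-layer-∋ u l x v)

-- Subsets and chains of subsets

extremum : {X : Set} {R : Rel X 0ℓ} → Reflexive R → Transitive R → ∀ x xs →
           (∀ {y z} → y List.∈ x ∷ xs → z List.∈ x ∷ xs → R y z ⊎ R z y) →
           ∃ λ m → m List.∈ x ∷ xs × (∀ {y} → y List.∈ x ∷ xs → R m y)
extremum rfl trn x [] total = x , here refl , λ { (here refl) → rfl }
extremum {R = R} rfl trn x (x′ ∷ xs) total =
  let m , m∈ , least = extremum {R = R} rfl trn x′ xs (λ p q → total (there p) (there q))
  in choose m m∈ least (total (here refl) (there m∈))
  where
  choose : ∀ m → m List.∈ x′ ∷ xs → (∀ {y} → y List.∈ x′ ∷ xs → R m y) → R x m ⊎ R m x →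
           ∃ λ m → m List.∈ x ∷ x′ ∷ xs × (∀ {y} → y List.∈ x ∷ x′ ∷ xs → R m y)
  choose m m∈ least (inj₁ xRm) = x , here refl , λ where
    (here refl) → rfl
    (there y∈)  → trn xRm (least y∈)
  choose m m∈ least (inj₂ mRx) = m , there m∈ , λ where
    (here refl) → mRx
    (there y∈)  → least y∈

module _ {n : ℕ} where

  ⟦_⟧ : {P : Pred (Fin n) 0ℓ} → Decidable P → Subset n
  ⟦ P? ⟧ = Vec.tabulate (does ∘ P?)

  ∈⟦⟧⁺ : {P : Pred (Fin n) 0ℓ} (P? : Decidable P) {v : Fin n} → P v → v ∈ ⟦ P? ⟧
  ∈⟦⟧⁺ P? {v} p = lookup⇒[]= v ⟦ P? ⟧ (trans (lookup∘tabulate (does ∘ P?) v) (dec-true (P? v) p))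

  ∈⟦⟧⁻ : {P : Pred (Fin n) 0ℓ} (P? : Decidable P) {v : Fin n} → v ∈ ⟦ P? ⟧ → P v
  ∈⟦⟧⁻ P? {v} v∈ with P? v | trans (sym (lookup∘tabulate (does ∘ P?) v)) ([]=⇒lookup v∈)
  ... | yes p | _ = p

  Comparable : Rel (Subset n) 0ℓ
  Comparable A B = A ⊆ B ⊎ B ⊆ A

  ⊈⇒∃ : ∀ {A B : Subset n} → ¬ (A ⊆ B) → ∃ λ v → v ∈ A × v ∉ B
  ⊈⇒∃ {A} {B} A⊈B with any? (λ v → (v Subset.∈? A) ×-dec ¬? (v Subset.∈? B))
  ... | yes p = p
  ... | no ¬p = contradiction
        (λ {v} v∈A → decidable-stable (v Subset.∈? B) (λ v∉B → ¬p (v , v∈A , v∉B))) A⊈B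

  ⊆⇒≡⊎⊂ : ∀ {A B : Subset n} → A ⊆ B → A ≡ B ⊎ A ⊂ B
  ⊆⇒≡⊎⊂ {A} {B} A⊆B with B Subset.⊆? A
  ... | yes B⊆A = inj₁ (Subset.⊆-antisym A⊆B B⊆A)
  ... | no  B⊈A = inj₂ (A⊆B , ⊈⇒∃ B⊈A)

  chain-comparable : ∀ {𝒜 : List (Subset n)} → IsChain 𝒜 →
                     ∀ {A B} → A List.∈ 𝒜 → B List.∈ 𝒜 → Comparable A B
  chain-comparable (_ ∷ _)  (here refl) (here refl) = inj₁ id
  chain-comparable (h ∷ _)  (here refl) (there q)   = inj₁ (proj₁ (All.lookup h q))
  chain-comparable (h ∷ _)  (there p)   (here refl) = inj₂ (proj₁ (All.lookup h p))
  chain-comparable (_ ∷ 𝒜) (there p)   (there q)   = chain-comparable 𝒜 p q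

  insert : ∀ A (𝒜 : List (Subset n)) → IsChain 𝒜 → (∀ {B} → B List.∈ 𝒜 → Comparable A B) →
           ∃ λ ℬ → IsChain ℬ × (List._∈ ℬ) ≐ (List._∈ A ∷ 𝒜)
  insert A [] [] _ = A ∷ [] , [] ∷ [] , id , id
  insert A (B ∷ 𝒜) (h ∷ c) cmp = place (cmp (here refl))
    where
    before : A ≡ B ⊎ A ⊂ B → ∃ λ ℬ → IsChain ℬ × (List._∈ ℬ) ≐ (List._∈ A ∷ B ∷ 𝒜)
    -- Chains are strict, so a repeated set is dropped.
    before (inj₁ refl) = B ∷ 𝒜 , h ∷ c , there , λ where
      (here refl) → here refl
      (there p)   → p
    before (inj₂ A⊂B) = A ∷ B ∷ 𝒜 , (A⊂B ∷ All.map (Subset.⊂-trans A⊂B) h) ∷ h ∷ c , id , id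

    after : A ≡ B ⊎ B ⊂ A → ∃ λ ℬ → IsChain ℬ × (List._∈ ℬ) ≐ (List._∈ A ∷ B ∷ 𝒜)
    after (inj₁ refl) = before (inj₁ refl)
    after (inj₂ B⊂A) =
      let ℬ , c′ , f , g = insert A 𝒜 c (cmp ∘ there)
      in B ∷ ℬ , All.tabulate (λ p → above (f p)) ∷ c′ ,
         (λ { (here refl) → there (here refl)
            ; (there p)   → move (f p) }) ,
         (λ { (here refl)         → there (g (here refl))
            ; (there (here refl)) → here refl
            ; (there (there p))   → there (g (there p)) })
      where
      above : ∀ {C} → C List.∈ A ∷ 𝒜 → B ⊂ C
      above (here refl) = B⊂A
      above (there p)   = All.lookup h p

      move : ∀ {C} → C List.∈ A ∷ 𝒜 → C List.∈ A ∷ B ∷ 𝒜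
      move (here refl) = here refl
      move (there p)   = there (there p)

    place : Comparable A B → ∃ λ ℬ → IsChain ℬ × (List._∈ ℬ) ≐ (List._∈ A ∷ B ∷ 𝒜)
    place (inj₁ A⊆B) = before (⊆⇒≡⊎⊂ A⊆B)
    place (inj₂ B⊆A) = after (Sum.map₁ sym (⊆⇒≡⊎⊂ B⊆A))

  -- Lists of vertices come in any order and with repetitions, whereas `IsChain` asks for strictly
  -- increasing ones.
  sort-chain : ∀ (𝒜 : List (Subset n)) → (∀ {A B} → A List.∈ 𝒜 → B List.∈ 𝒜 → Comparable A B) →
               ∃ λ ℬ → IsChain ℬ × (List._∈ ℬ) ≐ (List._∈ 𝒜)
  sort-chain [] _ = [] , [] , id , id
  sort-chain (A ∷ 𝒜) cmp =
    let ℬ , c , f , g    = sort-chain 𝒜 (λ p q → cmp (there p) (there q))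
        𝒞 , c′ , f′ , g′ = insert A ℬ c (λ p → cmp (here refl) (there (f p)))
    in 𝒞 , c′ ,
       (λ p → weaken f (f′ p)) , (λ p → g′ (weaken g p))
    where
    weaken : ∀ {ℬ 𝒞 : List (Subset n)} → (∀ {X} → X List.∈ ℬ → X List.∈ 𝒞) →
             ∀ {X} → X List.∈ A ∷ ℬ → X List.∈ A ∷ 𝒞
    weaken _ (here refl) = here refl
    weaken f (there p)   = there (f p)

-- Common neighbourhoods and the simplices of ssd(B(G))

i≢oppositei : (i : Fin 2) → i ≢ opposite i
i≢oppositei 0F ()
i≢oppositei 1F ()

i≢k⇒oppositei≡k : ∀ {i k : Fin 2} → i ≢ k → opposite i ≡ k
i≢k⇒oppositei≡k {0F} {0F} i≢k = contradiction refl i≢k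
i≢k⇒oppositei≡k {0F} {1F} _   = refl
i≢k⇒oppositei≡k {1F} {0F} _   = refl
i≢k⇒oppositei≡k {1F} {1F} i≢k = contradiction refl i≢k

swap-involutive : ∀ {U : Set} (w : U × Fin 2) → swap (swap w) ≡ w
swap-involutive (A , i) = cong (A ,_) (opposite-involutive i)

module Neighbourhoods {n : ℕ} (G : Graph n) where

  open Graph G

  ∈CN⁺ : ∀ {A v} → (∀ {a} → a ∈ A → Adj a v) → v ∈ CN G A
  ∈CN⁺ {A} p = ∈⟦⟧⁺ (λ v → all? λ a → (a Subset.∈? A) →-dec adj? a v) (λ a → p)

  ∈CN⁻ : ∀ {A v} → v ∈ CN G A → ∀ {a} → a ∈ A → Adj a v
  ∈CN⁻ {A} v∈ {a} = ∈⟦⟧⁻ (λ v → all? λ a → (a Subset.∈? A) →-dec adj? a v) v∈ a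

  CN-galois : ∀ {A B} → A ⊆ CN G B → B ⊆ CN G A
  CN-galois A⊆ b∈B = ∈CN⁺ λ a∈A → symm (∈CN⁻ (A⊆ a∈A) b∈B)

  CN-antitone : ∀ {A B} → A ⊆ B → CN G B ⊆ CN G A
  CN-antitone A⊆B v∈ = ∈CN⁺ λ a∈A → ∈CN⁻ v∈ (A⊆B a∈A)

  ⊆CN² : ∀ A → A ⊆ CN² G A
  ⊆CN² A = CN-galois id

  CN²-mono : ∀ {A B} → A ⊆ B → CN² G A ⊆ CN² G B
  CN²-mono A⊆B = CN-antitone (CN-antitone A⊆B)

  CN³≡CN : ∀ A → CN G (CN² G A) ≡ CN G A
  CN³≡CN A = Subset.⊆-antisym (CN-antitone (⊆CN² A)) (⊆CN² (CN G A))

  -- `CN B` is closed under `CN²`, and `CN² A` is the least closed set containing A.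
  CN²-least : ∀ {A B} → A ⊆ CN G B → CN² G A ⊆ CN G B
  CN²-least {A} {B} A⊆ v∈ = subst (_ ∈_) (CN³≡CN B) (CN²-mono A⊆ v∈)

  -- A node in both sets would be adjacent to itself. Hence the two sets of a pair are never tied.
  CN≢CN² : ∀ {A} → Nonempty (CN G A) → CN G A ≢ CN² G A
  CN≢CN² {A} (c , c∈) eq = irrefl refl (∈CN⁻ (subst (c ∈_) eq c∈) c∈)

  Vertex : Set
  Vertex = Subset n × Fin 2

  Valid : Pred Vertex 0ℓ
  Valid (A , _) = Nonempty A × N G A

  -- The edge relation of ssd(B(G)), stated for arbitrary shores because `J` may change them.
  Compat : Rel Vertex 0ℓ
  Compat (A , i) (B , k) = (i ≡ k → Comparable A B) × (i ≢ k → A ⊆ CN G B)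

  same : ∀ {i k A B} → i ≡ k → Comparable A B → Compat (A , i) (B , k)
  same i≡k c = (λ _ → c) , contradiction i≡k

  cross : ∀ {i k A B} → i ≢ k → A ⊆ CN G B → Compat (A , i) (B , k)
  cross i≢k s = (λ i≡k → contradiction i≡k i≢k) , λ _ → s

  Compat-sym : ∀ {w w′} → Compat w w′ → Compat w′ w
  Compat-sym (p , q) = Sum.swap ∘ p ∘ sym , λ k≢i → CN-galois (q (k≢i ∘ sym))

  swap-valid : ∀ {w} → Valid w → Valid (swap w)
  swap-valid p = p

  swap-compat : ∀ {w w′} → Compat w w′ → Compat (swap w) (swap w′)
  swap-compat {_ , i} {_ , k} (p , q) =
    (λ e → p (trans (sym (opposite-involutive i)) (trans (cong opposite e) (opposite-involutive k)))) ,
    (λ ne → q (ne ∘ cong opposite))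

  -- The complex ssd(B(G)) is a flag complex.

  Flag : Complex Vertex
  Flag σ = (∀ {w} → w List.∈ σ → Valid w) × (∀ {w w′} → w List.∈ σ → w′ List.∈ σ → Compat w w′)

  shore : Fin 2 → List Vertex → List (Subset n)
  shore i σ = map proj₁ (filter (λ w → proj₂ w ≟ i) σ)

  ∈shore⁺ : ∀ {i σ A} → (A , i) List.∈ σ → A List.∈ shore i σ
  ∈shore⁺ {i} p = List.∈-map⁺ proj₁ (List.∈-filter⁺ (λ w → proj₂ w ≟ i) p refl)

  ∈shore⁻ : ∀ {i σ A} → A List.∈ shore i σ → (A , i) List.∈ σ
  ∈shore⁻ {i} {σ} p with List.∈-map⁻ proj₁ p
  ... | (A , k) , q , refl with List.∈-filter⁻ (λ w → proj₂ w ≟ i) {xs = σ} q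
  ...   | r , refl = r

  shore-comparable : ∀ {i σ} → Flag σ → ∀ {A B} → A List.∈ shore i σ → B List.∈ shore i σ → Comparable A B
  shore-comparable (_ , compat) p q = proj₁ (compat (∈shore⁻ p) (∈shore⁻ q)) refl

  Flag⇒ssdB : ∀ {σ} → Flag σ → ssdB G σ
  Flag⇒ssdB {σ} flag@(valid , compat) =
    let 𝒜 , c₀ , f₀ , g₀ = sort-chain (shore 0F σ) (shore-comparable flag)
        ℬ , c₁ , f₁ , g₁ = sort-chain (shore 1F σ) (shore-comparable flag)
    in 𝒜 , ℬ ,
       c₀ , All.tabulate (λ p → proj₁ (valid (∈shore⁻ (f₀ p)))) , All.tabulate (λ p → proj₂ (valid (∈shore⁻ (f₀ p)))) ,
       c₁ , All.tabulate (λ p → proj₁ (valid (∈shore⁻ (f₁ p)))) , All.tabulate (λ p → proj₂ (valid (∈shore⁻ (f₁ p)))) ,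
       (λ p q → proj₂ (compat (∈shore⁻ (f₀ p)) (∈shore⁻ (f₁ q))) (λ ())) ,
       (λ { {_ , 0F} p → g₀ (∈shore⁺ p) ; {_ , 1F} p → g₁ (∈shore⁺ p) }) ,
       (λ { {_ , 0F} p → ∈shore⁻ (f₀ p) ; {_ , 1F} p → ∈shore⁻ (f₁ p) })

  ssdB⇒Flag : ∀ {σ} → ssdB G σ → Flag σ
  ssdB⇒Flag {σ} (𝒜 , ℬ , c₀ , ne₀ , nb₀ , c₁ , ne₁ , nb₁ , adj , f , g) = valid , compat
    where
    valid : ∀ {w} → w List.∈ σ → Valid w
    valid {_ , 0F} p = All.lookup ne₀ (f p) , All.lookup nb₀ (f p)
    valid {_ , 1F} p = All.lookup ne₁ (f p) , All.lookup nb₁ (f p)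

    compat : ∀ {w w′} → w List.∈ σ → w′ List.∈ σ → Compat w w′
    compat {_ , 0F} {_ , 0F} p q = same refl (chain-comparable c₀ (f p) (f q))
    compat {_ , 0F} {_ , 1F} p q = cross (λ ()) (adj (f p) (f q))
    compat {_ , 1F} {_ , 0F} p q = cross (λ ()) (CN-galois (adj (f q) (f p)))
    compat {_ , 1F} {_ , 1F} p q = same refl (chain-comparable c₁ (f p) (f q))

  B-adjacent : ∀ {σ} → B G σ → ∀ {u v i k} → (u , i) List.∈ σ → (v , k) List.∈ σ → i ≢ k → Adj u v
  B-adjacent _ {i = 0F} {0F} p q i≢k = contradiction refl i≢k
  B-adjacent _ {i = 1F} {1F} p q i≢k = contradiction refl i≢k
  B-adjacent (_ , _ , _ , _ , _ , Q⊆ , f , _) {i = 0F} {1F} p q _ = ∈CN⁻ (Q⊆ (f q)) (f p)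
  B-adjacent (_ , _ , _ , _ , P⊆ , _ , f , _) {i = 1F} {0F} p q _ = ∈CN⁻ (P⊆ (f q)) (f p)

  B-neighbour : ∀ {σ} → B G σ → ∀ i → ∃ λ c → ∀ {u} → (u , i) List.∈ σ → Adj u c
  B-neighbour (_ , _ , (c , c∈) , _ , _ , _ , f , _) 0F = c , λ p → ∈CN⁻ c∈ (f p)
  B-neighbour (_ , _ , _ , (c , c∈) , _ , _ , f , _) 1F = c , λ p → ∈CN⁻ c∈ (f p)

  open DecMembership {A = Fin n × Fin 2} (Product.≡-dec _≟_ _≟_) using (_∈?_)

  section : Fin 2 → List (Fin n × Fin 2) → Subset n
  section i σ = ⟦ (λ v → (v , i) ∈? σ) ⟧

  ∈section⁺ : ∀ {i σ v} → (v , i) List.∈ σ → v ∈ section i σ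
  ∈section⁺ {i} {σ} = ∈⟦⟧⁺ (λ v → (v , i) ∈? σ)

  ∈section⁻ : ∀ {i σ v} → v ∈ section i σ → (v , i) List.∈ σ
  ∈section⁻ {i} {σ} = ∈⟦⟧⁻ (λ v → (v , i) ∈? σ)

  -- Adjacency across the shores is inherited from the covering sets. On one shore these form a
  -- chain, and a common neighbour of its largest set serves for all covered nodes.
  covered⇒B : ∀ {τ σ} → Flag τ → Fin n →
              (∀ {v i} → (v , i) List.∈ σ → ∃ λ A → (A , i) List.∈ τ × v ∈ A) → B G σ
  covered⇒B {τ} {σ} flag@(valid , compat) v₀ cover =
    section 0F σ , section 1F σ , nbr 0F , nbr 1F , adj (λ ()) , adj (λ ()) ,
    (λ { {_ , 0F} p → ∈section⁺ p ; {_ , 1F} p → ∈section⁺ p }) ,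
    (λ { {_ , 0F} p → ∈section⁻ p ; {_ , 1F} p → ∈section⁻ p })
    where
    adj : ∀ {i k} → i ≢ k → section i σ ⊆ CN G (section k σ)
    adj i≢k u∈ = ∈CN⁺ λ v∈ →
      let A , A∈ , u∈A = cover (∈section⁻ u∈)
          B , B∈ , v∈B = cover (∈section⁻ v∈)
      in ∈CN⁻ (proj₂ (compat A∈ B∈) i≢k u∈A) v∈B

    nbr-of : ∀ i 𝒜 → (∀ {A} → A List.∈ shore i τ → A List.∈ 𝒜) →
             (∀ {A} → A List.∈ 𝒜 → A List.∈ shore i τ) → N G (section i σ)
    -- With no covering set the section is empty and every node is a common neighbour; v₀ supplies
    -- one.
    nbr-of i [] f _ = v₀ , ∈CN⁺ λ u∈ → let A , A∈ , _ = cover (∈section⁻ u∈) in none (f (∈shore⁺ A∈))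
      where
      none : ∀ {A} {X : Set} → A List.∈ [] → X
      none ()
    nbr-of i (A ∷ 𝒜) f g =
      let M , M∈ , top = extremum {R = λ P Q → Q ⊆ P} id (λ p q → p ∘ q) A 𝒜
                           (λ p q → Sum.swap (shore-comparable flag (g p) (g q)))
          c , c∈       = proj₂ (valid (∈shore⁻ (g M∈)))
      in c , ∈CN⁺ λ u∈ → let B , B∈ , u∈B = cover (∈section⁻ u∈) in ∈CN⁻ c∈ (top (f (∈shore⁺ B∈)) u∈B)

    nbr : ∀ i → N G (section i σ)
    nbr i = nbr-of i (shore i τ) id id

-- The map `J` and its image HDL(G)

module Halving {n : ℕ} (G : Graph n) {_<ᵥ_ : Rel (Fin n) 0ℓ} (<ᵥ-isSTO : IsStrictTotalOrder _≡_ _<ᵥ_) where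

  open Neighbourhoods G
  open IsStrictTotalOrder <ᵥ-isSTO using (compare; <-resp-≈; asym)

  infix 4 _⊰_

  _⊰_ : Rel (Subset n) 0ℓ
  P ⊰ Q = _≺_ G <ᵥ-isSTO P Q

  ⊰-asym : ∀ {P Q} → P ⊰ Q → ¬ (Q ⊰ P)
  ⊰-asym (inj₁ p)       (inj₁ q)       = ℕ.<-asym p q
  ⊰-asym (inj₁ p)       (inj₂ (e , _)) = ℕ.<-irrefl (sym e) p
  ⊰-asym (inj₂ (e , _)) (inj₁ q)       = ℕ.<-irrefl (sym e) q
  ⊰-asym (inj₂ (_ , p)) (inj₂ (_ , q)) = <-asymmetric sym <-resp-≈ asym p q

  -- Sorting only permutes, so a set is recovered from its sorted list and distinct sets cannot tie
  -- lexicographically.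
  elements-⊆ : ∀ {P Q} → elements G <ᵥ-isSTO P ≡ elements G <ᵥ-isSTO Q → P ⊆ Q
  elements-⊆ {P} {Q} eq {v} v∈P = proj₂ (List.∈-filter⁻ (Subset._∈? Q) {xs = allFin n}
    (∈-resp-↭ (sort-↭ (filter (Subset._∈? Q) (allFin n))) (subst (v List.∈_) eq
      (∈-resp-↭ (↭-sym (sort-↭ (filter (Subset._∈? P) (allFin n))))
        (List.∈-filter⁺ (Subset._∈? P) (List.∈-allFin v) v∈P)))))
    where open Sort (STO.decTotalOrder (order G <ᵥ-isSTO)) using (sort-↭)

  ⊰-total : ∀ {P Q} → P ≢ Q → P ⊰ Q ⊎ Q ⊰ P
  ⊰-total {P} {Q} P≢Q with ℕ.<-cmp Subset.∣ P ∣ Subset.∣ Q ∣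
  ... | tri< lt _ _ = inj₁ (inj₁ lt)
  ... | tri> _ _ gt = inj₂ (inj₁ gt)
  ... | tri≈ _ eq _ with <-compare sym compare (elements G <ᵥ-isSTO P) (elements G <ᵥ-isSTO Q)
  ...   | tri< lt _ _ = inj₁ (inj₂ (eq , lt))
  ...   | tri> _ _ gt = inj₂ (inj₂ (sym eq , gt))
  ...   | tri≈ _ e _  = contradiction
          (Subset.⊆-antisym (elements-⊆ (Pointwise-≡⇒≡ e)) (elements-⊆ (sym (Pointwise-≡⇒≡ e)))) P≢Q

  ⊰⇒∣∣≤∣∣ : ∀ {P Q} → P ⊰ Q → Subset.∣ P ∣ ℕ.≤ Subset.∣ Q ∣
  ⊰⇒∣∣≤∣∣ (inj₁ lt)       = ℕ.<⇒≤ lt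
  ⊰⇒∣∣≤∣∣ (inj₂ (eq , _)) = ℕ.≤-reflexive eq

  -- A proper inclusion at either end makes the cardinalities differ strictly, which decides the
  -- order before any lexicographic comparison.
  ⊆-⊰-⊆ : ∀ {P′ P Q Q′} → P′ ⊆ P → P ⊰ Q → Q ⊆ Q′ → P′ ⊰ Q′
  ⊆-⊰-⊆ P′⊆P P⊰Q Q⊆Q′ with ⊆⇒≡⊎⊂ P′⊆P | ⊆⇒≡⊎⊂ Q⊆Q′
  ... | inj₁ refl | inj₁ refl = P⊰Q
  ... | inj₂ P′⊂P | _         = inj₁ (ℕ.<-≤-trans (Subset.p⊂q⇒∣p∣<∣q∣ P′⊂P)
                                  (ℕ.≤-trans (⊰⇒∣∣≤∣∣ P⊰Q) (Subset.p⊆q⇒∣p∣≤∣q∣ Q⊆Q′)))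
  ... | inj₁ refl | inj₂ Q⊂Q′ = inj₁ (ℕ.≤-<-trans (⊰⇒∣∣≤∣∣ P⊰Q) (Subset.p⊂q⇒∣p∣<∣q∣ Q⊂Q′))

  -- For A in N(G), the condition under which `j` sends the closure `CN² A` to the opposite shore.
  Large : Pred (Subset n) 0ℓ
  Large A = CN G A ⊰ CN² G A

  large? : Decidable Large
  large? A = _≺?_ G <ᵥ-isSTO (CN G A) (CN² G A)

  Large-⊆ : ∀ {A B} → A ⊆ B → Large A → Large B
  Large-⊆ A⊆B large = ⊆-⊰-⊆ (CN-antitone A⊆B) large (CN²-mono A⊆B)

  -- Adjacency gives `CN² B ⊆ CN A` and `CN² A ⊆ CN B`, so `CN A ⊰ CN² A` implies `CN² B ⊰ CN B`,
  -- the reverse of `Large B`.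
  ¬Large-both : ∀ {A B} → A ⊆ CN G B → Large A → ¬ Large B
  ¬Large-both A⊆CNB largeA largeB =
    ⊰-asym (⊆-⊰-⊆ (CN²-least (CN-galois A⊆CNB)) largeA (CN²-least A⊆CNB)) largeB

  -- The flow is defined on all rational vectors, so all subsets need an image with a barycentre. A
  -- nonempty A with empty `CN A` would count as large and be sent to the empty set; it is left in
  -- place instead.
  J : Vertex → Vertex
  J (A , i) = if does (Subset.nonempty? (CN G A))
              then (if does (large? A) then (CN G A , opposite i) else (CN² G A , i))
              else (A , i)

  J-large : ∀ {A i} → N G A → Large A → J (A , i) ≡ (CN G A , opposite i)
  J-large {A} nbr large rewrite dec-true (Subset.nonempty? (CN G A)) nbr | dec-true (large? A) large = refl

  J-small : ∀ {A i} → N G A → ¬ Large A → J (A , i) ≡ (CN² G A , i)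
  J-small {A} nbr small rewrite dec-true (Subset.nonempty? (CN G A)) nbr | dec-false (large? A) small = refl

  J-outside : ∀ {A i} → ¬ N G A → J (A , i) ≡ (A , i)
  J-outside {A} ¬nbr rewrite dec-false (Subset.nonempty? (CN G A)) ¬nbr = refl

  J-swap : ∀ w → J (swap w) ≡ swap (J w)
  J-swap (A , i) = cases (Subset.nonempty? (CN G A)) (large? A)
    where
    cases : Dec (N G A) → Dec (Large A) → J (A , opposite i) ≡ swap (J (A , i))
    cases (no ¬nbr) _         = trans (J-outside ¬nbr) (cong swap (sym (J-outside ¬nbr)))
    cases (yes nbr) (yes lg)  = trans (J-large nbr lg) (cong swap (sym (J-large nbr lg)))
    cases (yes nbr) (no small) = trans (J-small nbr small) (cong swap (sym (J-small nbr small)))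

  CN²-nonempty : ∀ {A} → Nonempty A → Nonempty (CN² G A)
  CN²-nonempty {A} (a , a∈A) = a , ⊆CN² A a∈A

  J-cases : ∀ {A i} (P : Vertex → Set) → N G A →
            (¬ Large A → P (CN² G A , i)) → (Large A → P (CN G A , opposite i)) → P (J (A , i))
  J-cases {A} {i} P nbr small large = cases (large? A)
    where
    cases : Dec (Large A) → P (J (A , i))
    cases (yes lg) = subst P (sym (J-large nbr lg)) (large lg)
    cases (no sm)  = subst P (sym (J-small nbr sm)) (small sm)

  J-valid : ∀ {w} → Valid w → Valid (J w)
  J-valid {A , i} (ne , nbr) = J-cases Valid nbr
    (λ _ → CN²-nonempty ne , subst Nonempty (sym (CN³≡CN A)) nbr)
    (λ _ → nbr , CN²-nonempty ne)

  i≢k⇒i≡opp : ∀ {i k : Fin 2} → i ≢ k → i ≡ opposite k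
  i≢k⇒i≡opp i≢k = sym (i≢k⇒oppositei≡k (i≢k ∘ sym))

  i≡k⇒i≢opp : ∀ {i k : Fin 2} → i ≡ k → i ≢ opposite k
  i≡k⇒i≢opp refl = i≢oppositei _

  J-compat-⊆ : ∀ {A B i} → N G A → N G B → A ⊆ B → Compat (J (A , i)) (J (B , i))
  J-compat-⊆ {A} {B} {i} nA nB A⊆B = J-cases (λ w → Compat w (J (B , i))) nA
    (λ smallA → J-cases (Compat (CN² G A , i)) nB
      (λ _ → same refl (inj₁ (CN²-mono A⊆B)))
      (λ _ → cross (i≢oppositei i) (CN²-mono A⊆B)))
    (λ largeA → J-cases (Compat (CN G A , opposite i)) nB
      -- The smaller set cannot change shores without the larger one.
      (λ smallB → contradiction (Large-⊆ A⊆B largeA) smallB)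
      (λ _ → same refl (inj₂ (CN-antitone A⊆B))))

  J-compat-CN : ∀ {A B i k} → i ≢ k → N G A → N G B → A ⊆ CN G B → Compat (J (A , i)) (J (B , k))
  J-compat-CN {A} {B} {i} {k} i≢k nA nB A⊆CNB = J-cases (λ w → Compat w (J (B , k))) nA
    (λ smallA → J-cases (Compat (CN² G A , i)) nB
      (λ _ → cross i≢k (subst (CN² G A ⊆_) (sym (CN³≡CN B)) (CN²-least A⊆CNB)))
      (λ _ → same (i≢k⇒i≡opp i≢k) (inj₁ (CN²-least A⊆CNB))))
    (λ largeA → J-cases (Compat (CN G A , opposite i)) nB
      (λ _ → same (i≢k⇒oppositei≡k i≢k) (inj₂ (CN²-least (CN-galois A⊆CNB))))
      (λ largeB → contradiction largeB (¬Large-both A⊆CNB largeA)))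

  J-compat : ∀ {w w′} → Valid w → Valid w′ → Compat w w′ → Compat (J w) (J w′)
  J-compat {A , i} {B , k} (_ , nA) (_ , nB) (s , c) = cases (i ≟ k)
    where
    cases : Dec (i ≡ k) → Compat (J (A , i)) (J (B , k))
    cases (yes refl) = either (s refl)
      where
      either : Comparable A B → Compat (J (A , i)) (J (B , i))
      either (inj₁ A⊆B) = J-compat-⊆ nA nB A⊆B
      either (inj₂ B⊆A) = Compat-sym (J-compat-⊆ nB nA B⊆A)
    cases (no i≢k)   = J-compat-CN i≢k nA nB (c i≢k)

  -- Intended for R the set of unmoved nodes. Unlike in `Compat`, the inclusion on a common shore
  -- has a fixed direction; if A were the smaller set, `CN² A` might not be comparable with R.
  Below : Rel Vertex 0ℓ
  Below (R , i) (A , k) = (i ≡ k → R ⊆ A) × (i ≢ k → R ⊆ CN G A)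

  Below⇒Compat : ∀ {u w} → Below u w → Compat u w
  Below⇒Compat (p , q) = (λ e → inj₁ (p e)) , q

  -- If the set stays on its shore, A only grows to `CN² A` and `CN A` is unchanged; if it moves,
  -- the bounds `R ⊆ A` and `R ⊆ CN A` trade roles.
  Below-J : ∀ {u w} → Valid w → Below u w → Below u (J w)
  Below-J {R , i} {A , k} (_ , nbr) (p , q) = J-cases (Below (R , i)) nbr
    (λ _ → (λ e → ⊆CN² A ∘ p e) , (λ ne → subst (R ⊆_) (sym (CN³≡CN A)) (q ne)))
    (λ _ → (λ e → q (λ i≡k → i≡k⇒i≢opp i≡k e)) , λ ne → ⊆CN² A ∘ p (unopp ne))
    where
    unopp : i ≢ opposite k → i ≡ k
    unopp ne = trans (i≢k⇒i≡opp ne) (opposite-involutive k)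

  private
    j-0-yes : ∀ {P} → P ⊰ CN G P → j G <ᵥ-isSTO (P , 0F) ≡ (P , 0F)
    j-0-yes {P} p = cong (λ b → if b then (P , 0F) else (CN G P , 1F)) (dec-true (_≺?_ G <ᵥ-isSTO P (CN G P)) p)

    j-0-no : ∀ {P} → ¬ (P ⊰ CN G P) → j G <ᵥ-isSTO (P , 0F) ≡ (CN G P , 1F)
    j-0-no {P} p = cong (λ b → if b then (P , 0F) else (CN G P , 1F)) (dec-false (_≺?_ G <ᵥ-isSTO P (CN G P)) p)

    j-1-yes : ∀ {Q} → CN G Q ⊰ Q → j G <ᵥ-isSTO (Q , 1F) ≡ (CN G Q , 0F)
    j-1-yes {Q} p = cong (λ b → if b then (CN G Q , 0F) else (Q , 1F)) (dec-true (_≺?_ G <ᵥ-isSTO (CN G Q) Q) p)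

    j-1-no : ∀ {Q} → ¬ (CN G Q ⊰ Q) → j G <ᵥ-isSTO (Q , 1F) ≡ (Q , 1F)
    j-1-no {Q} p = cong (λ b → if b then (CN G Q , 0F) else (Q , 1F)) (dec-false (_≺?_ G <ᵥ-isSTO (CN G Q) Q) p)

  close : Vertex → Vertex
  close (A , i) = CN² G A , i

  j∘close≡J : ∀ {w} → Valid w → j G <ᵥ-isSTO (close w) ≡ J w
  j∘close≡J {A , 0F} (_ , nbr) = J-cases (λ w → j G <ᵥ-isSTO (CN² G A , 0F) ≡ w) nbr
    -- On the first shore `j` tests `CN² A ⊰ CN A`, which follows from the negation of `Large` only
    -- because ties are excluded. On the second shore it tests `Large` itself.
    (λ small → j-0-yes (subst (CN² G A ⊰_) (sym (CN³≡CN A))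
      (Sum.[ (λ lg → contradiction lg small) , id ]′ (⊰-total (CN≢CN² nbr)))))
    (λ large → trans (j-0-no (λ p → ⊰-asym large (subst (CN² G A ⊰_) (CN³≡CN A) p)))
                     (cong (_, 1F) (CN³≡CN A)))
  j∘close≡J {A , 1F} (_ , nbr) = J-cases (λ w → j G <ᵥ-isSTO (CN² G A , 1F) ≡ w) nbr
    (λ small → j-1-no (λ p → small (subst (_⊰ CN² G A) (CN³≡CN A) p)))
    (λ large → trans (j-1-yes (subst (_⊰ CN² G A) (sym (CN³≡CN A)) large)) (cong (_, 0F) (CN³≡CN A)))

  -- The set reached is closed and not large: if A was large, the comparison at `CN A` is the
  -- reversed one.
  J-idempotent : ∀ {w} → Valid w → J (J w) ≡ J w
  J-idempotent {A , i} (ne , nbr) = J-cases (λ w → J w ≡ w) nbr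
    (λ small → trans (J-small (subst Nonempty (sym (CN³≡CN A)) nbr)
                        (λ lg → small (subst₂ _⊰_ (CN³≡CN A) (cong (CN G) (CN³≡CN A)) lg)))
                     (cong (_, i) (cong (CN G) (CN³≡CN A))))
    (λ large → trans (J-small (CN²-nonempty ne)
                        (λ lg → ⊰-asym large (subst (CN² G A ⊰_) (CN³≡CN A) lg)))
                     (cong (_, opposite i) (CN³≡CN A)))

  map-j∘close : ∀ {ws} → (∀ {w} → w List.∈ ws → Valid w) →
                map (j G <ᵥ-isSTO) (map close ws) ≡ map J ws
  map-j∘close {[]}     _     = refl
  map-j∘close {w ∷ ws} valid = cong₂ _∷_ (j∘close≡J (valid (here refl))) (map-j∘close (valid ∘ there))

  -- Merges the two nested images, under the closure and under `j`, into one application of `J` to a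
  -- flag.
  HDL⁻ : ∀ {σ} → HDL G <ᵥ-isSTO σ →
         ∃ λ ws → Flag ws × (∀ {u} → u List.∈ σ → ∃ λ w → w List.∈ ws × u ≡ J w)
  HDL⁻ {σ} (τ , (ws , ws∈ssdB , f , _) , g , _) = ws , flag , origin
    where
    flag : Flag ws
    flag = ssdB⇒Flag ws∈ssdB

    origin : ∀ {u} → u List.∈ σ → ∃ λ w → w List.∈ ws × u ≡ J w
    origin u∈ with List.∈-map⁻ (j G <ᵥ-isSTO) (g u∈)
    ... | s , s∈ , refl with List.∈-map⁻ close (f s∈)
    ...   | w , w∈ , refl = w , w∈ , j∘close≡J (proj₁ flag w∈)

  HDL⁺ : ∀ σ ws → Flag ws → (∀ {u} → u List.∈ σ → ∃ λ w → w List.∈ ws × u ≡ J w) → HDL G <ᵥ-isSTO σ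
  HDL⁺ σ ws (valid , compat) origin =
    -- σ may miss images of some members of `ws`, whereas `image` asks for exactly the members of σ;
    -- so one preimage is chosen for each entry, and these still form a flag.
    let vs , vs⊆ws , eq = collect σ origin
        σ≡ = trans eq (sym (map-j∘close (valid ∘ vs⊆ws)))
    in map close vs ,
       (vs , Flag⇒ssdB (valid ∘ vs⊆ws , λ p q → compat (vs⊆ws p) (vs⊆ws q)) , id , id) ,
       (λ {u} → subst (u List.∈_) σ≡) , (λ {u} → subst (u List.∈_) (sym σ≡))
    where
    collect : ∀ σ → (∀ {u} → u List.∈ σ → ∃ λ w → w List.∈ ws × u ≡ J w) →
              ∃ λ vs → (∀ {v} → v List.∈ vs → v List.∈ ws) × σ ≡ map J vs
    collect []      _      = [] , (λ ()) , refl
    collect (u ∷ σ) origin =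
      let w , w∈ , u≡     = origin (here refl)
          vs , vs⊆ws , eq = collect σ (origin ∘ there)
      in w ∷ vs , (λ { (here refl) → w∈ ; (there v∈) → vs⊆ws v∈ }) , cong₂ _∷_ u≡ eq

  HDL⇒Flag : ∀ {σ} → HDL G <ᵥ-isSTO σ → Flag σ
  HDL⇒Flag {σ} σ∈HDL with HDL⁻ σ∈HDL
  ... | ws , (valid , compat) , origin = valid′ , compat′
    where
    valid′ : ∀ {u} → u List.∈ σ → Valid u
    valid′ u∈ with origin u∈
    ... | w , w∈ , refl = J-valid (valid w∈)

    compat′ : ∀ {u u′} → u List.∈ σ → u′ List.∈ σ → Compat u u′
    compat′ u∈ u′∈ with origin u∈ | origin u′∈
    ... | w , w∈ , refl | w′ , w′∈ , refl = J-compat (valid w∈) (valid w′∈) (compat w∈ w′∈)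

  HDL-swap : ∀ {σ} → HDL G <ᵥ-isSTO (map swap σ) → HDL G <ᵥ-isSTO σ
  HDL-swap {σ} σ∈HDL with HDL⁻ σ∈HDL
  ... | ws , (valid , compat) , origin = HDL⁺ σ (map swap ws) (valid′ , compat′) origin′
    where
    valid′ : ∀ {u} → u List.∈ map swap ws → Valid u
    valid′ u∈ with List.∈-map⁻ swap u∈
    ... | w , w∈ , refl = swap-valid {w} (valid w∈)

    compat′ : ∀ {u u′} → u List.∈ map swap ws → u′ List.∈ map swap ws → Compat u u′
    compat′ u∈ u′∈ with List.∈-map⁻ swap u∈ | List.∈-map⁻ swap u′∈
    ... | w , w∈ , refl | w′ , w′∈ , refl = swap-compat {w} {w′} (compat w∈ w′∈)

    origin′ : ∀ {u} → u List.∈ σ → ∃ λ w → w List.∈ map swap ws × u ≡ J w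
    origin′ {u} u∈ =
      let w , w∈ , eq = origin (List.∈-map⁺ swap u∈)
      in swap w , List.∈-map⁺ swap w∈ ,
         trans (sym (swap-involutive u)) (trans (cong swap eq) (sym (J-swap w)))

  HDL-fixed : ∀ {w} → HDL G <ᵥ-isSTO (w ∷ []) → J w ≡ w
  HDL-fixed w∈HDL with HDL⁻ w∈HDL
  ... | ws , (valid , _) , origin with origin (here refl)
  ...   | w , w∈ , refl = J-idempotent (valid w∈)

-- Kronecker deltas and coordinates of barycentres

δ₂ : Fin 2 → Fin 2 → ℚ
δ₂ 0F 0F = 1ℚ
δ₂ 0F 1F = 0ℚ
δ₂ 1F 0F = 0ℚ
δ₂ 1F 1F = 1ℚ

-- Recursion along the subset lets sums over `subsets` be evaluated by the recursion of that list.
δˢ : ∀ {n} → Subset n → Subset n → ℚ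
δˢ Vec.[]            Vec.[]            = 1ℚ
δˢ (inside  Vec.∷ A) (inside  Vec.∷ B) = δˢ A B
δˢ (inside  Vec.∷ A) (outside Vec.∷ B) = 0ℚ
δˢ (outside Vec.∷ A) (inside  Vec.∷ B) = 0ℚ
δˢ (outside Vec.∷ A) (outside Vec.∷ B) = δˢ A B

δ : ∀ {n} → Subset n × Fin 2 → Subset n × Fin 2 → ℚ
δ (A , i) (B , k) = δˢ A B ℚ.* δ₂ i k

0≤1ℚ : 0ℚ ℚ.≤ 1ℚ
0≤1ℚ = ℚ.<⇒≤ (ℚ.positive⁻¹ 1ℚ)

0≤δ₂ : ∀ i k → 0ℚ ℚ.≤ δ₂ i k
0≤δ₂ 0F 0F = 0≤1ℚ
0≤δ₂ 0F 1F = ℚ.≤-refl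
0≤δ₂ 1F 0F = ℚ.≤-refl
0≤δ₂ 1F 1F = 0≤1ℚ

0≤δˢ : ∀ {n} (A B : Subset n) → 0ℚ ℚ.≤ δˢ A B
0≤δˢ Vec.[]            Vec.[]            = 0≤1ℚ
0≤δˢ (inside  Vec.∷ A) (inside  Vec.∷ B) = 0≤δˢ A B
0≤δˢ (inside  Vec.∷ A) (outside Vec.∷ B) = ℚ.≤-refl
0≤δˢ (outside Vec.∷ A) (inside  Vec.∷ B) = ℚ.≤-refl
0≤δˢ (outside Vec.∷ A) (outside Vec.∷ B) = 0≤δˢ A B

0≤δ : ∀ {n} (w w′ : Subset n × Fin 2) → 0ℚ ℚ.≤ δ w w′
0≤δ (A , i) (B , k) = 0≤* (δˢ A B) (δ₂ i k) (0≤δˢ A B) (0≤δ₂ i k)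

0≮0 : {X : Set} → 0ℚ ℚ.< 0ℚ → X
0≮0 lt = ⊥-elim (ℚ.<-irrefl refl lt)

0<δ₂⇒≡ : ∀ i k → 0ℚ ℚ.< δ₂ i k → i ≡ k
0<δ₂⇒≡ 0F 0F _  = refl
0<δ₂⇒≡ 0F 1F lt = 0≮0 lt
0<δ₂⇒≡ 1F 0F lt = 0≮0 lt
0<δ₂⇒≡ 1F 1F _  = refl

0<δˢ⇒≡ : ∀ {n} (A B : Subset n) → 0ℚ ℚ.< δˢ A B → A ≡ B
0<δˢ⇒≡ Vec.[]            Vec.[]            _  = refl
0<δˢ⇒≡ (inside  Vec.∷ A) (inside  Vec.∷ B) lt = cong (inside Vec.∷_) (0<δˢ⇒≡ A B lt)
0<δˢ⇒≡ (inside  Vec.∷ A) (outside Vec.∷ B) lt = 0≮0 lt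
0<δˢ⇒≡ (outside Vec.∷ A) (inside  Vec.∷ B) lt = 0≮0 lt
0<δˢ⇒≡ (outside Vec.∷ A) (outside Vec.∷ B) lt = cong (outside Vec.∷_) (0<δˢ⇒≡ A B lt)

0<p*q⇒0<p : ∀ p q → 0ℚ ℚ.≤ p → 0ℚ ℚ.< p ℚ.* q → 0ℚ ℚ.< p
0<p*q⇒0<p p q 0≤p lt = ℚ.≰⇒> λ p≤0 → 0≮0
  (subst (0ℚ ℚ.<_) (trans (cong (ℚ._* q) (ℚ.≤-antisym p≤0 0≤p)) (ℚ.*-zeroˡ q)) lt)

0<p*q⇒0<q : ∀ p q → 0ℚ ℚ.≤ q → 0ℚ ℚ.< p ℚ.* q → 0ℚ ℚ.< q
0<p*q⇒0<q p q 0≤q lt = 0<p*q⇒0<p q p 0≤q (subst (0ℚ ℚ.<_) (ℚ.*-comm p q) lt)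

0<δ⇒≡ : ∀ {n} (w w′ : Subset n × Fin 2) → 0ℚ ℚ.< δ w w′ → w ≡ w′
0<δ⇒≡ (A , i) (B , k) lt = cong₂ _,_
  (0<δˢ⇒≡ A B (0<p*q⇒0<p (δˢ A B) (δ₂ i k) (0≤δˢ A B) lt))
  (0<δ₂⇒≡ i k (0<p*q⇒0<q (δˢ A B) (δ₂ i k) (0≤δ₂ i k) lt))

∑-δ₂ : ∀ k (q : Fin 2 → ℚ) → ∑ℚ (allFin 2) (λ i → δ₂ i k ℚ.* q i) ≡ q k
∑-δ₂ 0F q = trans (cong₂ ℚ._+_ (ℚ.*-identityˡ (q 0F)) (trans (ℚ.+-identityʳ _) (ℚ.*-zeroˡ (q 1F))))
                  (ℚ.+-identityʳ (q 0F))
∑-δ₂ 1F q = trans (cong₂ ℚ._+_ (ℚ.*-zeroˡ (q 0F)) (trans (ℚ.+-identityʳ _) (ℚ.*-identityˡ (q 1F))))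
                  (ℚ.+-identityˡ (q 1F))

∑ℚ-zero : ∀ {I : Set} is {f : I → ℚ} → (∀ i → f i ≡ 0ℚ) → ∑ℚ is f ≡ 0ℚ
∑ℚ-zero is f≡0 = trans (∑ℚ-cong is f≡0) (∑ℚ-0 is)

∑-δˢ : ∀ {n} (B : Subset n) (q : Subset n → ℚ) → ∑ℚ (subsets n) (λ A → δˢ A B ℚ.* q A) ≡ q B
∑-δˢ Vec.[] q = trans (ℚ.+-identityʳ (1ℚ ℚ.* q Vec.[])) (ℚ.*-identityˡ (q Vec.[]))
∑-δˢ {ℕ.suc n} (b Vec.∷ B) q = trans
  (trans (∑ℚ-++ (map (outside Vec.∷_) (subsets n)) (map (inside Vec.∷_) (subsets n)) term)
         (cong₂ ℚ._+_ (∑ℚ-map (outside Vec.∷_) (subsets n) term) (∑ℚ-map (inside Vec.∷_) (subsets n) term)))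
  (halves b)
  where
  term : Subset (ℕ.suc n) → ℚ
  term A = δˢ A (b Vec.∷ B) ℚ.* q A

  halves : ∀ b → ∑ℚ (subsets n) (λ A → δˢ (outside Vec.∷ A) (b Vec.∷ B) ℚ.* q (outside Vec.∷ A)) ℚ.+
                 ∑ℚ (subsets n) (λ A → δˢ (inside Vec.∷ A) (b Vec.∷ B) ℚ.* q (inside Vec.∷ A))
                 ≡ q (b Vec.∷ B)
  halves outside = trans (cong₂ ℚ._+_ (∑-δˢ B (q ∘ (outside Vec.∷_)))
                                      (∑ℚ-zero (subsets n) (λ A → ℚ.*-zeroˡ (q (inside Vec.∷ A)))))
                         (ℚ.+-identityʳ (q (outside Vec.∷ B)))
  halves inside  = trans (cong₂ ℚ._+_ (∑ℚ-zero (subsets n) (λ A → ℚ.*-zeroˡ (q (outside Vec.∷ A))))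
                                      (∑-δˢ B (q ∘ (inside Vec.∷_))))
                         (ℚ.+-identityˡ (q (inside Vec.∷ B)))

module _ {n : ℕ} (G : Graph n) where

  ∑-δ : ∀ w (q : Subset n × Fin 2 → ℚ) → ∑ℚ (ssdVertices G) (λ w′ → δ w′ w ℚ.* q w′) ≡ q w
  ∑-δ (B , k) q = begin
    ∑ℚ (ssdVertices G) (λ w′ → δ w′ (B , k) ℚ.* q w′)
      ≡⟨ ∑ℚ-× (subsets n) (allFin 2) (λ w′ → δ w′ (B , k) ℚ.* q w′) ⟩
    ∑ℚ (subsets n) (λ A → ∑ℚ (allFin 2) (λ i → δˢ A B ℚ.* δ₂ i k ℚ.* q (A , i)))
      ≡⟨ ∑ℚ-cong (subsets n) (λ A → trans
           (∑ℚ-cong (allFin 2) (λ i → reorder (δˢ A B) (δ₂ i k) (q (A , i))))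
           (trans (∑-δ₂ k (λ i → q (A , i) ℚ.* δˢ A B)) (ℚ.*-comm (q (A , k)) (δˢ A B)))) ⟩
    ∑ℚ (subsets n) (λ A → δˢ A B ℚ.* q (A , k))
      ≡⟨ ∑-δˢ B (λ A → q (A , k)) ⟩
    q (B , k) ∎
    where
    open ≡-Reasoning

    reorder : ∀ a b c → a ℚ.* b ℚ.* c ≡ b ℚ.* (c ℚ.* a)
    reorder a b c = trans (cong (ℚ._* c) (ℚ.*-comm a b))
      (trans (ℚ.*-assoc b a c) (cong (b ℚ.*_) (ℚ.*-comm a c)))

  -- The point of ∥ B(G) ∥ at which a vertex of ssd(B(G)) is placed, with zeros on the other shore.
  bary : Subset n × Fin 2 → Fin n × Fin 2 → ℚ
  bary (A , i) (v , k) = δ₂ i k ℚ.* barycentre A v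

  0≤bary : ∀ w u → 0ℚ ℚ.≤ bary w u
  0≤bary (A , i) (v , k) = 0≤* (δ₂ i k) (barycentre A v) (0≤δ₂ i k) (0≤barycentre A v)

  0<bary⇒∈ : ∀ A i v k → 0ℚ ℚ.< bary (A , i) (v , k) → i ≡ k × v ∈ A
  0<bary⇒∈ A i v k lt =
    0<δ₂⇒≡ i k (0<p*q⇒0<p (δ₂ i k) (barycentre A v) (0≤δ₂ i k) lt) ,
    0<barycentre⇒∈ A (0<p*q⇒0<q (δ₂ i k) (barycentre A v) (0≤barycentre A v) lt)

  ∑-bary* : ∀ v k (ζ : Subset n × Fin 2 → ℚ) →
            ∑ℚ (ssdVertices G) (λ w → bary w (v , k) ℚ.* ζ w) ≡
            ∑ℚ (subsets n) (λ A → barycentre A v ℚ.* ζ (A , k))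
  ∑-bary* v k ζ = trans (∑ℚ-× (subsets n) (allFin 2) (λ w → bary w (v , k) ℚ.* ζ w))
    (∑ℚ-cong (subsets n) λ A → trans
      (∑ℚ-cong (allFin 2) (λ i → ℚ.*-assoc (δ₂ i k) (barycentre A v) (ζ (A , i))))
      (∑-δ₂ k (λ i → barycentre A v ℚ.* ζ (A , i))))

  ∑-bary : ∀ w → ∑ℚ (boxVertices G) (bary w) ≡ ∑ℚ (allFin n) (barycentre (proj₁ w))
  ∑-bary (A , i) = trans (∑ℚ-× (allFin n) (allFin 2) (bary (A , i)))
    (∑ℚ-cong (allFin n) λ v → trans (∑ℚ-cong (allFin 2) (λ k → cong (ℚ._* barycentre A v) (δ₂-sym i k)))
                                    (∑-δ₂ i (λ _ → barycentre A v)))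
    where
    δ₂-sym : ∀ i k → δ₂ i k ≡ δ₂ k i
    δ₂-sym 0F 0F = refl
    δ₂-sym 0F 1F = refl
    δ₂-sym 1F 0F = refl
    δ₂-sym 1F 1F = refl

-- The flow on rational vectors

module Flow {n : ℕ} (G : Graph n) (J : Subset n × Fin 2 → Subset n × Fin 2)
            (J-nonempty : ∀ {w} → Nonempty (proj₁ w) → Nonempty (proj₁ (J w))) where

  -- nothing stands for the time, just u for the coordinate u.

  Key : Set
  Key = Maybe (Fin n × Fin 2)

  keys : List Key
  keys = nothing ∷ map just (boxVertices G)

  keys-complete : ∀ k → k List.∈ keys
  keys-complete nothing        = here refl
  keys-complete (just (v , i)) = there (List.∈-map⁺ just (List.∈-cartesianProduct⁺ (List.∈-allFin v) (List.∈-allFin i)))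

  -- What remains of a coordinate above the level; `cappedℚ` is the part below. The maximum with
  -- zero keeps their sum exact even where an approximation of the time is negative.
  excessℚ : Fin n × Fin 2 → (Key → ℚ) → ℚ
  excessℚ u ρ = ρ (just u) ∸ (0ℚ ℚ.⊔ ρ nothing)

  layerℚ : Subset n × Fin 2 → (Key → ℚ) → ℚ
  layerℚ (A , k) ρ = layer A (ρ nothing) 0ℚ (λ v → ρ (just (v , k)))

  weightℚ : Subset n × Fin 2 → (Key → ℚ) → ℚ
  weightℚ w ρ = fromℕ Subset.∣ proj₁ w ∣ ℚ.* layerℚ w ρ

  movedℚ : Fin n × Fin 2 → (Key → ℚ) → ℚ
  movedℚ u ρ = ∑ℚ (ssdVertices G) (λ w → bary G (J w) u ℚ.* weightℚ w ρ)

  flowℚ : Fin n × Fin 2 → (Key → ℚ) → ℚ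
  flowℚ u ρ = excessℚ u ρ ℚ.+ movedℚ u ρ

  cappedℚ : Fin n × Fin 2 → (Key → ℚ) → ℚ
  cappedℚ u ρ = (ρ nothing ℚ.⊓ ρ (just u)) ∸ 0ℚ

  lip-excess : ∀ u → Lipschitz (excessℚ u)
  lip-excess u = lip-∸ (lip-var (just u)) (lip-⊔ (lip-const 0ℚ) (lip-var nothing))

  lip-layerℚ : ∀ w → Lipschitz (layerℚ w)
  lip-layerℚ (A , k) = lip-layer A (lip-var nothing) (lip-const 0ℚ) (λ v → lip-var (just (v , k)))

  lip-weight : ∀ w → Lipschitz (weightℚ w)
  lip-weight w = lip-* (0≤fromℕ Subset.∣ proj₁ w ∣) (lip-layerℚ w)

  lip-flow : ∀ u → Lipschitz (flowℚ u)
  lip-flow u = lip-+ (lip-excess u) (lip-∑ (ssdVertices G) (λ w → lip-* (0≤bary G (J w) u) (lip-weight w)))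

  lip-capped : ∀ u → Lipschitz (cappedℚ u)
  lip-capped u = lip-∸ (lip-⊓ (lip-var nothing) (lip-var (just u))) (lip-const 0ℚ)

  0≤weightℚ : ∀ w ρ → 0ℚ ℚ.≤ weightℚ w ρ
  0≤weightℚ (A , k) ρ = 0≤* (fromℕ Subset.∣ A ∣) (layerℚ (A , k) ρ) (0≤fromℕ Subset.∣ A ∣)
    (0≤layer A (ρ nothing) 0ℚ (λ v → ρ (just (v , k))))

  0≤excessℚ : ∀ u ρ → 0ℚ ℚ.≤ excessℚ u ρ
  0≤excessℚ u ρ = 0≤∸ (ρ (just u)) (0ℚ ℚ.⊔ ρ nothing)

  0≤movedℚ : ∀ u ρ → 0ℚ ℚ.≤ movedℚ u ρ
  0≤movedℚ u ρ = 0≤∑ℚ (ssdVertices G)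
    (λ w → 0≤* (bary G (J w) u) (weightℚ w ρ) (0≤bary G (J w) u) (0≤weightℚ w ρ))

  0≤flowℚ : ∀ u ρ → 0ℚ ℚ.≤ flowℚ u ρ
  0≤flowℚ u ρ = subst (ℚ._≤ flowℚ u ρ) (ℚ.+-identityʳ 0ℚ) (ℚ.+-mono-≤ (0≤excessℚ u ρ) (0≤movedℚ u ρ))

  ∑-bary*weight : ∀ u ρ → ∑ℚ (ssdVertices G) (λ w → bary G w u ℚ.* weightℚ w ρ) ≡ cappedℚ u ρ
  ∑-bary*weight (v , k) ρ = trans (∑-bary* G v k (λ w → weightℚ w ρ))
    (∑-barycentre*layer (ρ nothing) 0ℚ (λ v → ρ (just (v , k))) v)

  excess+capped : ∀ u ρ → excessℚ u ρ ℚ.+ cappedℚ u ρ ≡ ρ (just u) ∸ 0ℚ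
  excess+capped u ρ = trans
    (cong (λ p → excessℚ u ρ ℚ.+ (p ∸ 0ℚ)) (ℚ.⊓-comm (ρ nothing) (ρ (just u))))
    (∸-split (ρ (just u)) 0ℚ (ρ nothing))

  ∑-weight : ∀ ρ → ∑ℚ (ssdVertices G) (λ w → weightℚ w ρ) ≡ ∑ℚ (boxVertices G) (λ u → cappedℚ u ρ)
  ∑-weight ρ = begin
    ∑ℚ (ssdVertices G) (λ w → weightℚ w ρ)
      ≡⟨ ∑ℚ-× (subsets n) (allFin 2) (λ w → weightℚ w ρ) ⟩
    ∑ℚ (subsets n) (λ A → ∑ℚ (allFin 2) (λ k → weightℚ (A , k) ρ))
      ≡⟨ ∑ℚ-swap (subsets n) (allFin 2) (λ A k → weightℚ (A , k) ρ) ⟩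
    ∑ℚ (allFin 2) (λ k → ∑ℚ (subsets n) (λ A → weightℚ (A , k) ρ))
      ≡⟨ ∑ℚ-cong (allFin 2) (λ k → ∑-∣∣*layer (ρ nothing) 0ℚ (λ v → ρ (just (v , k)))) ⟩
    ∑ℚ (allFin 2) (λ k → ∑ℚ (allFin n) (λ v → cappedℚ (v , k) ρ))
      ≡⟨ ∑ℚ-swap (allFin 2) (allFin n) (λ k v → cappedℚ (v , k) ρ) ⟩
    ∑ℚ (allFin n) (λ v → ∑ℚ (allFin 2) (λ k → cappedℚ (v , k) ρ))
      ≡⟨ sym (∑ℚ-× (allFin n) (allFin 2) (λ u → cappedℚ u ρ)) ⟩
    ∑ℚ (boxVertices G) (λ u → cappedℚ u ρ) ∎
    where open ≡-Reasoning

  -- The coordinates of a barycentre add up to one, so redirecting a weight preserves its total. The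
  -- empty set lacks a barycentre but carries no weight.
  ∑-moved : ∀ ρ → ∑ℚ (boxVertices G) (λ u → movedℚ u ρ) ≡ ∑ℚ (boxVertices G) (λ u → cappedℚ u ρ)
  ∑-moved ρ = begin
    ∑ℚ (boxVertices G) (λ u → movedℚ u ρ)
      ≡⟨ ∑ℚ-swap (boxVertices G) (ssdVertices G) (λ u w → bary G (J w) u ℚ.* weightℚ w ρ) ⟩
    ∑ℚ (ssdVertices G) (λ w → ∑ℚ (boxVertices G) (λ u → bary G (J w) u ℚ.* weightℚ w ρ))
      ≡⟨ ∑ℚ-cong (ssdVertices G) (λ w → trans (∑ℚ-* (boxVertices G) (bary G (J w)) (weightℚ w ρ))
           (total w (Subset.nonempty? (proj₁ w)))) ⟩
    ∑ℚ (ssdVertices G) (λ w → weightℚ w ρ)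
      ≡⟨ ∑-weight ρ ⟩
    ∑ℚ (boxVertices G) (λ u → cappedℚ u ρ) ∎
    where
    open ≡-Reasoning

    total : ∀ w → Dec (Nonempty (proj₁ w)) → ∑ℚ (boxVertices G) (bary G (J w)) ℚ.* weightℚ w ρ ≡ weightℚ w ρ
    total w (yes ne) = trans
      (cong (ℚ._* weightℚ w ρ) (trans (∑-bary G (J w)) (∑-barycentre (proj₁ (J w)) (J-nonempty {w} ne))))
      (ℚ.*-identityˡ (weightℚ w ρ))
    total w (no ¬ne) = trans (cong (∑ℚ (boxVertices G) (bary G (J w)) ℚ.*_) weightless)
      (trans (ℚ.*-zeroʳ (∑ℚ (boxVertices G) (bary G (J w)))) (sym weightless))
      where
      weightless : weightℚ w ρ ≡ 0ℚ
      weightless = empty⇒weightless (proj₁ w) ¬ne (layerℚ w ρ)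

  ∑-flow : ∀ ρ → ∑ℚ (boxVertices G) (λ u → flowℚ u ρ) ≡ ∑ℚ (boxVertices G) (λ u → ρ (just u) ∸ 0ℚ)
  ∑-flow ρ = begin
    ∑ℚ (boxVertices G) (λ u → flowℚ u ρ)
      ≡⟨ ∑ℚ-+ (boxVertices G) (λ u → excessℚ u ρ) (λ u → movedℚ u ρ) ⟩
    ∑ℚ (boxVertices G) (λ u → excessℚ u ρ) ℚ.+ ∑ℚ (boxVertices G) (λ u → movedℚ u ρ)
      ≡⟨ cong (∑ℚ (boxVertices G) (λ u → excessℚ u ρ) ℚ.+_) (∑-moved ρ) ⟩
    ∑ℚ (boxVertices G) (λ u → excessℚ u ρ) ℚ.+ ∑ℚ (boxVertices G) (λ u → cappedℚ u ρ)
      ≡⟨ sym (∑ℚ-+ (boxVertices G) (λ u → excessℚ u ρ) (λ u → cappedℚ u ρ)) ⟩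
    ∑ℚ (boxVertices G) (λ u → excessℚ u ρ ℚ.+ cappedℚ u ρ)
      ≡⟨ ∑ℚ-cong (boxVertices G) (λ u → excess+capped u ρ) ⟩
    ∑ℚ (boxVertices G) (λ u → ρ (just u) ∸ 0ℚ) ∎
    where open ≡-Reasoning

-- Finite choice and positivity of reals

∀∈-∷ : {X : Set} {P : Pred X 0ℓ} {x : X} {xs : List X} →
       P x → (∀ {y} → y List.∈ xs → P y) → ∀ {y} → y List.∈ x ∷ xs → P y
∀∈-∷ p ps (here refl) = p
∀∈-∷ p ps (there y∈)  = ps y∈

-- Finite choice: witnesses found separately for the members of a support are gathered in one list.
collect : {X Y : Set} {P : Pred Y 0ℓ} {R : X → Y → Set} (xs : List X) →
          (∀ {x} → x List.∈ xs → ∃ λ y → P y × R x y) →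
          ∃ λ ys → (∀ {y} → y List.∈ ys → P y) × (∀ {x} → x List.∈ xs → ∃ λ y → y List.∈ ys × R x y)
collect []       _ = [] , (λ ()) , (λ ())
collect {P = P} (x ∷ xs) f =
  let y , p , r   = f (here refl)
      ys , ps , g = collect xs (f ∘ there)
  in y ∷ ys , ∀∈-∷ {P = P} p ps ,
     (λ { (here refl) → y , here refl , r ; (there x∈) → let z , z∈ , s = g x∈ in z , there z∈ , s })

<-asym : ∀ {x y} → x < y → ¬ (y < x)
<-asym {x} {y} = <⇒≤ {x} {y}

<-irrefl : ∀ {x} → ¬ (x < x)
<-irrefl {x} = ≤-refl {x}

<-resp-≈ : ∀ {x x′ y y′} → x ≈ x′ → y ≈ y′ → x < y → x′ < y′
<-resp-≈ {x} {x′} {y} {y′} (_ , x′≤x) (y≤y′ , _) x<y =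
  <-≤-trans {x′} {y} {y′} (≤-<-trans {x′} {x} {y} x′≤x x<y) y≤y′

∸-gap : ∀ u l ε → 0ℚ ℚ.< ε → ε ℚ.≤ u ∸ l → l ℚ.+ ε ℚ.≤ u
∸-gap u l ε 0<ε ε≤ = cases (ℚ.≤-total u l)
  where
  cases : u ℚ.≤ l ⊎ l ℚ.≤ u → l ℚ.+ ε ℚ.≤ u
  cases (inj₁ u≤l) = ⊥-elim (ℚ.<-irrefl refl (ℚ.<-≤-trans 0<ε (subst (ε ℚ.≤_) (u≤l⇒u∸l≡0 u≤l) ε≤)))
  cases (inj₂ l≤u) = subst (l ℚ.+ ε ℚ.≤_) (cancel l u) (ℚ.+-monoʳ-≤ l (subst (ε ℚ.≤_) (l≤u⇒u∸l≡u-l l≤u) ε≤))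
    where
    cancel : ∀ l u → l ℚ.+ (u ℚ.- l) ≡ u
    cancel l u = trans (cong (l ℚ.+_) (ℚ.+-comm u (ℚ.- l))) (trans (sym (ℚ.+-assoc l (ℚ.- l) u))
      (trans (cong (ℚ._+ u) (ℚ.+-inverseʳ l)) (ℚ.+-identityˡ u)))

0<∸⇒< : ∀ y U V → (∀ n → seq y n ℚ.≤ seq U n ∸ seq V n) → 0ℝ < y → V < U
0<∸⇒< y U V y≤ (ε , 0<ε , N , p) = ε , 0<ε , N , λ n N≤n →
  ∸-gap (seq U n) (seq V n) ε 0<ε
    (ℚ.≤-trans (subst (ℚ._≤ seq y n) (ℚ.+-identityˡ ε) (p n N≤n)) (y≤ n))

-- Approximations of a nonnegative real may be negative, but replacing them by their positive parts
-- does not change the real.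
∸0≈ : ∀ x y → (∀ n → seq y n ≡ seq x n ∸ 0ℚ) → 0ℝ ≤ x → y ≈ x
∸0≈ x y y≡ 0≤x = y≤x , seq-≤⇒≤ {x} {y} (λ n → subst (seq x n ℚ.≤_) (sym (y≡ n)) (x≤x∸0 (seq x n)))
  where
  x≤x∸0 : ∀ p → p ℚ.≤ p ∸ 0ℚ
  x≤x∸0 p = subst (ℚ._≤ p ∸ 0ℚ) (ℚ.+-identityʳ p) (ℚ.p≤q⊔p 0ℚ (p ℚ.- 0ℚ))

  y≤x : y ≤ x
  y≤x (ε , 0<ε , N , p) = 0≤x (ε , 0<ε , N , λ n N≤n →
    negative (seq x n) (subst (seq x n ℚ.+ ε ℚ.≤_) (y≡ n) (p n N≤n)))
    where
    negative : ∀ q → q ℚ.+ ε ℚ.≤ q ∸ 0ℚ → q ℚ.+ ε ℚ.≤ 0ℚ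
    negative q le = cases (ℚ.≤-total q 0ℚ)
      where
      cases : q ℚ.≤ 0ℚ ⊎ 0ℚ ℚ.≤ q → q ℚ.+ ε ℚ.≤ 0ℚ
      cases (inj₁ q≤0) = subst (q ℚ.+ ε ℚ.≤_) (u≤l⇒u∸l≡0 q≤0) le
      cases (inj₂ 0≤q) = ⊥-elim (p+ε≰p {q} 0<ε
        (subst (q ℚ.+ ε ℚ.≤_) (trans (l≤u⇒u∸l≡u-l 0≤q) (ℚ.+-identityʳ q)) le))

0<·⇒ : ∀ q y → 0ℚ ℚ.≤ q → 0ℝ < q · y → 0ℚ ℚ.< q × 0ℝ < y
0<·⇒ q y 0≤q lt = ·-cancel-< q 0ℝ y 0≤q (≤-<-trans {q · 0ℝ} {0ℝ} {q · y} (proj₁ (·-zeroʳ q)) lt)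

0≤· : ∀ q y → 0ℚ ℚ.≤ q → 0ℝ ≤ y → 0ℝ ≤ q · y
0≤· q y 0≤q 0≤y = ≤-trans {0ℝ} {q · 0ℝ} {q · y} (proj₂ (·-zeroʳ q)) (·-mono-≤ q {0ℝ} {y} 0≤q 0≤y)

·-null : ∀ q y → 0ℚ ℚ.≤ q → y ≈ 0ℝ → q · y ≈ 0ℝ
·-null q y 0≤q y≈0 = ≈-trans {q · y} {q · 0ℝ} {0ℝ} (·-cong q {y} {0ℝ} 0≤q y≈0) (·-zeroʳ q)

0<+⇒ : ∀ x y → 0ℝ < x + y → 0ℝ < x ⊎ 0ℝ < y
0<+⇒ x y lt = +-<-split 0ℝ 0ℝ x y
  (≤-<-trans {0ℝ + 0ℝ} {0ℝ} {x + y} (seq-≤⇒≤ {0ℝ + 0ℝ} {0ℝ} (λ _ → ℚ.≤-refl)) lt)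

0<1 : 0ℝ < 1ℝ
0<1 = 1ℚ , ℚ.positive⁻¹ 1ℚ , 0 , λ _ _ → ℚ.≤-refl

-- The action on ∥ B(G) ∥

module Equivariance {n : ℕ} (G : Graph n) where

  open Neighbourhoods G using (B-adjacent)

  ∑ℚ-swapped : ∀ {V : Set} (vs : List V) (f : V × Fin 2 → ℚ) →
               ∑ℚ (cartesianProduct vs (allFin 2)) (f ∘ swap) ≡ ∑ℚ (cartesianProduct vs (allFin 2)) f
  ∑ℚ-swapped vs f = trans (∑ℚ-× vs (allFin 2) (f ∘ swap))
    (trans (∑ℚ-cong vs (λ v → both (f (v , 1F)) (f (v , 0F)))) (sym (∑ℚ-× vs (allFin 2) f)))
    where
    both : ∀ p q → p ℚ.+ (q ℚ.+ 0ℚ) ≡ q ℚ.+ (p ℚ.+ 0ℚ)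
    both p q = trans (cong (p ℚ.+_) (ℚ.+-identityʳ q))
      (trans (ℚ.+-comm p q) (cong (q ℚ.+_) (sym (ℚ.+-identityʳ p))))

  ∑-swapped : ∀ {V : Set} (vs : List V) (f : V × Fin 2 → ℝ) →
              ∑ (cartesianProduct vs (allFin 2)) (f ∘ swap) ≈ ∑ (cartesianProduct vs (allFin 2)) f
  ∑-swapped vs f = seq-≡⇒≈ {∑ ps (f ∘ swap)} {∑ ps f} λ k →
    trans (seq-∑ ps (f ∘ swap) k)
          (trans (∑ℚ-swapped vs (λ u → seq (f u) k)) (sym (seq-∑ ps f k)))
    where
    ps = cartesianProduct vs (allFin 2)

  ∈-swap⁻ : ∀ {V : Set} {σ : List (V × Fin 2)} {u} → swap u List.∈ map swap σ → u List.∈ σ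
  ∈-swap⁻ {σ = σ} {u} u∈ with List.∈-map⁻ swap u∈
  ... | u′ , u′∈ , eq = subst (List._∈ σ)
        (trans (sym (swap-involutive u′)) (trans (cong swap (sym eq)) (swap-involutive u))) u′∈

  B-swap : ∀ {σ} → B G (map swap σ) → B G σ
  B-swap (P , Q , nP , nQ , P⊆ , Q⊆ , f , g) = Q , P , nQ , nP , Q⊆ , P⊆ ,
    (λ { {_ , 0F} u∈ → f (List.∈-map⁺ swap u∈) ; {_ , 1F} u∈ → f (List.∈-map⁺ swap u∈) }) ,
    (λ { {_ , 0F} u∈ → ∈-swap⁻ (g u∈) ; {_ , 1F} u∈ → ∈-swap⁻ (g u∈) })

  ν-closed : ∀ x → ∥B∥ G x → ∥B∥ G (ν G x)
  ν-closed x x∈B = record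
    { nonNegative = nonNegative ∘ swap
    ; sum         = ≈-trans {∑ (boxVertices G) (x ∘ swap)} {∑ (boxVertices G) x} {1ℝ} (∑-swapped (allFin n) x) sum
    ; support     = λ σ pos → B-swap (support (map swap σ) (All.map⁺ pos))
    }
    where open Realization x∈B

  ν-involutive : ∀ x u → ν G (ν G x) u ≈ x u
  ν-involutive x (v , i) = subst (λ k → x (v , k) ≈ x (v , i)) (sym (opposite-involutive i)) (≈-refl {x (v , i)})

  -- At a fixed point some node would have positive coordinates on both shores and thus be adjacent
  -- to itself.
  ν-free : ∀ x → ∥B∥ G x → ¬ (ν G x ≋ x)
  ν-free x x∈B νx≋x =
    let (v , i) , _ , pos = 0<∑⇒∃ (boxVertices G) x (<-≤-trans {0ℝ} {1ℝ} {∑ (boxVertices G) x} 0<1 (proj₂ sum))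
        pos′              = <-≤-trans {0ℝ} {x (v , i)} {x (v , opposite i)} pos (proj₂ (νx≋x (v , i)))
    in Graph.irrefl G refl (B-adjacent (support ((v , i) ∷ (v , opposite i) ∷ []) (pos ∷ pos′ ∷ []))
         (here refl) (there (here refl)) (i≢oppositei i))
    where open Realization x∈B

  ν-isZ₂Space : IsZ₂Space (∥B∥ G) (ν G)
  ν-isZ₂Space = record
    { closed     = ν-closed
    ; continuous = λ x ε 0<ε → ε , 0<ε , λ y near u → near (swap u)
    ; involutive = λ x → ν-involutive (proj₁ x)
    ; free       = λ x → ν-free (proj₁ x) (proj₂ x)
    }

  δ₂-swap : ∀ i k → δ₂ (opposite i) (opposite k) ≡ δ₂ i k
  δ₂-swap 0F 0F = refl
  δ₂-swap 0F 1F = refl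
  δ₂-swap 1F 0F = refl
  δ₂-swap 1F 1F = refl

  bary-swap : ∀ w u → bary G (swap w) (swap u) ≡ bary G w u
  bary-swap (A , i) (v , k) = cong (ℚ._* barycentre A v) (δ₂-swap i k)

Near-mono : ∀ {x y δ ε} → δ ℚ.≤ ε → Near δ x y → Near ε x y
Near-mono {x} {y} {δ} {ε} δ≤ε (p , q) =
  <-≤-trans {x} {y + const δ} {y + const ε} p (widen y) ,
  <-≤-trans {y} {x + const δ} {x + const ε} q (widen x)
  where
  widen : ∀ y → y + const δ ≤ y + const ε
  widen y = seq-≤⇒≤ {y + const δ} {y + const ε} λ n → ℚ.+-monoʳ-≤ (seq y n) δ≤ε

-- The flow on real points

module Retraction {n : ℕ} (G : Graph n) {_<ᵥ_ : Rel (Fin n) 0ℓ} (<ᵥ-isSTO : IsStrictTotalOrder _≡_ _<ᵥ_) where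

  open Neighbourhoods G
  open Halving G <ᵥ-isSTO
  open Equivariance G

  J-nonempty : ∀ {w} → Nonempty (proj₁ w) → Nonempty (proj₁ (J w))
  J-nonempty {A , i} ne = cases (Subset.nonempty? (CN G A))
    where
    cases : Dec (N G A) → Nonempty (proj₁ (J (A , i)))
    cases (yes nbr) = proj₁ (J-valid {A , i} (ne , nbr))
    cases (no ¬nbr) = subst (Nonempty ∘ proj₁) (sym (J-outside ¬nbr)) ne

  open Flow G J (λ {w} → J-nonempty {w})
  open Lift keys keys-complete

  private
    X : Set
    X = Fin n × Fin 2 → ℝ

    ss : List Vertex
    ss = ssdVertices G

    bs : List (Fin n × Fin 2)
    bs = boxVertices G

  env : X → ℝ → Key → ℝ
  env x t = maybe x t

  flow excess capped moved : X → ℝ → X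
  flow   x t u = lift (lip-flow u) (env x t)
  excess x t u = lift (lip-excess u) (env x t)
  capped x t u = lift (lip-capped u) (env x t)

  weight depth : X → ℝ → Vertex → ℝ
  weight x t w = lift (lip-weight w) (env x t)
  depth  x t w = lift (lip-layerℚ w) (env x t)

  moved x t u = ∑ ss λ w → bary G (J w) u · weight x t w

  seq-∑bary : ∀ (f : Vertex → Vertex) x t u n →
              seq (∑ ss λ w → bary G (f w) u · weight x t w) n ≡
              ∑ℚ ss (λ w → bary G (f w) u ℚ.* weightℚ w (env x t at n))
  seq-∑bary f x t u n = seq-∑ ss (λ w → bary G (f w) u · weight x t w) n

  flow≈ : ∀ x t u → flow x t u ≈ excess x t u + moved x t u
  flow≈ x t u = seq-≡⇒≈ {flow x t u} {excess x t u + moved x t u} λ n →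
    cong (excessℚ u (env x t at n) ℚ.+_) (sym (seq-∑bary J x t u n))

  0≤weight : ∀ x t w → 0ℝ ≤ weight x t w
  0≤weight x t w = seq-≤⇒≤ {0ℝ} {weight x t w} λ n → 0≤weightℚ w (env x t at n)

  0≤excess : ∀ x t u → 0ℝ ≤ excess x t u
  0≤excess x t u = seq-≤⇒≤ {0ℝ} {excess x t u} λ n → 0≤excessℚ u (env x t at n)

  excess+capped≈ : ∀ x t u → 0ℝ ≤ x u → excess x t u + capped x t u ≈ x u
  excess+capped≈ x t u = ∸0≈ (x u) (excess x t u + capped x t u)
    (λ n → excess+capped u (env x t at n))

  capped≈ : ∀ x t u → capped x t u ≈ ∑ ss λ w → bary G w u · weight x t w
  capped≈ x t u = seq-≡⇒≈ {capped x t u} {∑ ss λ w → bary G w u · weight x t w} λ n →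
    sym (trans (seq-∑bary id x t u n) (∑-bary*weight u (env x t at n)))

  -- Weights that are not redirected rebuild the capped coordinate, and the excess completes it.
  -- This covers both the start, where no weight is positive, and the points of ∥ HDL(G) ∥.
  stationary : ∀ x t u → 0ℝ ≤ x u → (∀ w → 0ℝ < weight x t w → J w ≡ w) → flow x t u ≈ x u
  stationary x t u 0≤xu fixes =
    ≈-trans {flow x t u} {excess x t u + moved x t u} {x u} (flow≈ x t u)
    (≈-trans {excess x t u + moved x t u} {excess x t u + capped x t u} {x u}
      (+-cong {excess x t u} {moved x t u} {excess x t u} {capped x t u} (≈-refl {excess x t u})
        (≈-trans {moved x t u} {∑ ss λ w → bary G w u · weight x t w} {capped x t u}
          (∑-cong ss {λ w → bary G (J w) u · weight x t w} {λ w → bary G w u · weight x t w} term)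
          (≈-sym {capped x t u} {∑ ss λ w → bary G w u · weight x t w} (capped≈ x t u))))
      (excess+capped≈ x t u 0≤xu))
    where
    term : ∀ w → bary G (J w) u · weight x t w ≈ bary G w u · weight x t w
    term w = ≈-by-cases {bary G (J w) u · weight x t w} {bary G w u · weight x t w} {0ℝ < weight x t w}
      (λ 0<w → subst (λ w′ → bary G w′ u · weight x t w ≈ bary G w u · weight x t w) (sym (fixes w 0<w))
                 (≈-refl {bary G w u · weight x t w}))
      (λ 0≮w → ≈-trans {bary G (J w) u · weight x t w} {0ℝ} {bary G w u · weight x t w}
        (·-null (bary G (J w) u) (weight x t w) (0≤bary G (J w) u) (0≮w , 0≤weight x t w))
        (≈-sym {bary G w u · weight x t w} {0ℝ}
          (·-null (bary G w u) (weight x t w) (0≤bary G w u) (0≮w , 0≤weight x t w))))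

  -- The strict inequalities behind a positive weight. They say that w is a superlevel set of x for
  -- a range of levels below t, without naming a level.
  record Active (x : X) (t : ℝ) (w : Vertex) : Set where
    field
      nonempty : Nonempty (proj₁ w)
      time     : 0ℝ < t
      inner    : ∀ {a} → a ∈ proj₁ w → 0ℝ < x (a , proj₂ w)
      apart    : ∀ {a b} → a ∈ proj₁ w → b ∉ proj₁ w → x (b , proj₂ w) < x (a , proj₂ w)
      outer    : ∀ {b} → b ∉ proj₁ w → x (b , proj₂ w) < t

  open Active

  -- Each inequality is `layer-≤` for another pair of candidate ends; nonemptiness comes from the
  -- cardinality factor.
  active : ∀ x t w → 0ℝ < weight x t w → Active x t w
  active x t (A , k) 0<w = record
    { nonempty = decidable-stable (Subset.nonempty? A) λ ¬ne →
        ℚ.<-irrefl refl (subst (0ℚ ℚ.<_) (trans (sym (ℚ.*-identityʳ (fromℕ Subset.∣ A ∣)))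
          (empty⇒weightless A ¬ne 1ℚ)) (proj₁ both))
    ; time     = gap t 0ℝ λ n → layer-≤ A (inj₁ ℚ.≤-refl) (inj₁ ℚ.≤-refl)
    ; inner    = λ {a} a∈ → gap (x (a , k)) 0ℝ λ n →
        layer-≤ A (inj₂ (a , a∈ , ℚ.≤-refl)) (inj₁ ℚ.≤-refl)
    ; apart    = λ {a} {b} a∈ b∉ → gap (x (a , k)) (x (b , k)) λ n →
        layer-≤ A (inj₂ (a , a∈ , ℚ.≤-refl)) (inj₂ (b , b∉ , ℚ.≤-refl))
    ; outer    = λ {b} b∉ → gap t (x (b , k)) λ n →
        layer-≤ A (inj₁ ℚ.≤-refl) (inj₂ (b , b∉ , ℚ.≤-refl))
    }
    where
    both : 0ℚ ℚ.< fromℕ Subset.∣ A ∣ × 0ℝ < depth x t (A , k)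
    both = 0<·⇒ (fromℕ Subset.∣ A ∣) (depth x t (A , k)) (0≤fromℕ Subset.∣ A ∣) 0<w

    gap : ∀ U V → (∀ n → seq (depth x t (A , k)) n ℚ.≤ seq U n ∸ seq V n) → V < U
    gap U V le = 0<∸⇒< (depth x t (A , k)) U V le (proj₂ both)

  -- Active vertices and the support of the flow

  module InB {x : X} (x∈B : ∥B∥ G x) where

    open Realization x∈B public

    adjacent : ∀ {u v i k} → i ≢ k → 0ℝ < x (u , i) → 0ℝ < x (v , k) → Graph.Adj G u v
    adjacent {u} {v} {i} {k} i≢k p q = B-adjacent
      (support ((u , i) ∷ (v , k) ∷ []) (p ∷ q ∷ [])) (here refl) (there (here refl)) i≢k

    neighbour : ∀ A i → (∀ {a} → a ∈ A → 0ℝ < x (a , i)) → N G A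
    neighbour A i pos = let c , adj = B-neighbour (support σ (All.tabulate σ-pos)) i
      in c , ∈CN⁺ (λ a∈ → adj (List.∈-map⁺ (_, i) (List.∈-filter⁺ (Subset._∈? A) (List.∈-allFin _) a∈)))
      where
      σ : List (Fin n × Fin 2)
      σ = map (_, i) (filter (Subset._∈? A) (allFin n))

      σ-pos : ∀ {u} → u List.∈ σ → 0ℝ < x u
      σ-pos u∈ with List.∈-map⁻ (_, i) u∈
      ... | a , a∈ , refl = pos (proj₂ (List.∈-filter⁻ (Subset._∈? A) {xs = allFin n} a∈))

    ≤1 : ∀ u → x u ≤ 1ℝ
    ≤1 u = ≤-trans {x u} {∑ bs x} {1ℝ}
      (term≤∑ x nonNegative (List.∈-cartesianProduct⁺ (List.∈-allFin (proj₁ u)) (List.∈-allFin (proj₂ u))))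
      (proj₁ sum)

    module _ {t : ℝ} where

      active-valid : ∀ {w} → Active x t w → Valid w
      active-valid {A , i} act = nonempty act , neighbour A i (inner act)

      -- Superlevel sets of one vector are nested: a in A but not in B and b in B but not in A would
      -- each have the larger coordinate. On opposite shores the support of x gives adjacency.
      active-compat : ∀ {w w′} → Active x t w → Active x t w′ → Compat w w′
      active-compat {A , i} {B , k} α β = (λ { refl → comparable α β }) , crossing
        where
        comparable : Active x t (A , i) → Active x t (B , i) → Comparable A B
        comparable α β = cases (A Subset.⊆? B)
          where
          cases : Dec (A ⊆ B) → Comparable A B
          cases (yes A⊆B) = inj₁ A⊆B
          cases (no A⊈B)  = let a , a∈A , a∉B = ⊈⇒∃ A⊈B in
            inj₂ λ {b} b∈B → decidable-stable (b Subset.∈? A) λ b∉A →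
              <-asym {x (a , i)} {x (b , i)} (apart β b∈B a∉B) (apart α a∈A b∉A)

        crossing : i ≢ k → A ⊆ CN G B
        crossing i≢k a∈A = ∈CN⁺ λ b∈B → Graph.symm G (adjacent i≢k (inner α a∈A) (inner β b∈B))

      -- Nodes outside an active set have coordinates below t, so a node above t on the same shore
      -- lies inside.
      raw-below : ∀ {R i w} → (∀ {v} → v ∈ R → t < x (v , i) × 0ℝ < x (v , i)) → Active x t w →
                  Below (R , i) w
      raw-below {R} {i} {A , k} raw α =
        (λ { refl {v} v∈R → decidable-stable (v Subset.∈? A) λ v∉A →
               <-asym {t} {x (v , i)} (proj₁ (raw v∈R)) (outer α v∉A) }) ,
        (λ i≢k v∈R → ∈CN⁺ λ a∈A → Graph.symm G (adjacent i≢k (proj₂ (raw v∈R)) (inner α a∈A)))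

  -- The two possible origins of a positive coordinate of the flow: a node not yet exhausted, or a
  -- vertex of the subdivision whose weight has been moved.
  Entry : Set
  Entry = (Fin n × Fin 2) ⊎ Vertex

  open DecMembership {A = Entry}
    (Sum.≡-dec (Product.≡-dec _≟_ _≟_) (Product.≡-dec (Vec.≡-dec Bool._≟_) _≟_)) using (_∈?_)

  module _ {x : X} (x∈B : ∥B∥ G x) (t : ℝ) where

    open InB x∈B

    vertex : Fin n
    vertex = proj₁ (proj₁ (0<∑⇒∃ bs x (<-≤-trans {0ℝ} {1ℝ} {∑ bs x} 0<1 (proj₂ sum))))

    0<excess⇒late : ∀ u → 0ℝ < excess x t u → t < x u
    0<excess⇒late u = 0<∸⇒< (excess x t u) (x u) t λ k →
      ∸-mono-≤ {seq (x u) k} {seq (x u) k} {0ℚ ℚ.⊔ seq t k} {seq t k} ℚ.≤-refl (ℚ.p≤q⊔p 0ℚ (seq t k))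

    0<excess⇒positive : ∀ u → 0ℝ < excess x t u → 0ℝ < x u
    0<excess⇒positive u = 0<∸⇒< (excess x t u) (x u) 0ℝ λ k →
      ∸-mono-≤ {seq (x u) k} {seq (x u) k} {0ℚ ℚ.⊔ seq t k} {0ℚ} ℚ.≤-refl (ℚ.p≤p⊔q 0ℚ (seq t k))

    Source : Pred Entry 0ℓ
    Source (inj₁ u) = t < x u × 0ℝ < x u
    Source (inj₂ w) = Active x t w

    Covers : (Fin n × Fin 2) → Entry → Set
    Covers u       (inj₁ u′) = u ≡ u′
    Covers (v , i) (inj₂ w)  = proj₂ (J w) ≡ i × v ∈ proj₁ (J w)

    source : ∀ u → 0ℝ < flow x t u → ∃ λ e → Source e × Covers u e
    source u@(v , i) 0<flow = Sum.[ raw , pushed ]′ (0<+⇒ (excess x t u) (moved x t u)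
        (<-≤-trans {0ℝ} {flow x t u} {excess x t u + moved x t u} 0<flow (proj₁ (flow≈ x t u))))
      where
      raw : 0ℝ < excess x t u → ∃ λ e → Source e × Covers u e
      raw pos = inj₁ u ,
        (0<excess⇒late u pos , 0<excess⇒positive u pos) , refl

      pushed : 0ℝ < moved x t u → ∃ λ e → Source e × Covers u e
      pushed pos =
        let w , _ , 0<term = 0<∑⇒∃ ss (λ w → bary G (J w) u · weight x t w) pos
            0<b , 0<w      = 0<·⇒ (bary G (J w) u) (weight x t w) (0≤bary G (J w) u) 0<term
        in inj₂ w , active x t w 0<w , 0<bary⇒∈ G (proj₁ (J w)) (proj₂ (J w)) v i 0<b

    module Carrier (τ : List Entry) (sources : ∀ {e} → e List.∈ τ → Source e) where

      raws : Fin 2 → Subset n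
      raws i = ⟦ (λ v → inj₁ (v , i) ∈? τ) ⟧

      raws⁻ : ∀ {i v} → v ∈ raws i → t < x (v , i) × 0ℝ < x (v , i)
      raws⁻ {i} v∈ = sources (∈⟦⟧⁻ (λ v → inj₁ (v , i) ∈? τ) v∈)

      -- Unmoved nodes of one shore are bundled into a single set: their singletons would not form a
      -- chain, while the bundle lies below every moved set.
      place : Entry → Vertex
      place (inj₁ (v , i)) = raws i , i
      place (inj₂ w)       = J w

      place-valid : ∀ {e} → e List.∈ τ → Valid (place e)
      place-valid {inj₁ (v , i)} e∈ = (v , ∈⟦⟧⁺ (λ v → inj₁ (v , i) ∈? τ) e∈) ,
        neighbour (raws i) i (λ v∈ → proj₂ (raws⁻ v∈))
      place-valid {inj₂ w} e∈ = J-valid {w} (active-valid (sources e∈))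

      raws-below : ∀ {i w} → Active x t w → Below (raws i , i) (J w)
      raws-below {i} {w} α = Below-J {raws i , i} {w} (active-valid α) (raw-below raws⁻ α)

      place-compat : ∀ {e e′} → e List.∈ τ → e′ List.∈ τ → Compat (place e) (place e′)
      place-compat {inj₁ (v , i)} {inj₁ (v′ , k)} _ _ =
        (λ { refl → inj₁ id }) ,
        (λ i≢k u∈ → ∈CN⁺ λ u′∈ → Graph.symm G (adjacent i≢k (proj₂ (raws⁻ u∈)) (proj₂ (raws⁻ u′∈))))
      place-compat {inj₁ (v , i)} {inj₂ w} _ e′∈ = Below⇒Compat (raws-below (sources e′∈))
      place-compat {inj₂ w} {inj₁ (v , i)} e∈ _ =
        Compat-sym {raws i , i} {J w} (Below⇒Compat (raws-below (sources e∈)))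
      place-compat {inj₂ w} {inj₂ w′} e∈ e′∈ = J-compat {w} {w′}
        (active-valid (sources e∈)) (active-valid (sources e′∈)) (active-compat (sources e∈) (sources e′∈))

      place-flag : Flag (map place τ)
      place-flag = valid′ , compat′
        where
        valid′ : ∀ {w} → w List.∈ map place τ → Valid w
        valid′ w∈ with List.∈-map⁻ place w∈
        ... | e , e∈ , refl = place-valid e∈

        compat′ : ∀ {w w′} → w List.∈ map place τ → w′ List.∈ map place τ → Compat w w′
        compat′ w∈ w′∈ with List.∈-map⁻ place w∈ | List.∈-map⁻ place w′∈
        ... | e , e∈ , refl | e′ , e′∈ , refl = place-compat e∈ e′∈

      covered : ∀ {v i e} → e List.∈ τ → Covers (v , i) e → ∃ λ A → (A , i) List.∈ map place τ × v ∈ A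
      covered {v} {i} {inj₁ _} e∈ refl = raws i , List.∈-map⁺ place e∈ , ∈⟦⟧⁺ (λ v → inj₁ (v , i) ∈? τ) e∈
      covered {v} {i} {inj₂ w} e∈ (refl , v∈) = proj₁ (J w) , List.∈-map⁺ place e∈ , v∈

    flow-support : ∀ σ → All (λ u → 0ℝ < flow x t u) σ → B G σ
    flow-support σ pos =
      let τ , sources , cover = collect {P = Source} {R = Covers} σ (λ {u} u∈ → source u (All.lookup pos u∈))
          open Carrier τ sources
      in covered⇒B place-flag vertex λ u∈ → let e , e∈ , c = cover u∈ in covered e∈ c

    flow∈B : ∥B∥ G (flow x t)
    flow∈B = record
      { nonNegative = λ u → seq-≤⇒≤ {0ℝ} {flow x t u} (λ k → 0≤flowℚ u (env x t at k))
      ; sum         = ≈-trans {∑ bs (flow x t)} {∑ bs pos} {1ℝ} flow-total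
                        (≈-trans {∑ bs pos} {∑ bs x} {1ℝ}
                          (∑-cong bs {pos} {x} (λ u → ∸0≈ (x u) (pos u) (λ _ → refl) (nonNegative u))) sum)
      ; support     = flow-support
      }
      where
      -- The total of the flow is exact only relative to the positive parts of the approximations,
      -- which represent the same reals as x.
      pos : X
      pos u = lift (lip-∸ (lip-var (just u)) (lip-const 0ℚ)) (env x t)

      flow-total : ∑ bs (flow x t) ≈ ∑ bs pos
      flow-total = seq-≡⇒≈ {∑ bs (flow x t)} {∑ bs pos} λ k →
        trans (seq-∑ bs (flow x t) k) (trans (∑-flow (env x t at k)) (sym (seq-∑ bs pos k)))

    -- The end of the flow

    module End (t≈1 : t ≈ 1ℝ) where

      -- The push-forward of the weights along `J`, which gives the barycentric coordinates of the
      -- end point in HDL(G).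
      z : Vertex → ℝ
      z w′ = ∑ ss λ w → δ w′ (J w) · weight x t w

      excess≈0 : ∀ u → excess x t u ≈ 0ℝ
      excess≈0 u = (λ pos → ≤-trans {x u} {1ℝ} {t} (≤1 u) (proj₂ t≈1)
          (0<excess⇒late u pos)) ,
        0≤excess x t u

      drop-excess : ∀ u y → excess x t u + y ≈ y
      drop-excess u y = ≈-trans {excess x t u + y} {0ℝ + y} {y}
        (+-cong {excess x t u} {y} {0ℝ} {y} (excess≈0 u) (≈-refl {y}))
        (seq-≡⇒≈ {0ℝ + y} {y} (λ k → ℚ.+-identityˡ (seq y k)))

      seq-z : ∀ w′ k → seq (z w′) k ≡ ∑ℚ ss (λ w → δ w′ (J w) ℚ.* weightℚ w (env x t at k))
      seq-z w′ k = seq-∑ ss (λ w → δ w′ (J w) · weight x t w) k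

      -- Change of variables for the push-forward. The constant q = 1 yields the total of z, and
      -- `bary G w u` as a function of w yields its placement.
      ∑-transport : ∀ (q : Vertex → ℚ) k →
        ∑ℚ ss (λ w′ → q w′ ℚ.* seq (z w′) k) ≡ ∑ℚ ss (λ w → q (J w) ℚ.* weightℚ w (env x t at k))
      ∑-transport q k = begin
        ∑ℚ ss (λ w′ → q w′ ℚ.* seq (z w′) k)
          ≡⟨ ∑ℚ-cong ss (λ w′ → trans (cong (q w′ ℚ.*_) (seq-z w′ k)) (trans (ℚ.*-comm (q w′) (∑ℚ ss (inner′ w′)))
               (sym (∑ℚ-* ss (inner′ w′) (q w′))))) ⟩
        ∑ℚ ss (λ w′ → ∑ℚ ss (λ w → inner′ w′ w ℚ.* q w′))
          ≡⟨ ∑ℚ-swap ss ss (λ w′ w → inner′ w′ w ℚ.* q w′) ⟩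
        ∑ℚ ss (λ w → ∑ℚ ss (λ w′ → inner′ w′ w ℚ.* q w′))
          ≡⟨ ∑ℚ-cong ss (λ w → trans
               (∑ℚ-cong ss (λ w′ → reorder (δ w′ (J w)) (weightℚ w (env x t at k)) (q w′)))
               (trans (∑ℚ-* ss (λ w′ → δ w′ (J w) ℚ.* q w′) (weightℚ w (env x t at k)))
                      (cong (ℚ._* weightℚ w (env x t at k)) (∑-δ G (J w) q)))) ⟩
        ∑ℚ ss (λ w → q (J w) ℚ.* weightℚ w (env x t at k)) ∎
        where
        open ≡-Reasoning

        inner′ : Vertex → Vertex → ℚ
        inner′ w′ w = δ w′ (J w) ℚ.* weightℚ w (env x t at k)

        reorder : ∀ a b c → a ℚ.* b ℚ.* c ≡ a ℚ.* c ℚ.* b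
        reorder a b c = trans (ℚ.*-assoc a b c) (trans (cong (a ℚ.*_) (ℚ.*-comm b c)) (sym (ℚ.*-assoc a c b)))

      z-sum : ∑ ss z ≈ 1ℝ
      z-sum = ≈-trans {∑ ss z} {∑ bs (capped x t)} {1ℝ}
        (seq-≡⇒≈ {∑ ss z} {∑ bs (capped x t)} total)
        (≈-trans {∑ bs (capped x t)} {∑ bs x} {1ℝ} (∑-cong bs {capped x t} {x} capped≈x) sum)
        where
        open ≡-Reasoning

        capped≈x : ∀ u → capped x t u ≈ x u
        capped≈x u = ≈-trans {capped x t u} {excess x t u + capped x t u} {x u}
          (≈-sym {excess x t u + capped x t u} {capped x t u} (drop-excess u (capped x t u)))
          (excess+capped≈ x t u (nonNegative u))

        total : ∀ k → seq (∑ ss z) k ≡ seq (∑ bs (capped x t)) k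
        total k = begin
          seq (∑ ss z) k
            ≡⟨ seq-∑ ss z k ⟩
          ∑ℚ ss (λ w′ → seq (z w′) k)
            ≡⟨ ∑ℚ-cong ss (λ w′ → sym (ℚ.*-identityˡ (seq (z w′) k))) ⟩
          ∑ℚ ss (λ w′ → 1ℚ ℚ.* seq (z w′) k)
            ≡⟨ ∑-transport (λ _ → 1ℚ) k ⟩
          ∑ℚ ss (λ w → 1ℚ ℚ.* weightℚ w (env x t at k))
            ≡⟨ ∑ℚ-cong ss (λ w → ℚ.*-identityˡ (weightℚ w (env x t at k))) ⟩
          ∑ℚ ss (λ w → weightℚ w (env x t at k))
            ≡⟨ ∑-weight (env x t at k) ⟩
          ∑ℚ bs (λ u → cappedℚ u (env x t at k))
            ≡⟨ sym (seq-∑ bs (capped x t) k) ⟩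
          seq (∑ bs (capped x t)) k ∎

      z-support : ∀ σ → All (λ w → 0ℝ < z w) σ → HDL G <ᵥ-isSTO σ
      z-support σ pos =
        let ws , acts , orig = collect {P = Active x t} {R = λ u w → u ≡ J w} σ origin
        in HDL⁺ σ ws ((λ w∈ → active-valid (acts w∈)) , (λ p q → active-compat (acts p) (acts q))) orig
        where
        origin : ∀ {u} → u List.∈ σ → ∃ λ w → Active x t w × u ≡ J w
        origin {u} u∈ =
          let w , _ , 0<term = 0<∑⇒∃ ss (λ w → δ u (J w) · weight x t w) (All.lookup pos u∈)
              0<d , 0<w      = 0<·⇒ (δ u (J w)) (weight x t w) (0≤δ u (J w)) 0<term
          in w , active x t w 0<w , 0<δ⇒≡ u (J w) 0<d

      z-placed : placement z ≋ flow x t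
      z-placed u@(v , i) = ≈-trans {placement z u} {moved x t u} {flow x t u}
        (seq-≡⇒≈ {placement z u} {moved x t u} λ k → begin
          seq (placement z u) k
            ≡⟨ seq-∑ (subsets n) (λ A → barycentre A v · z (A , i)) k ⟩
          ∑ℚ (subsets n) (λ A → barycentre A v ℚ.* seq (z (A , i)) k)
            ≡⟨ sym (∑-bary* G v i (λ w → seq (z w) k)) ⟩
          ∑ℚ ss (λ w → bary G w u ℚ.* seq (z w) k)
            ≡⟨ ∑-transport (λ w → bary G w u) k ⟩
          ∑ℚ ss (λ w → bary G (J w) u ℚ.* weightℚ w (env x t at k))
            ≡⟨ sym (seq-∑bary J x t u k) ⟩
          seq (moved x t u) k ∎)
        (≈-sym {flow x t u} {moved x t u}
          (≈-trans {flow x t u} {excess x t u + moved x t u} {moved x t u}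
            (flow≈ x t u) (drop-excess u (moved x t u))))
        where open ≡-Reasoning

      flow∈HDL : ∥HDL∥ G <ᵥ-isSTO (flow x t)
      flow∈HDL = z , record
        { nonNegative = λ w′ → 0≤∑ ss (λ w → δ w′ (J w) · weight x t w)
            (λ w → 0≤· (δ w′ (J w)) (weight x t w) (0≤δ w′ (J w)) (0≤weight x t w))
        ; sum         = z-sum
        ; support     = z-support
        } , z-placed

  -- Points of ∥ HDL(G) ∥: active vertices are fixed, and the points lie in ∥ B(G) ∥

  module _ {x : X} {z : Vertex → ℝ} (z∈HDL : Realization ss (HDL G <ᵥ-isSTO) z) (z↦x : placement z ≋ x) where

    open Realization z∈HDL

    charged-flag : ∀ σ → All (λ w → 0ℝ < z w) σ → Flag σ
    charged-flag σ pos = HDL⇒Flag (support σ pos)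

    charged-comparable : ∀ {A B i} → 0ℝ < z (A , i) → 0ℝ < z (B , i) → Comparable A B
    charged-comparable {A} {B} {i} p q =
      proj₁ (proj₂ (charged-flag ((A , i) ∷ (B , i) ∷ []) (p ∷ q ∷ [])) (here refl) (there (here refl))) refl

    cover : ∀ v i → 0ℝ < x (v , i) → ∃ λ C → 0ℝ < z (C , i) × v ∈ C
    cover v i pos =
      let C , _ , 0<term = 0<∑⇒∃ (subsets n) (λ C → barycentre C v · z (C , i))
                             (<-≤-trans {0ℝ} {x (v , i)} {placement z (v , i)} pos (proj₂ (z↦x (v , i))))
          0<b , 0<z      = 0<·⇒ (barycentre C v) (z (C , i)) (0≤barycentre C v) 0<term
      in C , 0<z , 0<barycentre⇒∈ C 0<b

    -- Some charged C contributes more at a than at b. A barycentre is constant on its set, so C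
    -- contains a and not b.
    separate : ∀ a b i → x (b , i) < x (a , i) → ∃ λ C → 0ℝ < z (C , i) × a ∈ C × b ∉ C
    separate a b i b<a =
      let C , _ , lt = ∑-<⇒∃ (subsets n) (λ C → barycentre C b · z (C , i)) (λ C → barycentre C a · z (C , i))
                         (<-resp-≈ {x (b , i)} {placement z (b , i)} {x (a , i)} {placement z (a , i)}
                           (≈-sym {placement z (b , i)} {x (b , i)} (z↦x (b , i)))
                           (≈-sym {placement z (a , i)} {x (a , i)} (z↦x (a , i))) b<a)
          0<b , 0<z  = 0<·⇒ (barycentre C a) (z (C , i)) (0≤barycentre C a)
                         (≤-<-trans {0ℝ} {barycentre C b · z (C , i)} {barycentre C a · z (C , i)}
                           (0≤· (barycentre C b) (z (C , i)) (0≤barycentre C b) (nonNegative (C , i))) lt)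
          a∈C        = 0<barycentre⇒∈ C 0<b
      in C , 0<z , a∈C , λ b∈C → <-irrefl {barycentre C a · z (C , i)}
           (subst (λ q → q · z (C , i) < barycentre C a · z (C , i))
             (trans (indicator-∈ C (1/ Subset.∣ C ∣) b∈C) (sym (indicator-∈ C (1/ Subset.∣ C ∣) a∈C))) lt)

    -- The sets charged by z form a chain on each shore.  An active set A is the union over
    -- a ∈ A of the smallest charged set containing a, hence it is charged itself.

    module _ {t : ℝ} {A : Subset n} {i : Fin 2} (α : Active x t (A , i)) where

      inner-set : ∀ {a} → a ∈ A → ∃ λ C → 0ℝ < z (C , i) × a ∈ C × C ⊆ A
      inner-set {a} a∈A =
        let C₀ , 0<z₀ , a∈C₀ = cover a i (inner α a∈A)
            𝒞 , charged , separated = collect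
              {P = λ C → 0ℝ < z (C , i) × a ∈ C} {R = λ b C → b ∉ A → b ∉ C} (allFin n) (λ {b} _ → choose C₀ 0<z₀ a∈C₀ b)
            all-charged = ∀∈-∷ {P = λ C → 0ℝ < z (C , i) × a ∈ C} (0<z₀ , a∈C₀) charged
            M , M∈ , least = extremum {R = _⊆_} id (λ p q → q ∘ p) C₀ 𝒞
              (λ p q → charged-comparable (proj₁ (all-charged p)) (proj₁ (all-charged q)))
            0<zM , a∈M = all-charged M∈
        in M , 0<zM , a∈M , λ {b} b∈M → decidable-stable (b Subset.∈? A) λ b∉A →
             let C , C∈ , sep = separated (List.∈-allFin b) in sep b∉A (least (there C∈) b∈M)
        where
        choose : ∀ C₀ → 0ℝ < z (C₀ , i) → a ∈ C₀ → ∀ b →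
                 ∃ λ C → (0ℝ < z (C , i) × a ∈ C) × (b ∉ A → b ∉ C)
        choose C₀ 0<z₀ a∈C₀ b = cases (b Subset.∈? A)
          where
          cases : Dec (b ∈ A) → ∃ λ C → (0ℝ < z (C , i) × a ∈ C) × (b ∉ A → b ∉ C)
          -- Nothing has to be separated from a here; C₀ fills the place in the list.
          cases (yes b∈A) = C₀ , (0<z₀ , a∈C₀) , λ b∉A → contradiction b∈A b∉A
          cases (no b∉A)  = let C , 0<z , a∈C , b∉C = separate a b i (apart α a∈A b∉A)
                            in C , (0<z , a∈C) , λ _ → b∉C

      active-charged : 0ℝ < z (A , i)
      active-charged =
        let a₀ , a₀∈A            = nonempty α
            C₀ , 0<z₀ , _ , C₀⊆A = inner-set a₀∈A
            𝒞 , charged , covers = collect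
              {P = λ C → 0ℝ < z (C , i) × C ⊆ A} {R = λ a C → a ∈ A → a ∈ C} (allFin n) (λ {a} _ → choose C₀ 0<z₀ C₀⊆A a)
            all-charged = ∀∈-∷ {P = λ C → 0ℝ < z (C , i) × C ⊆ A} (0<z₀ , C₀⊆A) charged
            M , M∈ , top = extremum {R = λ P Q → Q ⊆ P} id (λ p q → p ∘ q) C₀ 𝒞
              (λ p q → Sum.swap (charged-comparable (proj₁ (all-charged p)) (proj₁ (all-charged q))))
            0<zM , M⊆A = all-charged M∈
            A⊆M : A ⊆ M
            A⊆M {a} a∈A = let C , C∈ , a∈C = covers (List.∈-allFin a) in top (there C∈) (a∈C a∈A)
        in subst (λ B → 0ℝ < z (B , i)) (Subset.⊆-antisym M⊆A A⊆M) 0<zM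
        where
        choose : ∀ C₀ → 0ℝ < z (C₀ , i) → C₀ ⊆ A → ∀ a →
                 ∃ λ C → (0ℝ < z (C , i) × C ⊆ A) × (a ∈ A → a ∈ C)
        choose C₀ 0<z₀ C₀⊆A a = cases (a Subset.∈? A)
          where
          cases : Dec (a ∈ A) → ∃ λ C → (0ℝ < z (C , i) × C ⊆ A) × (a ∈ A → a ∈ C)
          cases (yes a∈A) = let C , 0<z , a∈C , C⊆A = inner-set a∈A in C , (0<z , C⊆A) , λ _ → a∈C
          cases (no a∉A)  = C₀ , (0<z₀ , C₀⊆A) , λ a∈A → contradiction a∈A a∉A

      -- A charged vertex belongs to HDL(G), the image of the idempotent `J`.
      active-fixed : J (A , i) ≡ (A , i)
      active-fixed = HDL-fixed (support ((A , i) ∷ []) (active-charged ∷ []))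

    placement-nonNegative : ∀ u → 0ℝ ≤ x u
    placement-nonNegative u@(v , i) = ≤-trans {0ℝ} {placement z u} {x u}
      (0≤∑ (subsets n) (λ A → barycentre A v · z (A , i))
        (λ A → 0≤· (barycentre A v) (z (A , i)) (0≤barycentre A v) (nonNegative (A , i))))
      (proj₁ (z↦x u))

    placement-sum : ∑ bs x ≈ 1ℝ
    placement-sum =
      ≈-trans {∑ bs x} {∑ bs (placement z)} {1ℝ}
        (∑-cong bs {x} {placement z} (λ u → ≈-sym {placement z u} {x u} (z↦x u)))
      (≈-trans {∑ bs (placement z)} {∑ ss scaled} {1ℝ}
        (seq-≡⇒≈ {∑ bs (placement z)} {∑ ss scaled} total)
      (≈-trans {∑ ss scaled} {∑ ss z} {1ℝ}
        (∑-cong ss {scaled} {z} (λ w → unscaled w (Subset.nonempty? (proj₁ w)))) sum))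
      where
      scaled : Vertex → ℝ
      scaled w = ∑ℚ bs (bary G w) · z w

      0≤∑bary : ∀ w → 0ℚ ℚ.≤ ∑ℚ bs (bary G w)
      0≤∑bary w = 0≤∑ℚ bs (0≤bary G w)

      unscaled : ∀ w → Dec (Nonempty (proj₁ w)) → scaled w ≈ z w
      unscaled w (yes ne) = seq-≡⇒≈ {scaled w} {z w} λ k → trans
        (cong (ℚ._* seq (z w) k) (trans (∑-bary G w) (∑-barycentre (proj₁ w) ne))) (ℚ.*-identityˡ (seq (z w) k))
      -- The empty set has no barycentre, but it is no vertex of HDL(G), so z vanishes on it.
      unscaled w (no ¬ne) = ≈-trans {scaled w} {0ℝ} {z w}
        (·-null (∑ℚ bs (bary G w)) (z w) (0≤∑bary w) z≈0) (≈-sym {z w} {0ℝ} z≈0)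
        where
        z≈0 : z w ≈ 0ℝ
        z≈0 = (λ pos → ¬ne (proj₁ (proj₁ (charged-flag (w ∷ []) (pos ∷ [])) (here refl)))) , nonNegative w

      total : ∀ k → seq (∑ bs (placement z)) k ≡ seq (∑ ss scaled) k
      total k = begin
        seq (∑ bs (placement z)) k
          ≡⟨ seq-∑ bs (placement z) k ⟩
        ∑ℚ bs (λ u → seq (placement z u) k)
          ≡⟨ ∑ℚ-cong bs (λ u → trans
               (seq-∑ (subsets n) (λ A → barycentre A (proj₁ u) · z (A , proj₂ u)) k)
               (sym (∑-bary* G (proj₁ u) (proj₂ u) (λ w → seq (z w) k)))) ⟩
        ∑ℚ bs (λ u → ∑ℚ ss (λ w → bary G w u ℚ.* seq (z w) k))
          ≡⟨ ∑ℚ-swap bs ss (λ u w → bary G w u ℚ.* seq (z w) k) ⟩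
        ∑ℚ ss (λ w → ∑ℚ bs (λ u → bary G w u ℚ.* seq (z w) k))
          ≡⟨ ∑ℚ-cong ss (λ w → ∑ℚ-* bs (bary G w) (seq (z w) k)) ⟩
        ∑ℚ ss (λ w → ∑ℚ bs (bary G w) ℚ.* seq (z w) k)
          ≡⟨ sym (seq-∑ ss scaled k) ⟩
        seq (∑ ss scaled) k ∎
        where open ≡-Reasoning

    placement-support : ∀ σ → All (λ u → 0ℝ < x u) σ → B G σ
    placement-support σ pos =
      let w , _ , 0<z = 0<∑⇒∃ ss z (<-≤-trans {0ℝ} {1ℝ} {∑ ss z} 0<1 (proj₂ sum))
          v₀ , _      = proj₁ (proj₁ (charged-flag (w ∷ []) (0<z ∷ [])) (here refl))
          τ , charged , covers = collect
            {P = λ w → 0ℝ < z w} {R = λ u w → proj₂ w ≡ proj₂ u × proj₁ u ∈ proj₁ w} σ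
            (λ {u} u∈ → let C , 0<zC , v∈C = cover (proj₁ u) (proj₂ u) (All.lookup pos u∈)
                        in (C , proj₂ u) , 0<zC , refl , v∈C)
      in covered⇒B (charged-flag τ (All.tabulate charged)) v₀
           (λ {v} {i} u∈ → spread τ v i (covers u∈))
      where
      spread : ∀ τ v i → (∃ λ w → w List.∈ τ × proj₂ w ≡ i × v ∈ proj₁ w) → ∃ λ A → (A , i) List.∈ τ × v ∈ A
      spread τ v i ((A , _) , w∈ , refl , v∈) = A , w∈ , v∈

    placement∈B : ∥B∥ G x
    placement∈B = record
      { nonNegative = placement-nonNegative
      ; sum         = placement-sum
      ; support     = placement-support
      }

  -- The properties of a strong deformation retract

  HDL⊆B : ∀ {x} → ∥HDL∥ G <ᵥ-isSTO x → ∥B∥ G x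
  HDL⊆B (z , z∈HDL , z↦x) = placement∈B z∈HDL z↦x

  HDL-invariant : ∀ x → ∥HDL∥ G <ᵥ-isSTO x → ∥HDL∥ G <ᵥ-isSTO (ν G x)
  HDL-invariant x (z , z∈HDL , z↦x) = z ∘ swap , record
    { nonNegative = nonNegative ∘ swap
    ; sum         = ≈-trans {∑ ss (z ∘ swap)} {∑ ss z} {1ℝ} (∑-swapped (subsets n) z) sum
    ; support     = λ σ pos → HDL-swap (support (map swap σ) (All.map⁺ pos))
    } , λ u → z↦x (swap u)
    where open Realization z∈HDL

  flow-fixed : ∀ x t → ∥B∥ G x → ∥HDL∥ G <ᵥ-isSTO x → flow x t ≋ x
  flow-fixed x t x∈B (z , z∈HDL , z↦x) u = stationary x t u (Realization.nonNegative x∈B u)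
    λ w 0<w → active-fixed z∈HDL z↦x (active x t w 0<w)

  -- No vertex is active at time zero, so the condition of `stationary` holds vacuously.
  flow-start : ∀ x t → ∥B∥ G x → t ≈ 0ℝ → flow x t ≋ x
  flow-start x t x∈B (t≤0 , _) u = stationary x t u (Realization.nonNegative x∈B u)
    λ w 0<w → contradiction (Active.time (active x t w 0<w)) t≤0

  -- Excess and weights of the swapped point are by definition those of x at swapped vertices; only
  -- the barycentres require `J-swap`, followed by a reindexing of the sum.
  flow-equivariant : ∀ x t → flow (ν G x) t ≋ ν G (flow x t)
  flow-equivariant x t u = seq-≡⇒≈ {flow (ν G x) t u} {flow x t (swap u)} λ k →
    cong (excessℚ (swap u) (env x t at k) ℚ.+_) (begin
      ∑ℚ ss (λ w → bary G (J w) u ℚ.* weightℚ w (env (ν G x) t at k))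
        ≡⟨ ∑ℚ-cong ss (λ w → cong (ℚ._* weightℚ (swap w) (env x t at k))
             (trans (sym (bary-swap (J w) u)) (cong (λ w′ → bary G w′ (swap u)) (sym (J-swap w))))) ⟩
      ∑ℚ ss (λ w → bary G (J (swap w)) (swap u) ℚ.* weightℚ (swap w) (env x t at k))
        ≡⟨ ∑ℚ-swapped (subsets n) (λ w → bary G (J w) (swap u) ℚ.* weightℚ w (env x t at k)) ⟩
      ∑ℚ ss (λ w → bary G (J w) (swap u) ℚ.* weightℚ w (env x t at k)) ∎)
    where open ≡-Reasoning

  -- The minimum of the radii for the finitely many coordinates, hence uniform in the point and the
  -- time.
  flow-near : ∀ ε → 0ℚ ℚ.< ε → ∃ λ δ → 0ℚ ℚ.< δ ×
              (∀ x x′ t t′ → Near∞ δ x x′ → Near δ t t′ → Near∞ ε (flow x t) (flow x′ t′))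
  flow-near ε 0<ε = let δ , 0<δ , near = common (boxVertices G) in
    δ , 0<δ , λ x x′ t t′ x∼x′ t∼t′ u → near x x′ t t′ x∼x′ t∼t′
      (List.∈-cartesianProduct⁺ (List.∈-allFin (proj₁ u)) (List.∈-allFin (proj₂ u)))
    where
    Controls : ℚ → List (Fin n × Fin 2) → Set
    Controls δ us = ∀ x x′ t t′ → Near∞ δ x x′ → Near δ t t′ →
                    ∀ {u} → u List.∈ us → Near ε (flow x t u) (flow x′ t′ u)

    0<⊓ : ∀ p q → 0ℚ ℚ.< p → 0ℚ ℚ.< q → 0ℚ ℚ.< p ℚ.⊓ q
    0<⊓ p q 0<p 0<q = Sum.[ (λ eq → subst (0ℚ ℚ.<_) (sym eq) 0<p) , (λ eq → subst (0ℚ ℚ.<_) (sym eq) 0<q) ]′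
      (ℚ.⊓-sel p q)

    common : ∀ us → ∃ λ δ → 0ℚ ℚ.< δ × Controls δ us
    common []       = 1ℚ , ℚ.positive⁻¹ 1ℚ , λ _ _ _ _ _ _ ()
    common (u ∷ us) = extend (lift-near (lip-flow u) ε 0<ε) (common us)
      where
      extend : (∃ λ δ → 0ℚ ℚ.< δ × (∀ ρ ρ′ → (∀ k → Near δ (ρ k) (ρ′ k)) →
                                    Near ε (lift (lip-flow u) ρ) (lift (lip-flow u) ρ′))) →
               (∃ λ δ → 0ℚ ℚ.< δ × Controls δ us) → ∃ λ δ → 0ℚ ℚ.< δ × Controls δ (u ∷ us)
      extend (δ , 0<δ , f) (δ′ , 0<δ′ , g) = δ ℚ.⊓ δ′ , 0<⊓ δ δ′ 0<δ 0<δ′ , control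
        where
        control : Controls (δ ℚ.⊓ δ′) (u ∷ us)
        control x x′ t t′ x∼x′ t∼t′ (here refl) = f (env x t) (env x′ t′) λ where
          nothing  → Near-mono {t} {t′} {δ ℚ.⊓ δ′} {δ} (ℚ.p⊓q≤p δ δ′) t∼t′
          (just v) → Near-mono {x v} {x′ v} {δ ℚ.⊓ δ′} {δ} (ℚ.p⊓q≤p δ δ′) (x∼x′ v)
        control x x′ t t′ x∼x′ t∼t′ (there u∈) = g x x′ t t′
          (λ v → Near-mono {x v} {x′ v} {δ ℚ.⊓ δ′} {δ′} (ℚ.p⊓q≤q δ δ′) (x∼x′ v))
          (Near-mono {t} {t′} {δ ℚ.⊓ δ′} {δ′} (ℚ.p⊓q≤q δ δ′) t∼t′) u∈

  isStrongZ₂DeformationRetract : IsStrongZ₂DeformationRetract (∥B∥ G) (ν G) (∥HDL∥ G <ᵥ-isSTO)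
  isStrongZ₂DeformationRetract = record
    { isZ₂Space  = ν-isZ₂Space
    ; subspace   = HDL⊆B
    ; invariant  = HDL-invariant
    ; F          = λ (x , x∈B) (t , _) → flow x t , flow∈B x∈B t
    ; continuous = λ (x , _) (t , _) ε 0<ε → let δ , 0<δ , near = flow-near ε 0<ε in
        δ , 0<δ , λ (x′ , _) (t′ , _) → near x x′ t t′
    ; start      = λ (x , x∈B) (t , _) → flow-start x t x∈B
    ; end        = λ (x , x∈B) (t , _) → End.flow∈HDL x∈B t
    ; fixed      = λ (x , x∈B) (t , _) → flow-fixed x t x∈B
    ; equivar    = λ (x , _) (t , _) → flow-equivariant x t
    }

theorem3 : ∀ {n : ℕ} (G : Graph n) → Connected G →
           ∀ {_<ᵥ_ : Rel (Fin n) 0ℓ} (<ᵥ-isSTO : IsStrictTotalOrder _≡_ _<ᵥ_) →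
           IsStrongZ₂DeformationRetract (∥B∥ G) (ν G) (∥HDL∥ G <ᵥ-isSTO)
theorem3 G _ = Retraction.isStrongZ₂DeformationRetract G
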